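{- Let $n\ge 5$. Among all $n$-vertex bicyclic graphs having exactly two cycles, the graph $P_n^{3,3}$ has the maximum degree resistance distance, i.e. $D_R(G)\le D_R(P_n^{3,3})$ for every such graph $G$, and $$D_R(P_n^{3,3})=\frac{2}{3}n^3+n^2-19n+\frac{88}{3}.$$
   Context: All graphs are finite, simple and connected. For vertices $u,v$ of a graph $G$, the resistance distance $r(u,v)$ is the effective resistance between $u$ and $v$ in the electrical network obtained from $G$ by replacing every edge by a unit resistor. The degree resistance distance of $G$ is $D_R(G)=\sum_{\{u,v\}\subseteq V(G)}[d(u)+d(v)]\,r(u,v)$, where $d(u)$ is the degree of $u$ and the sum runs over unordered pairs of distinct vertices. A bicyclic graph is a connected graph with $|E(G)|=|V(G)|+1$. $P_n^{3,3}$ is the graph consisting of two vertex-disjoint triangles and a path of length $n-5$ joining a vertex of one triangle to a vertex of the other (for $n=5$, the two triangles share exactly one vertex). -}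

module Defs where

open import Data.Nat as ℕ using (ℕ; zero; suc; _<ᵇ_; _≡ᵇ_; _≤ᵇ_; _∸_)
open import Data.Integer as ℤ using (ℤ; +_)
open import Data.Rational as ℚ using (ℚ; _/_; 0ℚ; 1ℚ)
open import Data.Fin using (Fin; toℕ)
open import Data.Bool using (Bool; true; false; _∧_; _∨_; if_then_else_)
open import Data.Product using (Σ; ∃; _×_; _,_)
open import Data.Sum using (_⊎_)
open import Relation.Binary.PropositionalEquality using (_≡_; _≢_; refl; cong)
open import Data.Bool.Properties using (∨-comm)
open import Relation.Nullary using (¬_)

record Graph (n : ℕ) : Set where
  field
    adj   : Fin n → Fin n → Bool
    sym   : ∀ u v → adj u v ≡ adj v u
    irrefl : ∀ u → adj u u ≡ false
open Graph public

∑ℕ : ∀ {n} → (Fin n → ℕ) → ℕ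
∑ℕ {zero} f = 0
∑ℕ {suc n} f = f Fin.zero ℕ.+ ∑ℕ (λ i → f (Fin.suc i))
  where import Data.Fin as Fin

∑ : ∀ {n} → (Fin n → ℚ) → ℚ
∑ {zero} f = 0ℚ
∑ {suc n} f = f Fin.zero ℚ.+ ∑ (λ i → f (Fin.suc i))
  where import Data.Fin as Fin

b2ℕ : Bool → ℕ
b2ℕ true = 1
b2ℕ false = 0

b2ℚ : Bool → ℚ
b2ℚ true = 1ℚ
b2ℚ false = 0ℚ

ℕ→ℚ : ℕ → ℚ
ℕ→ℚ k = (+ k) / 1

degE : ∀ {n} → (Fin n → Fin n → Bool) → Fin n → ℕ
degE E u = ∑ℕ (λ v → b2ℕ (E u v))

deg : ∀ {n} → Graph n → Fin n → ℕ
deg G = degE (adj G)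

edgeCount : ∀ {n} → Graph n → ℕ
edgeCount G = ∑ℕ (λ u → ∑ℕ (λ v → b2ℕ ((toℕ u <ᵇ toℕ v) ∧ adj G u v)))

data Reach {n} (E : Fin n → Fin n → Bool) : Fin n → Fin n → Set where
  here : ∀ {u} → Reach E u u
  step : ∀ {u v w} → E u v ≡ true → Reach E v w → Reach E u w

Connected : ∀ {n} → Graph n → Set
Connected G = ∀ u v → Reach (adj G) u v

Bicyclic : ∀ {n} → Graph n → Set
Bicyclic {n} G = Connected G × edgeCount G ≡ suc n

-- A cycle of G, as its edge set C: a nonempty, symmetric subgraph of G
-- in which every vertex has degree 0 or 2 and whose non-isolated
-- vertices are mutually reachable (a connected 2-regular subgraph).
record IsCycle {n} (G : Graph n) (C : Fin n → Fin n → Bool) : Set where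
  field
    csym     : ∀ u v → C u v ≡ C v u
    sub      : ∀ u v → C u v ≡ true → adj G u v ≡ true
    nonempty : ∃ λ u → ∃ λ v → C u v ≡ true
    deg02    : ∀ u → degE C u ≡ 0 ⊎ degE C u ≡ 2
    conn     : ∀ u v → degE C u ≢ 0 → degE C v ≢ 0 → Reach C u v

SameEdges : ∀ {n} → (Fin n → Fin n → Bool) → (Fin n → Fin n → Bool) → Set
SameEdges C D = ∀ u v → C u v ≡ D u v

ExactlyTwoCycles : ∀ {n} → Graph n → Set
ExactlyTwoCycles G =
  Σ _ λ C₁ → Σ _ λ C₂ →
    IsCycle G C₁ × IsCycle G C₂ × ¬ SameEdges C₁ C₂ ×
    (∀ C → IsCycle G C → SameEdges C C₁ ⊎ SameEdges C C₂)

-- Electrical potential: φ is a vertex potential when a unit current enters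
-- at u and leaves at v (unit resistors; Kirchhoff's current law + Ohm's law):
-- for every x, Σ_w [x~w] (φ x − φ w) = δ(x,u) − δ(x,v).
δ : ∀ {n} → Fin n → Fin n → ℚ
δ x u = b2ℚ (toℕ x ≡ᵇ toℕ u)

IsPotential : ∀ {n} → Graph n → Fin n → Fin n → (Fin n → ℚ) → Set
IsPotential G u v φ =
  ∀ x → ∑ (λ w → b2ℚ (adj G x w) ℚ.* (φ x ℚ.- φ w)) ≡ δ x u ℚ.- δ x v

IsResistance : ∀ {n} → Graph n → (Fin n → Fin n → ℚ) → Set
IsResistance G r = ∀ u v → ∃ λ φ → IsPotential G u v φ × r u v ≡ φ u ℚ.- φ v

DR : ∀ {n} → Graph n → (Fin n → Fin n → ℚ) → ℚ
DR G r = ∑ (λ u → ∑ (λ v →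
  b2ℚ (toℕ u <ᵇ toℕ v) ℚ.* (ℕ→ℚ (deg G u ℕ.+ deg G v) ℚ.* r u v)))

-- P_n^{3,3}: triangles {0,1,2} and {n-3,n-2,n-1}, path 2,3,...,n-3
-- (for n = 5 the triangles share vertex 2).
edgeℕ : ℕ → ℕ → ℕ → Bool
edgeℕ n a b =
     ((a ≡ᵇ 0) ∧ (b ≡ᵇ 1)) ∨ ((a ≡ᵇ 0) ∧ (b ≡ᵇ 2)) ∨ ((a ≡ᵇ 1) ∧ (b ≡ᵇ 2))
  ∨ ((a ≡ᵇ (n ∸ 3)) ∧ (b ≡ᵇ (n ∸ 2))) ∨ ((a ≡ᵇ (n ∸ 3)) ∧ (b ≡ᵇ (n ∸ 1)))
  ∨ ((a ≡ᵇ (n ∸ 2)) ∧ (b ≡ᵇ (n ∸ 1)))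
  ∨ ((b ≡ᵇ suc a) ∧ (2 ≤ᵇ a) ∧ (b ≤ᵇ (n ∸ 3)))

adjP : (n : ℕ) → Fin n → Fin n → Bool
adjP n u v = ((toℕ u <ᵇ toℕ v) ∧ edgeℕ n (toℕ u) (toℕ v))
           ∨ ((toℕ v <ᵇ toℕ u) ∧ edgeℕ n (toℕ v) (toℕ u))

private
  <ᵇ-irrefl : ∀ k → (k <ᵇ k) ≡ false
  <ᵇ-irrefl zero = refl
  <ᵇ-irrefl (suc k) = <ᵇ-irrefl k

P33 : (n : ℕ) → Graph n
P33 n = record
  { adj = adjP n
  ; sym = λ u v → ∨-comm ((toℕ u <ᵇ toℕ v) ∧ edgeℕ n (toℕ u) (toℕ v))
                         ((toℕ v <ᵇ toℕ u) ∧ edgeℕ n (toℕ v) (toℕ u))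
  ; irrefl = λ u → cong (λ b → (b ∧ edgeℕ n (toℕ u) (toℕ u)) ∨ (b ∧ edgeℕ n (toℕ u) (toℕ u))) (<ᵇ-irrefl (toℕ u))
  }

{-# OPTIONS --safe #-}
-- Effective resistance is additive across a pendant vertex, and adding an edge between the ends c, y of a
-- pendant path changes all resistances by the rank-one term (ψ u − ψ v)² / (ℓ + 1), where ψ is the unit
-- potential of the path and ℓ its length. Hence the resistance sums at a vertex, at a vertex weighted by
-- degree, and over all pairs satisfy explicit recursions. Attaching pendant vertices at an extremal vertex
-- preserves polynomial upper bounds in the number of vertices. A unicyclic graph without pendant vertices is a
-- cycle, that is, a path closed by one edge. A bicyclic graph with exactly two cycles and no pendant vertices
-- has a cycle with a single vertex y of degree above 2: otherwise both cycles pass through a vertex of degree 3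
-- and their symmetric difference contains a third cycle. Deleting an edge at y of that cycle leaves a unicyclic
-- graph with a pendant path, for which the bounds are known; the resulting polynomial inequality in the cycle
-- length is sharp exactly for triangles. For P_n^{3,3} every step is an equality.
module Submission where

open import Defs
open import Data.Nat using (ℕ; _≤_)
open import Data.Integer using (+_)
open import Data.Rational using (ℚ; _/_; _+_; _-_; _*_) renaming (_≤_ to _≤ℚ_)
open import Data.Product using (_×_)
open import Relation.Binary.PropositionalEquality using (_≡_)

open import Data.Nat as ℕ using (zero; suc; z≤n; s≤s; _≡ᵇ_; _≤ᵇ_; _<ᵇ_)
import Data.Nat.Properties as ℕ
open import Algebra.Properties.CommutativeSemigroup ℕ.+-commutativeSemigroup using () renaming (interchange to +-interchange)
open import Data.Nat.Solver using () renaming (module +-*-Solver to ℕ-Solver)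
import Data.Integer as ℤ
import Data.Integer.Properties as ℤ
open import Data.Rational as ℚ using (0ℚ; 1ℚ; -_)
import Data.Rational.Properties as ℚ
import Data.Rational.Unnormalised as ℚᵘ
import Data.Rational.Unnormalised.Properties as ℚᵘ
open import Data.Rational.Solver using (module +-*-Solver)
open +-*-Solver using (solve; _:=_; _:+_; _:*_; _:-_; :-_; con)
open import Data.Bool using (Bool; true; false; _∧_; _∨_; _xor_; not; if_then_else_) renaming (T to True)
open import Data.Bool.Properties using (∧-comm; ∧-idem; ∧-zeroʳ; ∨-assoc; ∨-comm; ∨-identityʳ)
import Data.Bool.Solver
module B = Data.Bool.Solver.∨-∧-Solver
open import Data.Fin using (Fin; zero; suc; toℕ; fromℕ<)
import Data.Fin.Properties as Fin
open import Data.Product using (∃; _,_; proj₁; proj₂)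
open import Data.Sum using (_⊎_; inj₁; inj₂; [_,_]′)
open import Data.Empty using (⊥; ⊥-elim)
open import Data.Unit using (tt)
open import Relation.Binary.Definitions using (tri<; tri≈; tri>)
open import Relation.Nullary using (¬_)
open import Function using (_∘_; case_of_)
open import Relation.Binary.PropositionalEquality
  using (_≢_; refl; trans; cong; cong₂; subst; subst₂; module ≡-Reasoning)
  renaming (sym to ≡-sym)

-- The degree resistance distance alone admits no induction. Attaching a pendant vertex at `y`
-- raises `total` by twice the resistance sum at `y` plus the degree-weighted one, up to a linear
-- term; bounding these sums at an old vertex in turn needs a bound on single resistances. So four
-- bounds travel together in `Bounded`, and, for the triangle with a tail, three equalities at the
-- end of the tail in `Exact`. Every step passes from a network to a smaller one: removing a pendant
-- vertex keeps `r`, removing an edge of a cycle adds a multiple of a square. The potentials of the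
-- smaller network come from those of the larger one, so none has to be constructed for a general
-- graph; only the potential of a path is written down. Vertices are deleted by shrinking a vertex
-- set inside the fixed type `Fin n`, without relabelling. Deleting one edge of the end cycle,
-- instead of cutting the cycle off, keeps the number N of vertices. The unicyclic bounds for N
-- apply at once, and the cycle length enters the bound for `total` only through the polynomial
-- `gain`.

private
  variable
    n : ℕ

-- Kronecker deltas on vertices

eqb : Fin n → Fin n → Bool
eqb x u = toℕ x ≡ᵇ toℕ u

eqb-refl : (x : Fin n) → eqb x x ≡ true
eqb-refl zero    = refl
eqb-refl (suc x) = eqb-refl x

eqb⇒≡ : (x u : Fin n) → eqb x u ≡ true → x ≡ u
eqb⇒≡ zero    zero    _ = refl
eqb⇒≡ (suc x) (suc u) e = cong suc (eqb⇒≡ x u e)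

≢⇒eqb : {x u : Fin n} → x ≢ u → eqb x u ≡ false
≢⇒eqb {x = x} {u} x≢u with eqb x u in e
... | true  = ⊥-elim (x≢u (eqb⇒≡ x u e))
... | false = refl

δ-refl : (x : Fin n) → δ x x ≡ 1ℚ
δ-refl x = cong b2ℚ (eqb-refl x)

δ-≢ : {x u : Fin n} → x ≢ u → δ x u ≡ 0ℚ
δ-≢ x≢u = cong b2ℚ (≢⇒eqb x≢u)

δ-subst : (f : Fin n → ℚ) (x u : Fin n) → δ x u * f x ≡ δ x u * f u
δ-subst f x u with eqb x u in e
... | true  = cong (λ y → 1ℚ * f y) (eqb⇒≡ x u e)
... | false = trans (ℚ.*-zeroˡ (f x)) (≡-sym (ℚ.*-zeroˡ (f u)))

δℕ : Fin n → Fin n → ℕ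
δℕ x u = b2ℕ (eqb x u)

δℕ-refl : (x : Fin n) → δℕ x x ≡ 1
δℕ-refl x = cong b2ℕ (eqb-refl x)

δℕ-≢ : {x u : Fin n} → x ≢ u → δℕ x u ≡ 0
δℕ-≢ x≢u = cong b2ℕ (≢⇒eqb x≢u)

-- Embedding of ℕ

ι : ℕ → ℚ
ι = ℕ→ℚ

ι-ᵘ : ∀ a → ℚ.toℚᵘ (ι a) ℚᵘ.≃ (+ a) ℚᵘ./ 1
ι-ᵘ a = ℚ.toℚᵘ-fromℚᵘ ((+ a) ℚᵘ./ 1)

ι-+ : ∀ a b → ι (a ℕ.+ b) ≡ ι a + ι b
ι-+ a b = ℚ.toℚᵘ-injective (begin
  ℚ.toℚᵘ (ι (a ℕ.+ b))
    ≈⟨ ι-ᵘ (a ℕ.+ b) ⟩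
  (+ (a ℕ.+ b)) ℚᵘ./ 1
    ≈⟨ ℚᵘ.*≡* (cong (ℤ._* (+ 1)) (trans (ℤ.pos-+ a b) (≡-sym (cong₂ ℤ._+_ (ℤ.*-identityʳ (+ a)) (ℤ.*-identityʳ (+ b)))))) ⟩
  (+ a) ℚᵘ./ 1 ℚᵘ.+ (+ b) ℚᵘ./ 1 ≈⟨ ℚᵘ.+-cong (ι-ᵘ a) (ι-ᵘ b) ⟨
  ℚ.toℚᵘ (ι a) ℚᵘ.+ ℚ.toℚᵘ (ι b) ≈⟨ ℚ.toℚᵘ-homo-+ (ι a) (ι b) ⟨
  ℚ.toℚᵘ (ι a + ι b) ∎)
  where open ℚᵘ.≃-Reasoning

ι-suc : ∀ a → ι (suc a) ≡ ι a + 1ℚ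
ι-suc a = trans (cong ι (ℕ.+-comm 1 a)) (ι-+ a 1)

ι-* : ∀ a b → ι (a ℕ.* b) ≡ ι a * ι b
ι-* zero    b = ≡-sym (ℚ.*-zeroˡ (ι b))
ι-* (suc a) b = begin
  ι (b ℕ.+ a ℕ.* b)
    ≡⟨ ι-+ b (a ℕ.* b) ⟩
  ι b + ι (a ℕ.* b)
    ≡⟨ cong (λ t → ι b + t) (ι-* a b) ⟩
  ι b + ι a * ι b
    ≡⟨ solve 2 (λ a b → b :+ a :* b := (a :+ con 1ℚ) :* b) refl (ι a) (ι b) ⟩
  (ι a + 1ℚ) * ι b
    ≡⟨ cong (_* ι b) (ι-suc a) ⟨
  ι (suc a) * ι b ∎
  where open ≡-Reasoning

0≤1 : 0ℚ ≤ℚ 1ℚ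
0≤1 = ℚ.nonNegative⁻¹ 1ℚ

0≤ι : ∀ a → 0ℚ ≤ℚ ι a
0≤ι zero    = ℚ.≤-refl
0≤ι (suc a) = subst (0ℚ ≤ℚ_) (≡-sym (ι-suc a)) (ℚ.+-mono-≤ (0≤ι a) 0≤1)

b2ℚ-ι : ∀ b → b2ℚ b ≡ ι (b2ℕ b)
b2ℚ-ι true  = refl
b2ℚ-ι false = refl

-- Finite sums

∑-cong : {f g : Fin n → ℚ} → (∀ i → f i ≡ g i) → ∑ f ≡ ∑ g
∑-cong {zero}  e = refl
∑-cong {suc n} e = cong₂ _+_ (e zero) (∑-cong (e ∘ suc))

∑-mono : {f g : Fin n → ℚ} → (∀ i → f i ≤ℚ g i) → ∑ f ≤ℚ ∑ g
∑-mono {zero}  e = ℚ.≤-refl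
∑-mono {suc n} e = ℚ.+-mono-≤ (e zero) (∑-mono (e ∘ suc))

∑-zero : ∑ {n} (λ _ → 0ℚ) ≡ 0ℚ
∑-zero {zero}  = refl
∑-zero {suc n} = trans (ℚ.+-identityˡ _) (∑-zero {n})

∑-*-zero : (f : Fin n → ℚ) → ∑ (λ i → f i * 0ℚ) ≡ 0ℚ
∑-*-zero {n} f = trans (∑-cong (λ i → ℚ.*-zeroʳ (f i))) (∑-zero {n})

∑-+ : (f g : Fin n → ℚ) → ∑ (λ i → f i + g i) ≡ ∑ f + ∑ g
∑-+ {zero}  f g = refl
∑-+ {suc n} f g = trans (cong (λ t → (f zero + g zero) + t) (∑-+ (f ∘ suc) (g ∘ suc)))
  (solve 4 (λ a b c d → (a :+ b) :+ (c :+ d) := (a :+ c) :+ (b :+ d)) refl (f zero) (g zero) (∑ (f ∘ suc)) (∑ (g ∘ suc)))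

∑-*ˡ : (c : ℚ) (f : Fin n → ℚ) → ∑ (λ i → c * f i) ≡ c * ∑ f
∑-*ˡ {zero}  c f = ≡-sym (ℚ.*-zeroʳ c)
∑-*ˡ {suc n} c f = trans (cong (λ t → c * f zero + t) (∑-*ˡ c (f ∘ suc))) (≡-sym (ℚ.*-distribˡ-+ c (f zero) (∑ (f ∘ suc))))

∑-*ʳ : (c : ℚ) (f : Fin n → ℚ) → ∑ (λ i → f i * c) ≡ ∑ f * c
∑-*ʳ c f = trans (∑-cong (λ i → ℚ.*-comm (f i) c)) (trans (∑-*ˡ c f) (ℚ.*-comm c (∑ f)))

∑-- : (f g : Fin n → ℚ) → ∑ (λ i → f i - g i) ≡ ∑ f - ∑ g
∑-- f g = trans (∑-+ f (λ i → - g i)) (cong (λ t → ∑ f + t)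
  (trans (∑-cong (λ i → neg-* (g i))) (trans (∑-*ˡ (- 1ℚ) g) (≡-sym (neg-* (∑ g))))))
  where
  neg-* : ∀ x → - x ≡ (- 1ℚ) * x
  neg-* = solve 1 (λ x → :- x := con (- 1ℚ) :* x) refl

∑-swap : ∀ {m} (f : Fin m → Fin n → ℚ) → ∑ (λ i → ∑ (λ j → f i j)) ≡ ∑ (λ j → ∑ (λ i → f i j))
∑-swap {n} {zero}  f = ≡-sym (∑-zero {n})
∑-swap {n} {suc m} f = trans (cong (λ t → ∑ (f zero) + t) (∑-swap (f ∘ suc)))
  (≡-sym (∑-+ (f zero) (λ j → ∑ (λ i → f (suc i) j))))

∑-δ : (f : Fin n → ℚ) (u : Fin n) → ∑ (λ x → δ x u * f x) ≡ f u
∑-δ {suc n} f zero = begin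
  1ℚ * f zero + ∑ (λ x → 0ℚ * f (suc x)) ≡⟨ cong₂ _+_ (ℚ.*-identityˡ (f zero)) (trans (∑-cong (λ x → ℚ.*-zeroˡ (f (suc x)))) (∑-zero {n})) ⟩
  f zero + 0ℚ
    ≡⟨ ℚ.+-identityʳ (f zero) ⟩
  f zero ∎
  where open ≡-Reasoning
∑-δ {suc n} f (suc u) = begin
  0ℚ * f zero + ∑ (λ x → δ x u * f (suc x)) ≡⟨ cong₂ _+_ (ℚ.*-zeroˡ (f zero)) (∑-δ (f ∘ suc) u) ⟩
  0ℚ + f (suc u)
    ≡⟨ ℚ.+-identityˡ (f (suc u)) ⟩
  f (suc u) ∎
  where open ≡-Reasoning

∑ℕ-cong : {f g : Fin n → ℕ} → (∀ i → f i ≡ g i) → ∑ℕ f ≡ ∑ℕ g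
∑ℕ-cong {zero}  e = refl
∑ℕ-cong {suc n} e = cong₂ ℕ._+_ (e zero) (∑ℕ-cong (e ∘ suc))

∑ℕ-mono : {f g : Fin n → ℕ} → (∀ i → f i ≤ g i) → ∑ℕ f ≤ ∑ℕ g
∑ℕ-mono {zero}  e = z≤n
∑ℕ-mono {suc n} e = ℕ.+-mono-≤ (e zero) (∑ℕ-mono (e ∘ suc))

∑ℕ-zero : ∑ℕ {n} (λ _ → 0) ≡ 0
∑ℕ-zero {zero}  = refl
∑ℕ-zero {suc n} = ∑ℕ-zero {n}

∑ℕ-+ : (f g : Fin n → ℕ) → ∑ℕ (λ i → f i ℕ.+ g i) ≡ ∑ℕ f ℕ.+ ∑ℕ g
∑ℕ-+ {zero}  f g = refl
∑ℕ-+ {suc n} f g = trans (cong (f zero ℕ.+ g zero ℕ.+_) (∑ℕ-+ (f ∘ suc) (g ∘ suc)))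
  (+-interchange (f zero) (g zero) (∑ℕ (f ∘ suc)) (∑ℕ (g ∘ suc)))

∑ℕ-*ˡ : (c : ℕ) (f : Fin n → ℕ) → ∑ℕ (λ i → c ℕ.* f i) ≡ c ℕ.* ∑ℕ f
∑ℕ-*ˡ {zero}  c f = ≡-sym (ℕ.*-zeroʳ c)
∑ℕ-*ˡ {suc n} c f = trans (cong (c ℕ.* f zero ℕ.+_) (∑ℕ-*ˡ c (f ∘ suc))) (≡-sym (ℕ.*-distribˡ-+ c (f zero) (∑ℕ (f ∘ suc))))

∑ℕ-swap : ∀ {m} (f : Fin m → Fin n → ℕ) → ∑ℕ (λ i → ∑ℕ (λ j → f i j)) ≡ ∑ℕ (λ j → ∑ℕ (λ i → f i j))
∑ℕ-swap {n} {zero}  f = ≡-sym (∑ℕ-zero {n})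
∑ℕ-swap {n} {suc m} f = trans (cong (∑ℕ (f zero) ℕ.+_) (∑ℕ-swap (f ∘ suc)))
  (≡-sym (∑ℕ-+ (f zero) (λ j → ∑ℕ (λ i → f (suc i) j))))

∑ℕ-δ : (u : Fin n) → ∑ℕ (λ x → δℕ x u) ≡ 1
∑ℕ-δ {suc n} zero    = cong suc (∑ℕ-zero {n})
∑ℕ-δ {suc n} (suc u) = ∑ℕ-δ u

ι-∑ : (f : Fin n → ℕ) → ι (∑ℕ f) ≡ ∑ (λ i → ι (f i))
ι-∑ {zero}  f = refl
ι-∑ {suc n} f = trans (ι-+ (f zero) (∑ℕ (f ∘ suc))) (cong (λ t → ι (f zero) + t) (ι-∑ (f ∘ suc)))

∑ℕ≡0 : (f : Fin n → ℕ) → ∑ℕ f ≡ 0 → ∀ i → f i ≡ 0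
∑ℕ≡0 f e zero    = ℕ.m+n≡0⇒m≡0 (f zero) e
∑ℕ≡0 f e (suc i) = ∑ℕ≡0 (f ∘ suc) (ℕ.m+n≡0⇒n≡0 (f zero) e) i

term≤∑ℕ : (f : Fin n → ℕ) (i : Fin n) → f i ≤ ∑ℕ f
term≤∑ℕ f zero    = ℕ.m≤m+n (f zero) _
term≤∑ℕ f (suc i) = ℕ.≤-trans (term≤∑ℕ (f ∘ suc) i) (ℕ.m≤n+m _ (f zero))


-- The gaps `g j ∸ f j` sum to zero. Every counting argument below that forces degrees or
-- neighbourhoods to agree rests on this.
∑ℕ-tight : (f g : Fin n → ℕ) → (∀ i → f i ≤ g i) → ∑ℕ f ≡ ∑ℕ g → ∀ i → f i ≡ g i
∑ℕ-tight f g f≤g e i = ℕ.≤-antisym (f≤g i) (ℕ.m∸n≡0⇒m≤n (∑ℕ≡0 (λ j → g j ℕ.∸ f j) gap≡0 i))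
  where
  gap≡0 : ∑ℕ (λ j → g j ℕ.∸ f j) ≡ 0
  gap≡0 = ℕ.+-cancelˡ-≡ (∑ℕ f) _ _ (begin
    ∑ℕ f ℕ.+ ∑ℕ (λ j → g j ℕ.∸ f j)
      ≡⟨ ∑ℕ-+ f (λ j → g j ℕ.∸ f j) ⟨
    ∑ℕ (λ j → f j ℕ.+ (g j ℕ.∸ f j))
      ≡⟨ ∑ℕ-cong (λ j → ℕ.m+[n∸m]≡n (f≤g j)) ⟩
    ∑ℕ g
      ≡⟨ e ⟨
    ∑ℕ f
      ≡⟨ ℕ.+-identityʳ (∑ℕ f) ⟨
    ∑ℕ f ℕ.+ 0 ∎)
    where open ≡-Reasoning

EdgeSet : ℕ → Set
EdgeSet n = Fin n → Fin n → Bool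

VertexSet : ℕ → Set
VertexSet n = Fin n → Bool

Sym : EdgeSet n → Set
Sym E = ∀ u v → E u v ≡ E v u

-- Electrical networks

lap : EdgeSet n → (Fin n → ℚ) → Fin n → ℚ
lap E φ x = ∑ (λ w → b2ℚ (E x w) * (φ x - φ w))

Potential : EdgeSet n → Fin n → Fin n → (Fin n → ℚ) → Set
Potential E u v φ = ∀ x → lap E φ x ≡ δ x u - δ x v

pairing : (f : Fin n → ℚ) (u v : Fin n) → ∑ (λ x → f x * (δ x u - δ x v)) ≡ f u - f v
pairing f u v = begin
  ∑ (λ x → f x * (δ x u - δ x v))
    ≡⟨ ∑-cong (λ x → solve 3 (λ f a b → f :* (a :- b) := a :* f :- b :* f) refl (f x) (δ x u) (δ x v)) ⟩
  ∑ (λ x → δ x u * f x - δ x v * f x)             ≡⟨ ∑-- (λ x → δ x u * f x) (λ x → δ x v * f x) ⟩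
  ∑ (λ x → δ x u * f x) - ∑ (λ x → δ x v * f x)
    ≡⟨ cong₂ _-_ (∑-δ f u) (∑-δ f v) ⟩
  f u - f v ∎
  where open ≡-Reasoning

module _ {E : EdgeSet n} (sym-E : Sym E) where

  -- Expanded into products, the diagonal part is symmetric in φ and ψ at once; the cross part
  -- becomes so after exchanging the two summations and using that `E` is symmetric.
  lap-selfadjoint : ∀ φ ψ → ∑ (λ x → ψ x * lap E φ x) ≡ ∑ (λ x → φ x * lap E ψ x)
  lap-selfadjoint φ ψ = begin
    ∑ (λ x → ψ x * lap E φ x)
      ≡⟨ expand φ ψ ⟩
    diag φ ψ - cross φ ψ
      ≡⟨ cong₂ _-_ diag-comm cross-comm ⟩
    diag ψ φ - cross ψ φ
      ≡⟨ expand ψ φ ⟨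
    ∑ (λ x → φ x * lap E ψ x) ∎
    where
    open ≡-Reasoning
    diag cross : (Fin _ → ℚ) → (Fin _ → ℚ) → ℚ
    diag  φ ψ = ∑ (λ x → ∑ (λ w → b2ℚ (E x w) * (ψ x * φ x)))
    cross φ ψ = ∑ (λ x → ∑ (λ w → b2ℚ (E x w) * (ψ x * φ w)))
    expand : ∀ φ ψ → ∑ (λ x → ψ x * lap E φ x) ≡ diag φ ψ - cross φ ψ
    expand φ ψ = trans (∑-cong λ x → begin
      ψ x * lap E φ x
        ≡⟨ ∑-*ˡ (ψ x) (λ w → b2ℚ (E x w) * (φ x - φ w)) ⟨
      ∑ (λ w → ψ x * (b2ℚ (E x w) * (φ x - φ w)))
        ≡⟨ ∑-cong (λ w → solve 4 (λ p e a b → p :* (e :* (a :- b)) := e :* (p :* a) :- e :* (p :* b)) refl (ψ x) (b2ℚ (E x w)) (φ x) (φ w)) ⟩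
      ∑ (λ w → b2ℚ (E x w) * (ψ x * φ x) - b2ℚ (E x w) * (ψ x * φ w))
        ≡⟨ ∑-- (λ w → b2ℚ (E x w) * (ψ x * φ x)) (λ w → b2ℚ (E x w) * (ψ x * φ w)) ⟩
      ∑ (λ w → b2ℚ (E x w) * (ψ x * φ x)) - ∑ (λ w → b2ℚ (E x w) * (ψ x * φ w)) ∎)
      (∑-- (λ x → ∑ (λ w → b2ℚ (E x w) * (ψ x * φ x))) (λ x → ∑ (λ w → b2ℚ (E x w) * (ψ x * φ w))))
    diag-comm : diag φ ψ ≡ diag ψ φ
    diag-comm = ∑-cong (λ x → ∑-cong (λ w → cong (b2ℚ (E x w) *_) (ℚ.*-comm (ψ x) (φ x))))
    cross-comm : cross φ ψ ≡ cross ψ φ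
    cross-comm = trans (∑-swap (λ x w → b2ℚ (E x w) * (ψ x * φ w)))
      (∑-cong (λ w → ∑-cong (λ x → cong₂ (λ e p → b2ℚ e * p) (sym-E x w) (ℚ.*-comm (ψ x) (φ w)))))

  -- The pairing of one potential with the Laplacian of the other can be evaluated on either side.
  -- For equal pairs of terminals it shows that the drop does not depend on the potential chosen,
  -- which takes the place of a uniqueness theorem for potentials.
  reciprocity : ∀ {u v a b} φ ψ → Potential E u v φ → Potential E a b ψ → ψ u - ψ v ≡ φ a - φ b
  reciprocity {u} {v} {a} {b} φ ψ pφ pψ = begin
    ψ u - ψ v
      ≡⟨ pairing ψ u v ⟨
    ∑ (λ x → ψ x * (δ x u - δ x v))
      ≡⟨ ∑-cong (λ x → cong (ψ x *_) (pφ x)) ⟨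
    ∑ (λ x → ψ x * lap E φ x)
      ≡⟨ lap-selfadjoint φ ψ ⟩
    ∑ (λ x → φ x * lap E ψ x)
      ≡⟨ ∑-cong (λ x → cong (φ x *_) (pψ x)) ⟩
    ∑ (λ x → φ x * (δ x a - δ x b))
      ≡⟨ pairing φ a b ⟩
    φ a - φ b ∎
    where open ≡-Reasoning

-- `IsResistance` relative to a vertex set, so that a vertex can be deleted while the type of
-- vertices stays fixed. Potentials remain functions on all of `Fin n`.
Resistance : VertexSet n → EdgeSet n → (Fin n → Fin n → ℚ) → Set
Resistance S E r = ∀ u v → S u ≡ true → S v ≡ true → ∃ λ φ → Potential E u v φ × r u v ≡ φ u - φ v

module _ {S : VertexSet n} {E : EdgeSet n} {r : Fin n → Fin n → ℚ} (sym-E : Sym E) (res : Resistance S E r) where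

  r-diag : ∀ u → S u ≡ true → r u u ≡ 0ℚ
  r-diag u u∈ with φ , _ , e ← res u u u∈ u∈ = trans e (ℚ.+-inverseʳ (φ u))

  r-sym : ∀ u v → S u ≡ true → S v ≡ true → r u v ≡ r v u
  r-sym u v u∈ v∈ with φ , pφ , eφ ← res u v u∈ v∈ | ψ , pψ , eψ ← res v u v∈ u∈ = begin
    r u v
      ≡⟨ eφ ⟩
    φ u - φ v
      ≡⟨ solve 2 (λ a b → a :- b := :- (b :- a)) refl (φ u) (φ v) ⟩
    - (φ v - φ u)
      ≡⟨ cong -_ (reciprocity sym-E φ ψ pφ pψ) ⟨
    - (ψ u - ψ v)
      ≡⟨ solve 2 (λ a b → :- (a :- b) := b :- a) refl (ψ u) (ψ v) ⟩
    ψ v - ψ u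
      ≡⟨ eψ ⟨
    r v u ∎
    where open ≡-Reasoning

-- Adding an edge

-- As an equation of natural numbers it sums directly to degrees and Laplacians. Since its left side
-- is at most 1, it also forces `a` and `b` to differ and their edge to be absent from `E′`.
AddEdge : EdgeSet n → Fin n → Fin n → EdgeSet n → Set
AddEdge E′ a b E = ∀ u w → b2ℕ (E u w) ≡ b2ℕ (E′ u w) ℕ.+ (δℕ u a ℕ.* δℕ w b ℕ.+ δℕ u b ℕ.* δℕ w a)

module _ {E′ E : EdgeSet n} {a b : Fin n} (add : AddEdge E′ a b E) where

  private
    splitℚ : ∀ u w → b2ℚ (E u w) ≡ b2ℚ (E′ u w) + (δ u a * δ w b + δ u b * δ w a)
    splitℚ u w = begin
      b2ℚ (E u w)
        ≡⟨ b2ℚ-ι (E u w) ⟩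
      ι (b2ℕ (E u w))
        ≡⟨ cong ι (add u w) ⟩
      ι (b2ℕ (E′ u w) ℕ.+ (δℕ u a ℕ.* δℕ w b ℕ.+ δℕ u b ℕ.* δℕ w a))
        ≡⟨ ι-+ (b2ℕ (E′ u w)) _ ⟩
      ι (b2ℕ (E′ u w)) + ι (δℕ u a ℕ.* δℕ w b ℕ.+ δℕ u b ℕ.* δℕ w a)
        ≡⟨ cong₂ _+_ (≡-sym (b2ℚ-ι (E′ u w))) (trans (ι-+ (δℕ u a ℕ.* δℕ w b) _) (cong₂ _+_ (prod u a w b) (prod u b w a))) ⟩
      b2ℚ (E′ u w) + (δ u a * δ w b + δ u b * δ w a) ∎
      where
      open ≡-Reasoning
      prod : ∀ (u a w b : Fin n) → ι (δℕ u a ℕ.* δℕ w b) ≡ δ u a * δ w b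
      prod u a w b = trans (ι-* (δℕ u a) (δℕ w b)) (≡-sym (cong₂ _*_ (b2ℚ-ι (eqb u a)) (b2ℚ-ι (eqb w b))))

  ∑-edge : ∀ (f : Fin n → ℚ) u → ∑ (λ w → b2ℚ (E u w) * f w) ≡ ∑ (λ w → b2ℚ (E′ u w) * f w) + (δ u a * f b + δ u b * f a)
  ∑-edge f u = begin
    ∑ (λ w → b2ℚ (E u w) * f w)
      ≡⟨ ∑-cong (λ w → trans (cong (_* f w) (splitℚ u w))
           (solve 6 (λ e p q s t f → (e :+ (p :* q :+ s :* t)) :* f := e :* f :+ (p :* (q :* f) :+ s :* (t :* f))) refl
             (b2ℚ (E′ u w)) (δ u a) (δ w b) (δ u b) (δ w a) (f w))) ⟩
    ∑ (λ w → b2ℚ (E′ u w) * f w + (δ u a * (δ w b * f w) + δ u b * (δ w a * f w)))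
      ≡⟨ ∑-+ (λ w → b2ℚ (E′ u w) * f w) _ ⟩
    ∑ (λ w → b2ℚ (E′ u w) * f w) + ∑ (λ w → δ u a * (δ w b * f w) + δ u b * (δ w a * f w))
      ≡⟨ cong (λ t → ∑ (λ w → b2ℚ (E′ u w) * f w) + t)
           (trans (∑-+ (λ w → δ u a * (δ w b * f w)) _) (cong₂ _+_ (collect a b) (collect b a))) ⟩
    ∑ (λ w → b2ℚ (E′ u w) * f w) + (δ u a * f b + δ u b * f a) ∎
    where
    open ≡-Reasoning
    collect : ∀ a b → ∑ (λ w → δ u a * (δ w b * f w)) ≡ δ u a * f b
    collect a b = trans (∑-*ˡ (δ u a) (λ w → δ w b * f w)) (cong (δ u a *_) (∑-δ f b))

  lap-edge : ∀ φ u → lap E φ u ≡ lap E′ φ u + (φ a - φ b) * (δ u a - δ u b)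
  lap-edge φ u = begin
    lap E φ u
      ≡⟨ ∑-edge (λ w → φ u - φ w) u ⟩
    lap E′ φ u + (δ u a * (φ u - φ b) + δ u b * (φ u - φ a))
      ≡⟨ cong (λ t → lap E′ φ u + t) (cong₂ _+_ (δ-subst (λ t → φ t - φ b) u a) (δ-subst (λ t → φ t - φ a) u b)) ⟩
    lap E′ φ u + (δ u a * (φ a - φ b) + δ u b * (φ b - φ a))
      ≡⟨ cong (λ t → lap E′ φ u + t) (solve 4 (λ p q a b → p :* (a :- b) :+ q :* (b :- a) := (a :- b) :* (p :- q)) refl (δ u a) (δ u b) (φ a) (φ b)) ⟩
    lap E′ φ u + (φ a - φ b) * (δ u a - δ u b) ∎
    where open ≡-Reasoning

  deg-edge : ∀ u → degE E u ≡ degE E′ u ℕ.+ (δℕ u a ℕ.+ δℕ u b)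
  deg-edge u = begin
    degE E u
      ≡⟨ ∑ℕ-cong (add u) ⟩
    ∑ℕ (λ w → b2ℕ (E′ u w) ℕ.+ (δℕ u a ℕ.* δℕ w b ℕ.+ δℕ u b ℕ.* δℕ w a))
      ≡⟨ ∑ℕ-+ (λ w → b2ℕ (E′ u w)) _ ⟩
    degE E′ u ℕ.+ ∑ℕ (λ w → δℕ u a ℕ.* δℕ w b ℕ.+ δℕ u b ℕ.* δℕ w a)
      ≡⟨ cong (degE E′ u ℕ.+_) (trans (∑ℕ-+ (λ w → δℕ u a ℕ.* δℕ w b) _) (cong₂ ℕ._+_ (collect a b) (collect b a))) ⟩
    degE E′ u ℕ.+ (δℕ u a ℕ.+ δℕ u b) ∎
    where
    open ≡-Reasoning
    collect : ∀ a b → ∑ℕ (λ w → δℕ u a ℕ.* δℕ w b) ≡ δℕ u a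
    collect a b = trans (∑ℕ-*ˡ (δℕ u a) (λ w → δℕ w b)) (trans (cong (δℕ u a ℕ.*_) (∑ℕ-δ b)) (ℕ.*-identityʳ _))

  vol-edge : ∑ℕ (degE E) ≡ ∑ℕ (degE E′) ℕ.+ 2
  vol-edge = begin
    ∑ℕ (degE E)
      ≡⟨ ∑ℕ-cong deg-edge ⟩
    ∑ℕ (λ u → degE E′ u ℕ.+ (δℕ u a ℕ.+ δℕ u b))
      ≡⟨ ∑ℕ-+ (degE E′) _ ⟩
    ∑ℕ (degE E′) ℕ.+ ∑ℕ (λ u → δℕ u a ℕ.+ δℕ u b)
      ≡⟨ cong (∑ℕ (degE E′) ℕ.+_) (trans (∑ℕ-+ (λ u → δℕ u a) (λ u → δℕ u b)) (cong₂ ℕ._+_ (∑ℕ-δ a) (∑ℕ-δ b))) ⟩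
    ∑ℕ (degE E′) ℕ.+ 2 ∎
    where open ≡-Reasoning

  ∑-deg-edge : (f : Fin n → ℚ) → ∑ (λ u → ι (degE E u) * f u) ≡ ∑ (λ u → ι (degE E′ u) * f u) + (f a + f b)
  ∑-deg-edge f = begin
    ∑ (λ u → ι (degE E u) * f u)
      ≡⟨ ∑-cong (λ u → trans (cong (_* f u) (trans (cong ι (deg-edge u)) (trans (ι-+ (degE E′ u) _) (cong (λ t → ι (degE E′ u) + t)
           (trans (ι-+ (δℕ u a) (δℕ u b)) (≡-sym (cong₂ _+_ (b2ℚ-ι (eqb u a)) (b2ℚ-ι (eqb u b)))))))))
           (solve 4 (λ d p q f → (d :+ (p :+ q)) :* f := d :* f :+ (p :* f :+ q :* f)) refl (ι (degE E′ u)) (δ u a) (δ u b) (f u))) ⟩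
    ∑ (λ u → ι (degE E′ u) * f u + (δ u a * f u + δ u b * f u))
      ≡⟨ ∑-+ (λ u → ι (degE E′ u) * f u) _ ⟩
    ∑ (λ u → ι (degE E′ u) * f u) + ∑ (λ u → δ u a * f u + δ u b * f u)
      ≡⟨ cong (λ t → ∑ (λ u → ι (degE E′ u) * f u) + t) (trans (∑-+ (λ u → δ u a * f u) _) (cong₂ _+_ (∑-δ f a) (∑-δ f b))) ⟩
    ∑ (λ u → ι (degE E′ u) * f u) + (f a + f b) ∎
    where open ≡-Reasoning

-- Degree-weighted resistance sums

Within : EdgeSet n → VertexSet n → Set
Within E S = ∀ u w → E u w ≡ true → S u ≡ true

card : VertexSet n → ℕ
card S = ∑ℕ (λ u → b2ℕ (S u))

vol : EdgeSet n → ℕ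
vol E = ∑ℕ (degE E)

∑ᵥ : VertexSet n → (Fin n → ℚ) → ℚ
∑ᵥ S f = ∑ (λ u → b2ℚ (S u) * f u)

∑ᵈ : EdgeSet n → (Fin n → ℚ) → ℚ
∑ᵈ E f = ∑ (λ u → ι (degE E u) * f u)

∑ᵥ-cong : {S : VertexSet n} {f g : Fin n → ℚ} → (∀ u → S u ≡ true → f u ≡ g u) → ∑ᵥ S f ≡ ∑ᵥ S g
∑ᵥ-cong {S = S} {f} {g} e = ∑-cong pointwise
  where
  pointwise : ∀ u → b2ℚ (S u) * f u ≡ b2ℚ (S u) * g u
  pointwise u with S u in u∈
  ... | true  = cong (1ℚ *_) (e u u∈)
  ... | false = trans (ℚ.*-zeroˡ (f u)) (≡-sym (ℚ.*-zeroˡ (g u)))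

degE-outside : {S : VertexSet n} {E : EdgeSet n} → Within E S → ∀ u → S u ≡ false → degE E u ≡ 0
degE-outside {n} {S} {E} within u u∉ = trans (∑ℕ-cong none) (∑ℕ-zero {n})
  where
  none : ∀ w → b2ℕ (E u w) ≡ 0
  none w with E u w in e
  ... | true  = case trans (≡-sym (within u w e)) u∉ of λ ()
  ... | false = refl

∑ᵈ-cong : {S : VertexSet n} {E : EdgeSet n} {f g : Fin n → ℚ} → Within E S → (∀ u → S u ≡ true → f u ≡ g u) → ∑ᵈ E f ≡ ∑ᵈ E g
∑ᵈ-cong {S = S} {E} {f} {g} within e = ∑-cong pointwise
  where
  pointwise : ∀ u → ι (degE E u) * f u ≡ ι (degE E u) * g u
  pointwise u with S u in u∈
  ... | true  = cong (ι (degE E u) *_) (e u u∈)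
  ... | false rewrite degE-outside within u u∈ = trans (ℚ.*-zeroˡ (f u)) (≡-sym (ℚ.*-zeroˡ (g u)))

-- Instantiated with the indicator of `S` and with the degree, so that plain and degree-weighted
-- sums share one expansion.
module Weighted (w : Fin n → ℚ) where

  ∑ʷ : (Fin n → ℚ) → ℚ
  ∑ʷ f = ∑ (λ u → w u * f u)

  ∑ʷ-+ : ∀ f g → ∑ʷ (λ u → f u + g u) ≡ ∑ʷ f + ∑ʷ g
  ∑ʷ-+ f g = trans (∑-cong (λ u → ℚ.*-distribˡ-+ (w u) (f u) (g u))) (∑-+ (λ u → w u * f u) (λ u → w u * g u))

  ∑ʷ-*ˡ : ∀ c f → ∑ʷ (λ u → c * f u) ≡ c * ∑ʷ f
  ∑ʷ-*ˡ c f = trans (∑-cong (λ u → solve 3 (λ w c f → w :* (c :* f) := c :* (w :* f)) refl (w u) c (f u))) (∑-*ˡ c (λ u → w u * f u))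

  ∑ʷ-const : ∀ c → ∑ʷ (λ _ → c) ≡ c * ∑ w
  ∑ʷ-const c = trans (∑-*ʳ c w) (ℚ.*-comm (∑ w) c)

  ∑ʷ-square : ∀ ψ z → ∑ʷ (λ u → (z - ψ u) * (z - ψ u)) ≡ z * z * ∑ w - (z + z) * ∑ʷ ψ + ∑ʷ (λ u → ψ u * ψ u)
  ∑ʷ-square ψ z = begin
    ∑ʷ (λ u → (z - ψ u) * (z - ψ u))
      ≡⟨ ∑-cong (λ u → cong (w u *_) (solve 2 (λ z p → (z :- p) :* (z :- p) := (z :* z :+ (:- (z :+ z)) :* p) :+ p :* p) refl z (ψ u))) ⟩
    ∑ʷ (λ u → (z * z + (- (z + z)) * ψ u) + ψ u * ψ u)
      ≡⟨ trans (∑ʷ-+ _ (λ u → ψ u * ψ u)) (cong (_+ ∑ʷ (λ u → ψ u * ψ u)) (trans (∑ʷ-+ (λ _ → z * z) _) (cong₂ _+_ (∑ʷ-const (z * z)) (∑ʷ-*ˡ (- (z + z)) ψ)))) ⟩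
    z * z * ∑ w + (- (z + z)) * ∑ʷ ψ + ∑ʷ (λ u → ψ u * ψ u)
      ≡⟨ solve 4 (λ a z p q → (a :+ (:- (z :+ z)) :* p) :+ q := a :- (z :+ z) :* p :+ q) refl (z * z * ∑ w) z (∑ʷ ψ) (∑ʷ (λ u → ψ u * ψ u)) ⟩
    z * z * ∑ w - (z + z) * ∑ʷ ψ + ∑ʷ (λ u → ψ u * ψ u) ∎
    where open ≡-Reasoning

module _ (S : VertexSet n) where
  open Weighted (λ u → b2ℚ (S u)) public
    renaming (∑ʷ-+ to ∑ᵥ-+; ∑ʷ-*ˡ to ∑ᵥ-*ˡ; ∑ʷ-const to ∑ᵥ-const; ∑ʷ-square to ∑ᵥ-square) hiding (∑ʷ)

  ∑b2ℚ : ∑ (λ u → b2ℚ (S u)) ≡ ι (card S)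
  ∑b2ℚ = trans (∑-cong (λ u → b2ℚ-ι (S u))) (≡-sym (ι-∑ (λ u → b2ℕ (S u))))

module _ (E : EdgeSet n) where
  open Weighted (λ u → ι (degE E u)) public
    renaming (∑ʷ-+ to ∑ᵈ-+; ∑ʷ-*ˡ to ∑ᵈ-*ˡ; ∑ʷ-const to ∑ᵈ-const; ∑ʷ-square to ∑ᵈ-square) hiding (∑ʷ)

  ∑ιdeg : ∑ (λ u → ι (degE E u)) ≡ ι (vol E)
  ∑ιdeg = ≡-sym (ι-∑ (degE E))

distSum : VertexSet n → (Fin n → Fin n → ℚ) → Fin n → ℚ
distSum S r z = ∑ᵥ S (r z)

degDistSum : EdgeSet n → (Fin n → Fin n → ℚ) → Fin n → ℚ
degDistSum E r z = ∑ᵈ E (r z)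

-- A sum over ordered pairs weighted by the degree of the first vertex, which equals the sum of
-- (d(u) + d(v)) r(u,v) over unordered pairs. In this form a new edge changes just two weights.
total : VertexSet n → EdgeSet n → (Fin n → Fin n → ℚ) → ℚ
total S E r = ∑ᵈ E (distSum S r)

-- Pendant vertices

-- The equation `vertex` makes `S` the disjoint union of `S′` and `x`; with `within′` it follows
-- that `x` is isolated in `E′`.
record Leaf (S : VertexSet n) (E : EdgeSet n) (S′ : VertexSet n) (E′ : EdgeSet n) (x y : Fin n) : Set where
  field
    edge    : AddEdge E′ x y E
    vertex  : ∀ u → b2ℕ (S u) ≡ b2ℕ (S′ u) ℕ.+ δℕ u x
    anchor  : S′ y ≡ true
    sym-E   : Sym E
    sym-E′  : Sym E′
    within′ : Within E′ S′

  leaf∉ : S′ x ≡ false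
  leaf∉ with S x | S′ x | vertex x
  ... | _     | false | _ = refl
  ... | true  | true  | e rewrite eqb-refl x = case e of λ ()
  ... | false | true  | e = case e of λ ()

  leaf∈ : S x ≡ true
  leaf∈ with S x | vertex x
  ... | true  | _ = refl
  ... | false | e rewrite leaf∉ | eqb-refl x = case e of λ ()

  member↑ : ∀ {u} → S′ u ≡ true → S u ≡ true
  member↑ {u} u∈ with S u | vertex u
  ... | true  | _ = refl
  ... | false | e rewrite u∈ = case e of λ ()

  member↓ : ∀ u → S u ≡ true → S′ u ≡ true ⊎ u ≡ x
  member↓ u u∈ with eqb u x in e | S′ u | vertex u
  ... | true  | _     | _ = inj₂ (eqb⇒≡ u x e)
  ... | false | true  | _ = inj₁ refl
  ... | false | false | q rewrite u∈ = case q of λ ()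

  ≢leaf : ∀ {u} → S′ u ≡ true → u ≢ x
  ≢leaf u∈ refl = case trans (≡-sym u∈) leaf∉ of λ ()

  leaf-isolated : ∀ w → E′ x w ≡ false
  leaf-isolated w with E′ x w in e
  ... | true  = case trans (≡-sym (within′ x w e)) leaf∉ of λ ()
  ... | false = refl

  lap-leaf : ∀ φ → lap E′ φ x ≡ 0ℚ
  lap-leaf φ = trans (∑-cong (λ w → trans (cong (λ b → b2ℚ b * (φ x - φ w)) (leaf-isolated w)) (ℚ.*-zeroˡ (φ x - φ w)))) (∑-zero {n})

  within : Within E S
  within u w e with E′ u w in e′
  ... | true  = member↑ (within′ u w e′)
  ... | false with eqb u x in ux | eqb u y in uy | edge u w
  ...   | true  | _     | _ = subst (λ v → S v ≡ true) (≡-sym (eqb⇒≡ u x ux)) leaf∈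
  ...   | false | true  | _ = subst (λ v → S v ≡ true) (≡-sym (eqb⇒≡ u y uy)) (member↑ anchor)
  ...   | false | false | q rewrite e | e′ = case q of λ ()

  ∑ᵥ-leaf : ∀ f → ∑ᵥ S f ≡ ∑ᵥ S′ f + f x
  ∑ᵥ-leaf f = begin
    ∑ᵥ S f
      ≡⟨ ∑-cong (λ u → trans (cong (_* f u) (split u)) (ℚ.*-distribʳ-+ (f u) (b2ℚ (S′ u)) (δ u x))) ⟩
    ∑ (λ u → b2ℚ (S′ u) * f u + δ u x * f u)
      ≡⟨ ∑-+ (λ u → b2ℚ (S′ u) * f u) _ ⟩
    ∑ᵥ S′ f + ∑ (λ u → δ u x * f u)
      ≡⟨ cong (λ t → ∑ᵥ S′ f + t) (∑-δ f x) ⟩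
    ∑ᵥ S′ f + f x ∎
    where
    open ≡-Reasoning
    split : ∀ u → b2ℚ (S u) ≡ b2ℚ (S′ u) + δ u x
    split u = begin
      b2ℚ (S u)
        ≡⟨ b2ℚ-ι (S u) ⟩
      ι (b2ℕ (S u))
        ≡⟨ cong ι (vertex u) ⟩
      ι (b2ℕ (S′ u) ℕ.+ δℕ u x)
        ≡⟨ ι-+ (b2ℕ (S′ u)) (δℕ u x) ⟩
      ι (b2ℕ (S′ u)) + ι (δℕ u x)
        ≡⟨ cong₂ _+_ (b2ℚ-ι (S′ u)) (b2ℚ-ι (eqb u x)) ⟨
      b2ℚ (S′ u) + δ u x ∎

  card-leaf : card S ≡ suc (card S′)
  card-leaf = begin
    card S
      ≡⟨ ∑ℕ-cong vertex ⟩
    ∑ℕ (λ u → b2ℕ (S′ u) ℕ.+ δℕ u x)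
      ≡⟨ ∑ℕ-+ (λ u → b2ℕ (S′ u)) (λ u → δℕ u x) ⟩
    card S′ ℕ.+ ∑ℕ (λ u → δℕ u x)
      ≡⟨ cong (card S′ ℕ.+_) (∑ℕ-δ x) ⟩
    card S′ ℕ.+ 1
      ≡⟨ ℕ.+-comm (card S′) 1 ⟩
    suc (card S′) ∎
    where open ≡-Reasoning

module LeafSums {S S′ : VertexSet n} {E E′ : EdgeSet n} {x y : Fin n} (leaf : Leaf S E S′ E′ x y)
                {r : Fin n → Fin n → ℚ} (res : Resistance S E r) where
  open Leaf leaf
  open ≡-Reasoning

  private
    -- Kirchhoff's law at `x` involves the pendant edge alone, because `x` is isolated in `E′`.
    lap-at-leaf : ∀ {u v} φ → Potential E u v φ → φ x - φ y ≡ δ x u - δ x v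
    lap-at-leaf {u} {v} φ pφ = begin
      φ x - φ y
        ≡⟨ solve 1 (λ a → a := con 0ℚ :+ a :* (con 1ℚ :- con 0ℚ)) refl (φ x - φ y) ⟩
      0ℚ + (φ x - φ y) * (1ℚ - 0ℚ)
        ≡⟨ cong₂ (λ p q → p + (φ x - φ y) * q) (lap-leaf φ) (cong₂ _-_ (δ-refl x) (δ-≢ (λ e → ≢leaf anchor (≡-sym e)))) ⟨
      lap E′ φ x + (φ x - φ y) * (δ x x - δ x y)
        ≡⟨ lap-edge {E′ = E′} {E = E} edge φ x ⟨
      lap E φ x
        ≡⟨ pφ x ⟩
      δ x u - δ x v ∎

    lap-rest : ∀ {u v} φ c → Potential E u v φ → φ x - φ y ≡ c → ∀ t → lap E′ φ t ≡ (δ t u - δ t v) - c * (δ t x - δ t y)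
    lap-rest {u} {v} φ c pφ drop t = begin
      lap E′ φ t
        ≡⟨ solve 2 (λ a b → a := (a :+ b) :- b) refl (lap E′ φ t) ((φ x - φ y) * (δ t x - δ t y)) ⟩
      (lap E′ φ t + (φ x - φ y) * (δ t x - δ t y)) - (φ x - φ y) * (δ t x - δ t y)
        ≡⟨ cong₂ (λ p q → p - q * (δ t x - δ t y)) (trans (≡-sym (lap-edge {E′ = E′} {E = E} edge φ t)) (pφ t)) drop ⟩
      (δ t u - δ t v) - c * (δ t x - δ t y) ∎

    1-0 : ∀ {a b} → a ≡ 1ℚ → b ≡ 0ℚ → a - b ≡ 1ℚ
    1-0 refl refl = refl

    0-0 : ∀ {a b} → a ≡ 0ℚ → b ≡ 0ℚ → a - b ≡ 0ℚ
    0-0 refl refl = refl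

    δ-leaf : ∀ {v} → S′ v ≡ true → δ x v ≡ 0ℚ
    δ-leaf v∈ = δ-≢ (λ e → ≢leaf v∈ (≡-sym e))

    drop-old : ∀ {u v} φ → S′ u ≡ true → S′ v ≡ true → Potential E u v φ → φ x - φ y ≡ 0ℚ
    drop-old φ u∈ v∈ pφ = trans (lap-at-leaf φ pφ) (0-0 (δ-leaf u∈) (δ-leaf v∈))

    drop-leaf : ∀ {v} φ → S′ v ≡ true → Potential E x v φ → φ x - φ y ≡ 1ℚ
    drop-leaf φ v∈ pφ = trans (lap-at-leaf φ pφ) (1-0 (δ-refl x) (δ-leaf v∈))

    potential-old : ∀ {u v} φ → S′ u ≡ true → S′ v ≡ true → Potential E u v φ → Potential E′ u v φ
    potential-old {u} {v} φ u∈ v∈ pφ t = trans (lap-rest φ 0ℚ pφ (drop-old φ u∈ v∈ pφ) t)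
      (solve 2 (λ a b → a :- con 0ℚ :* b := a) refl (δ t u - δ t v) (δ t x - δ t y))

    -- A unit current entering at `x` passes entirely through the pendant edge, so for the rest of
    -- the network it enters at `y`.
    potential-leaf : ∀ {v} φ → S′ v ≡ true → Potential E x v φ → Potential E′ y v φ
    potential-leaf {v} φ v∈ pφ t = trans (lap-rest φ 1ℚ pφ (drop-leaf φ v∈ pφ) t)
      (solve 3 (λ a b c → (a :- b) :- con 1ℚ :* (a :- c) := c :- b) refl (δ t x) (δ t v) (δ t y))

  res′ : Resistance S′ E′ r
  res′ u v u∈ v∈ = let φ , pφ , e = res u v (member↑ u∈) (member↑ v∈) in φ , potential-old φ u∈ v∈ pφ , e

  r-leaf : ∀ v → S′ v ≡ true → r x v ≡ 1ℚ + r y v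
  r-leaf v v∈ = let φ , pφ , e = res x v leaf∈ (member↑ v∈)
                    χ , pχ , eχ = res′ y v anchor v∈ in begin
    r x v
      ≡⟨ e ⟩
    φ x - φ v
      ≡⟨ solve 3 (λ a b c → a :- c := (a :- b) :+ (b :- c)) refl (φ x) (φ y) (φ v) ⟩
    (φ x - φ y) + (φ y - φ v)
      ≡⟨ cong (_+ (φ y - φ v)) (drop-leaf φ v∈ pφ) ⟩
    1ℚ + (φ y - φ v)
      -- The restricted potential need not be the one that witnesses `r y v`; reciprocity identifies
      -- their drops.
      ≡⟨ cong (λ t → 1ℚ + t) (trans (reciprocity sym-E′ χ φ pχ (potential-leaf φ v∈ pφ)) (≡-sym eχ)) ⟩
    1ℚ + r y v ∎

  r-leafʳ : ∀ v → S′ v ≡ true → r v x ≡ 1ℚ + r y v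
  r-leafʳ v v∈ = trans (r-sym sym-E res v x (member↑ v∈) leaf∈) (r-leaf v v∈)

  r-self : r x x ≡ 0ℚ
  r-self = r-diag sym-E res x leaf∈

  distSum-old : ∀ z → S′ z ≡ true → distSum S r z ≡ distSum S′ r z + (1ℚ + r y z)
  distSum-old z z∈ = trans (∑ᵥ-leaf (r z)) (cong (λ t → distSum S′ r z + t) (r-leafʳ z z∈))

  distSum-new : distSum S r x ≡ ι (card S′) + distSum S′ r y
  distSum-new = begin
    distSum S r x
      ≡⟨ ∑ᵥ-leaf (r x) ⟩
    ∑ᵥ S′ (r x) + r x x
      ≡⟨ cong₂ _+_ (∑ᵥ-cong r-leaf) r-self ⟩
    ∑ᵥ S′ (λ v → 1ℚ + r y v) + 0ℚ
      ≡⟨ ℚ.+-identityʳ _ ⟩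
    ∑ᵥ S′ (λ v → 1ℚ + r y v)
      ≡⟨ ∑ᵥ-+ S′ (λ _ → 1ℚ) (r y) ⟩
    ∑ᵥ S′ (λ _ → 1ℚ) + distSum S′ r y
      ≡⟨ cong (_+ distSum S′ r y) (trans (∑ᵥ-const S′ 1ℚ) (trans (ℚ.*-identityˡ _) (∑b2ℚ S′))) ⟩
    ι (card S′) + distSum S′ r y ∎

  degDistSum-old : ∀ z → S′ z ≡ true → degDistSum E r z ≡ degDistSum E′ r z + ((1ℚ + r y z) + r y z)
  degDistSum-old z z∈ = trans (∑-deg-edge {E′ = E′} {E = E} edge (r z)) (cong (λ t → degDistSum E′ r z + t) (cong₂ _+_ (r-leafʳ z z∈) (r-sym sym-E′ res′ z y z∈ anchor)))

  ∑ᵈ-1+r : ∑ᵈ E′ (λ u → 1ℚ + r y u) ≡ ι (vol E′) + degDistSum E′ r y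
  ∑ᵈ-1+r = trans (∑ᵈ-+ E′ (λ _ → 1ℚ) (r y)) (cong (_+ degDistSum E′ r y) (trans (∑ᵈ-const E′ 1ℚ) (trans (ℚ.*-identityˡ _) (∑ιdeg E′))))

  r-edge : r x y ≡ 1ℚ
  r-edge = trans (r-leaf y anchor) (trans (cong (λ t → 1ℚ + t) (r-diag sym-E′ res′ y anchor)) (ℚ.+-identityʳ 1ℚ))

  degDistSum-new : degDistSum E r x ≡ (ι (vol E′) + degDistSum E′ r y) + 1ℚ
  degDistSum-new = begin
    degDistSum E r x
      ≡⟨ ∑-deg-edge {E′ = E′} {E = E} edge (r x) ⟩
    ∑ᵈ E′ (r x) + (r x x + r x y)
      ≡⟨ cong₂ _+_ (trans (∑ᵈ-cong within′ r-leaf) ∑ᵈ-1+r) (trans (cong₂ _+_ r-self r-edge) (ℚ.+-identityˡ 1ℚ)) ⟩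
    (ι (vol E′) + degDistSum E′ r y) + 1ℚ ∎

  total-leaf : total S E r ≡ total S′ E′ r + (ι (vol E′) + degDistSum E′ r y) + ((ι (card S′) + distSum S′ r y) + (distSum S′ r y + 1ℚ))
  total-leaf = begin
    total S E r
      ≡⟨ ∑-deg-edge {E′ = E′} {E = E} edge (distSum S r) ⟩
    ∑ᵈ E′ (distSum S r) + (distSum S r x + distSum S r y)
      ≡⟨ cong₂ _+_ (trans (∑ᵈ-cong within′ distSum-old) (trans (∑ᵈ-+ E′ (distSum S′ r) (λ u → 1ℚ + r y u)) (cong (λ t → total S′ E′ r + t) ∑ᵈ-1+r)))
           (cong₂ _+_ distSum-new (trans (distSum-old y anchor) (cong (λ t → distSum S′ r y + t) (trans (cong (λ t → 1ℚ + t) (r-diag sym-E′ res′ y anchor)) (ℚ.+-identityʳ 1ℚ))))) ⟩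
    total S′ E′ r + (ι (vol E′) + degDistSum E′ r y) + ((ι (card S′) + distSum S′ r y) + (distSum S′ r y + 1ℚ)) ∎

lap-linear : (E : EdgeSet n) (φ ψ : Fin n → ℚ) (s : ℚ) → ∀ x → lap E (λ t → φ t + s * ψ t) x ≡ lap E φ x + s * lap E ψ x
lap-linear E φ ψ s x = begin
  lap E (λ t → φ t + s * ψ t) x
    ≡⟨ ∑-cong (λ w → solve 6 (λ e a b s c d → e :* ((a :+ s :* c) :- (b :+ s :* d)) := e :* (a :- b) :+ s :* (e :* (c :- d))) refl
         (b2ℚ (E x w)) (φ x) (φ w) s (ψ x) (ψ w)) ⟩
  ∑ (λ w → b2ℚ (E x w) * (φ x - φ w) + s * (b2ℚ (E x w) * (ψ x - ψ w)))
    ≡⟨ ∑-+ (λ w → b2ℚ (E x w) * (φ x - φ w)) _ ⟩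
  lap E φ x + ∑ (λ w → s * (b2ℚ (E x w) * (ψ x - ψ w)))
    ≡⟨ cong (λ t → lap E φ x + t) (∑-*ˡ s (λ w → b2ℚ (E x w) * (ψ x - ψ w))) ⟩
  lap E φ x + s * lap E ψ x ∎
  where open ≡-Reasoning

-- E closes the c–y connection in T by one more edge. With ψ the unit potential of T from c to y
-- and ℓ its drop, removing the edge is a rank-one update of the resistances.
module Closing {S : VertexSet n} {T E : EdgeSet n} {c y : Fin n} (add : AddEdge T c y E)
               (sym-T : Sym T) (sym-E : Sym E) (c∈ : S c ≡ true) (y∈ : S y ≡ true)
               {r : Fin n → Fin n → ℚ} (res : Resistance S E r)
               (ψ : Fin n → ℚ) (ψ-pot : Potential T c y ψ) (ψy : ψ y ≡ 0ℚ)
               (ℓ κ : ℚ) (ψc : ψ c ≡ ℓ) (κ-inv : κ * (1ℚ + ℓ) ≡ 1ℚ) where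
  open ≡-Reasoning

  sq : Fin n → Fin n → ℚ
  sq u v = (ψ u - ψ v) * (ψ u - ψ v)

  rT : Fin n → Fin n → ℚ
  rT u v = r u v + κ * sq u v

  private
    lap-ψ : ∀ x → lap E ψ x ≡ (1ℚ + ℓ) * (δ x c - δ x y)
    lap-ψ x = begin
      lap E ψ x
        ≡⟨ lap-edge {E′ = T} {E = E} add ψ x ⟩
      lap T ψ x + (ψ c - ψ y) * (δ x c - δ x y)
        ≡⟨ cong₂ (λ p q → p + q * (δ x c - δ x y)) (ψ-pot x) (cong₂ _-_ ψc ψy) ⟩
      (δ x c - δ x y) + (ℓ - 0ℚ) * (δ x c - δ x y)
        ≡⟨ solve 2 (λ d l → d :+ (l :- con 0ℚ) :* d := (con 1ℚ :+ l) :* d) refl (δ x c - δ x y) ℓ ⟩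
      (1ℚ + ℓ) * (δ x c - δ x y) ∎

    -- The network `E` is not solved for φ. In `E` the Laplacian of ψ is `1ℚ + ℓ` times the dipole
    -- at `c` and `y`, so testing φ against ψ yields the current through the closing edge.
    drop : ∀ {u v} φ → Potential E u v φ → φ c - φ y ≡ κ * (ψ u - ψ v)
    drop {u} {v} φ pφ = begin
      φ c - φ y
        ≡⟨ ℚ.*-identityˡ (φ c - φ y) ⟨
      1ℚ * (φ c - φ y)
        ≡⟨ cong (_* (φ c - φ y)) κ-inv ⟨
      κ * (1ℚ + ℓ) * (φ c - φ y)
        ≡⟨ ℚ.*-assoc κ (1ℚ + ℓ) (φ c - φ y) ⟩
      κ * ((1ℚ + ℓ) * (φ c - φ y))
        ≡⟨ cong (λ t → κ * ((1ℚ + ℓ) * t)) (pairing φ c y) ⟨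
      κ * ((1ℚ + ℓ) * ∑ (λ x → φ x * (δ x c - δ x y)))
        ≡⟨ cong (κ *_) (∑-*ˡ (1ℚ + ℓ) (λ x → φ x * (δ x c - δ x y))) ⟨
      κ * ∑ (λ x → (1ℚ + ℓ) * (φ x * (δ x c - δ x y)))
        ≡⟨ cong (κ *_) (∑-cong (λ x → solve 3 (λ k p d → k :* (p :* d) := p :* (k :* d)) refl (1ℚ + ℓ) (φ x) (δ x c - δ x y))) ⟩
      κ * ∑ (λ x → φ x * ((1ℚ + ℓ) * (δ x c - δ x y)))
        ≡⟨ cong (κ *_) (∑-cong (λ x → cong (φ x *_) (lap-ψ x))) ⟨
      κ * ∑ (λ x → φ x * lap E ψ x)
        ≡⟨ cong (κ *_) (lap-selfadjoint sym-E φ ψ) ⟨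
      κ * ∑ (λ x → ψ x * lap E φ x)
        ≡⟨ cong (κ *_) (∑-cong (λ x → cong (ψ x *_) (pφ x))) ⟩
      κ * ∑ (λ x → ψ x * (δ x u - δ x v))
        ≡⟨ cong (κ *_) (pairing ψ u v) ⟩
      κ * (ψ u - ψ v) ∎

    -- The current that used the closing edge is sent through `T` instead, by superposing ψ with
    -- just that strength.
    correct : ∀ {u v} φ → Potential E u v φ → Potential T u v (λ t → φ t + κ * (ψ u - ψ v) * ψ t)
    correct {u} {v} φ pφ x = begin
      lap T (λ t → φ t + κ * (ψ u - ψ v) * ψ t) x
        ≡⟨ lap-linear T φ ψ (κ * (ψ u - ψ v)) x ⟩
      lap T φ x + κ * (ψ u - ψ v) * lap T ψ x
        ≡⟨ cong₂ (λ p q → lap T φ x + p * q) (≡-sym (drop φ pφ)) (ψ-pot x) ⟩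
      lap T φ x + (φ c - φ y) * (δ x c - δ x y)
        ≡⟨ lap-edge {E′ = T} {E = E} add φ x ⟨
      lap E φ x
        ≡⟨ pφ x ⟩
      δ x u - δ x v ∎

  resT : Resistance S T rT
  resT u v u∈ v∈ = let φ , pφ , e = res u v u∈ v∈ in
    (λ t → φ t + κ * (ψ u - ψ v) * ψ t) , correct φ pφ ,
    trans (cong (_+ κ * sq u v) e)
      (solve 5 (λ a b k p q → (a :- b) :+ k :* ((p :- q) :* (p :- q)) := (a :+ k :* (p :- q) :* p) :- (b :+ k :* (p :- q) :* q)) refl
        (φ u) (φ v) κ (ψ u) (ψ v))

  -- This is the general identity 2(ψ v - ψ y) = r(c,y) + r(y,v) - r(c,v), assembled from three
  -- reciprocities; the shape of `T` does not enter.
  rT-ends : ∀ v → S v ≡ true → rT y v ≡ rT c v + ((ψ v + ψ v) - ℓ)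
  rT-ends v v∈ = let φ , pφ , eφ = resT c v c∈ v∈
                     χ , pχ , eχ = resT y v y∈ v∈ in begin
    rT y v
      ≡⟨ solve 3 (λ r p l → r := (((l :- p) :+ ((con 0ℚ :- p) :+ r))) :+ ((p :+ p) :- l)) refl (rT y v) (ψ v) ℓ ⟩
    ((ℓ - ψ v) + ((0ℚ - ψ v) + rT y v)) + ((ψ v + ψ v) - ℓ)
      ≡⟨ cong (_+ ((ψ v + ψ v) - ℓ)) (begin
           (ℓ - ψ v) + ((0ℚ - ψ v) + rT y v)
             ≡⟨ cong₂ (λ p q → (p - ψ v) + ((q - ψ v) + rT y v)) ψc ψy ⟨
           (ψ c - ψ v) + ((ψ y - ψ v) + rT y v)
             ≡⟨ cong₂ _+_ (reciprocity sym-T φ ψ pφ ψ-pot) (cong₂ _+_ (reciprocity sym-T χ ψ pχ ψ-pot) eχ) ⟩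
           (φ c - φ y) + ((χ c - χ y) + (χ y - χ v))
             ≡⟨ cong (λ t → (φ c - φ y) + t) (trans (telescope (χ c) (χ y) (χ v)) (reciprocity sym-T φ χ pφ pχ)) ⟩
           (φ c - φ y) + (φ y - φ v)
             ≡⟨ telescope (φ c) (φ y) (φ v) ⟩
           φ c - φ v
             ≡⟨ eφ ⟨
           rT c v ∎) ⟩
    rT c v + ((ψ v + ψ v) - ℓ) ∎
    where
    telescope : ∀ a b c → (a - b) + (b - c) ≡ a - c
    telescope = solve 3 (λ a b c → (a :- b) :+ (b :- c) := a :- c) refl

  distSum-ends : distSum S rT y ≡ distSum S rT c + ((∑ᵥ S ψ + ∑ᵥ S ψ) - ℓ * ι (card S))
  distSum-ends = begin
    distSum S rT y
      ≡⟨ ∑ᵥ-cong {S = S} rT-ends ⟩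
    ∑ᵥ S (λ v → rT c v + ((ψ v + ψ v) - ℓ))
      ≡⟨ ∑ᵥ-+ S (rT c) (λ v → (ψ v + ψ v) - ℓ) ⟩
    distSum S rT c + ∑ᵥ S (λ v → (ψ v + ψ v) - ℓ)
      ≡⟨ cong (λ t → distSum S rT c + t) (begin
      ∑ᵥ S (λ v → (ψ v + ψ v) - ℓ)
        ≡⟨ ∑ᵥ-+ S (λ v → ψ v + ψ v) (λ _ → - ℓ) ⟩
      ∑ᵥ S (λ v → ψ v + ψ v) + ∑ᵥ S (λ _ → - ℓ)
        ≡⟨ cong₂ _+_ (∑ᵥ-+ S ψ ψ) (trans (∑ᵥ-const S (- ℓ)) (trans (cong (- ℓ *_) (∑b2ℚ S)) (solve 2 (λ l m → (:- l) :* m := :- (l :* m)) refl ℓ (ι (card S))))) ⟩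
      (∑ᵥ S ψ + ∑ᵥ S ψ) - ℓ * ι (card S) ∎) ⟩
    distSum S rT c + ((∑ᵥ S ψ + ∑ᵥ S ψ) - ℓ * ι (card S)) ∎

  private
    ψ² : Fin n → ℚ
    ψ² u = ψ u * ψ u

    r-rT : ∀ u v → r u v ≡ rT u v + (- κ) * sq u v
    r-rT u v = solve 3 (λ r k s → r := (r :+ k :* s) :+ (:- k) :* s) refl (r u v) κ (sq u v)

  -- The weighted sums of (ψ z - ψ v)² over v, expanded in the moments of ψ. Along a pendant path
  -- these moments are explicit.
  correctionᵥ correctionᵈ : Fin n → ℚ
  correctionᵥ z = ψ z * ψ z * ι (card S) - (ψ z + ψ z) * ∑ᵥ S ψ + ∑ᵥ S ψ²
  correctionᵈ z = ψ z * ψ z * ι (vol E) - (ψ z + ψ z) * ∑ᵈ E ψ + ∑ᵈ E ψ²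

  distSum-closing : ∀ z → distSum S r z ≡ distSum S rT z + (- κ) * correctionᵥ z
  distSum-closing z = begin
    distSum S r z
      ≡⟨ ∑ᵥ-cong {S = S} (λ v _ → r-rT z v) ⟩
    ∑ᵥ S (λ v → rT z v + (- κ) * sq z v)
      ≡⟨ ∑ᵥ-+ S (rT z) (λ v → (- κ) * sq z v) ⟩
    distSum S rT z + ∑ᵥ S (λ v → (- κ) * sq z v)
      ≡⟨ cong (λ t → distSum S rT z + t) (trans (∑ᵥ-*ˡ S (- κ) (sq z)) (cong (- κ *_)
                                                              (trans (∑ᵥ-square S ψ (ψ z)) (cong (λ t → ψ z * ψ z * t - (ψ z + ψ z) * ∑ᵥ S ψ + ∑ᵥ S ψ²) (∑b2ℚ S))))) ⟩
    distSum S rT z + (- κ) * correctionᵥ z ∎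

  degDistSum-closing : ∀ z → degDistSum E r z ≡ (degDistSum T rT z + (rT z c + rT z y)) + (- κ) * correctionᵈ z
  degDistSum-closing z = begin
    degDistSum E r z
      ≡⟨ ∑-cong (λ u → cong (ι (degE E u) *_) (r-rT z u)) ⟩
    ∑ᵈ E (λ u → rT z u + (- κ) * sq z u)
      ≡⟨ ∑ᵈ-+ E (rT z) (λ u → (- κ) * sq z u) ⟩
    ∑ᵈ E (rT z) + ∑ᵈ E (λ u → (- κ) * sq z u)
      ≡⟨ cong₂ _+_ (∑-deg-edge {E′ = T} {E = E} add (rT z)) (trans (∑ᵈ-*ˡ E (- κ) (sq z)) (cong (- κ *_)
                                                              (trans (∑ᵈ-square E ψ (ψ z)) (cong (λ t → ψ z * ψ z * t - (ψ z + ψ z) * ∑ᵈ E ψ + ∑ᵈ E ψ²) (∑ιdeg E))))) ⟩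
    (degDistSum T rT z + (rT z c + rT z y)) + (- κ) * correctionᵈ z ∎

  -- The factor of `- κ` is the double sum of deg(u) (ψ u - ψ v)² over u and v; the two resistance
  -- sums at `c` and `y` come from the degrees raised by the closing edge.
  total-closing : total S E r ≡ (total S T rT + (distSum S rT c + distSum S rT y))
    + (- κ) * (ι (card S) * ∑ᵈ E ψ² - (∑ᵥ S ψ + ∑ᵥ S ψ) * ∑ᵈ E ψ + ι (vol E) * ∑ᵥ S ψ²)
  total-closing = begin
    total S E r
      ≡⟨ ∑-cong (λ u → cong (ι (degE E u) *_) (distSum-closing u)) ⟩
    ∑ᵈ E (λ u → distSum S rT u + (- κ) * correctionᵥ u)
      ≡⟨ ∑ᵈ-+ E (distSum S rT) (λ u → (- κ) * correctionᵥ u) ⟩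
    ∑ᵈ E (distSum S rT) + ∑ᵈ E (λ u → (- κ) * correctionᵥ u)
      ≡⟨ cong₂ _+_ (∑-deg-edge {E′ = T} {E = E} add (distSum S rT)) (trans (∑ᵈ-*ˡ E (- κ) correctionᵥ) (cong (- κ *_) ∑correction)) ⟩
    (total S T rT + (distSum S rT c + distSum S rT y))
      + (- κ) * (ι (card S) * ∑ᵈ E ψ² - (∑ᵥ S ψ + ∑ᵥ S ψ) * ∑ᵈ E ψ + ι (vol E) * ∑ᵥ S ψ²) ∎
    where
    ∑correction : ∑ᵈ E correctionᵥ ≡ ι (card S) * ∑ᵈ E ψ² - (∑ᵥ S ψ + ∑ᵥ S ψ) * ∑ᵈ E ψ + ι (vol E) * ∑ᵥ S ψ²
    ∑correction = begin
      ∑ᵈ E correctionᵥ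
        ≡⟨ ∑-cong (λ u → cong (ι (degE E u) *_) (solve 4 (λ p n P Q → p :* p :* n :- (p :+ p) :* P :+ Q := (n :* (p :* p) :+ (:- (P :+ P)) :* p) :+ Q) refl (ψ u) (ι (card S)) (∑ᵥ S ψ) (∑ᵥ S ψ²))) ⟩
      ∑ᵈ E (λ u → (ι (card S) * ψ² u + (- (∑ᵥ S ψ + ∑ᵥ S ψ)) * ψ u) + ∑ᵥ S ψ²)
        ≡⟨ trans (∑ᵈ-+ E (λ u → ι (card S) * ψ² u + (- (∑ᵥ S ψ + ∑ᵥ S ψ)) * ψ u) (λ _ → ∑ᵥ S ψ²))
             (cong₂ _+_ (trans (∑ᵈ-+ E (λ u → ι (card S) * ψ² u) (λ u → (- (∑ᵥ S ψ + ∑ᵥ S ψ)) * ψ u))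
                              (cong₂ _+_ (∑ᵈ-*ˡ E (ι (card S)) ψ²) (∑ᵈ-*ˡ E (- (∑ᵥ S ψ + ∑ᵥ S ψ)) ψ)))
                        (trans (∑ᵈ-const E (∑ᵥ S ψ²)) (cong (∑ᵥ S ψ² *_) (∑ιdeg E)))) ⟩
      (ι (card S) * ∑ᵈ E ψ² + (- (∑ᵥ S ψ + ∑ᵥ S ψ)) * ∑ᵈ E ψ) + ∑ᵥ S ψ² * ι (vol E)
        ≡⟨ solve 4 (λ a P Pd b → (a :+ (:- P) :* Pd) :+ b := a :- P :* Pd :+ b) refl (ι (card S) * ∑ᵈ E ψ²) (∑ᵥ S ψ + ∑ᵥ S ψ) (∑ᵈ E ψ) (∑ᵥ S ψ² * ι (vol E)) ⟩
      ι (card S) * ∑ᵈ E ψ² - (∑ᵥ S ψ + ∑ᵥ S ψ) * ∑ᵈ E ψ + ∑ᵥ S ψ² * ι (vol E)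
        ≡⟨ cong (λ t → ι (card S) * ∑ᵈ E ψ² - (∑ᵥ S ψ + ∑ᵥ S ψ) * ∑ᵈ E ψ + t) (ℚ.*-comm (∑ᵥ S ψ²) (ι (vol E))) ⟩
      ι (card S) * ∑ᵈ E ψ² - (∑ᵥ S ψ + ∑ᵥ S ψ) * ∑ᵈ E ψ + ι (vol E) * ∑ᵥ S ψ² ∎

-- Bounds along pendant vertices

2ℚ ½ ⅓ : ℚ
2ℚ = + 2 / 1
½  = + 1 / 2
⅓  = + 1 / 3

-- The integer c is the cyclomatic number |E| − |S| + 1, since vol E = 2|E|.
Euler : ℕ → VertexSet n → EdgeSet n → Set
Euler c S E = vol E ℕ.+ 2 ≡ 2 ℕ.* (card S ℕ.+ c)

Euler-ℚ : ∀ {c} {S : VertexSet n} {E : EdgeSet n} → Euler c S E → ι (vol E) ≡ 2ℚ * (ι (card S) + ι c) - 2ℚ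
Euler-ℚ {c = c} {S} {E} euler = begin
  ι (vol E)
    ≡⟨ solve 1 (λ v → v := (v :+ con 2ℚ) :- con 2ℚ) refl (ι (vol E)) ⟩
  (ι (vol E) + ι 2) - 2ℚ
    ≡⟨ cong (_- 2ℚ) (ι-+ (vol E) 2) ⟨
  ι (vol E ℕ.+ 2) - 2ℚ
    ≡⟨ cong (λ t → ι t - 2ℚ) euler ⟩
  ι (2 ℕ.* (card S ℕ.+ c)) - 2ℚ
    ≡⟨ cong (_- 2ℚ) (trans (ι-* 2 (card S ℕ.+ c)) (cong (2ℚ *_) (ι-+ (card S) c))) ⟩
  2ℚ * (ι (card S) + ι c) - 2ℚ ∎
  where open ≡-Reasoning

-- The part of the increase of `total` that depends on the vertex `z` at which a pendant vertex is
-- attached. Accordingly `pointMax` is, up to a linear term, the difference of consecutive values of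
-- `totalMax`.
pointSum : VertexSet n → EdgeSet n → (Fin n → Fin n → ℚ) → Fin n → ℚ
pointSum S E r z = distSum S r z + distSum S r z + degDistSum E r z

-- Candidate maxima, as polynomials in the number N of vertices. The dependence on N is forced by
-- adding pendant vertices at an extremal vertex; only the constants κ, φ, α depend on the base graph.
record Level : Set where
  constructor level
  field
    cyc   : ℕ
    κ φ α : ℚ

  distMax pointMax totalMax : ℚ → ℚ
  distMax  N = ½ * (N * (N - 1ℚ)) - κ
  pointMax N = 2ℚ * (N * N) - (+ 3 / 1) * N + 1ℚ + 2ℚ * ι cyc * N - φ
  totalMax N = ⅓ * (N * (N - 1ℚ) * (2ℚ * N - 1ℚ)) + ι cyc * (N * N) + (ι cyc - φ) * N - α

record Exact (lv : Level) (S : VertexSet n) (E : EdgeSet n) (r : Fin n → Fin n → ℚ) (z : Fin n) : Set where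
  open Level lv
  field
    dist-≡  : distSum S r z ≡ distMax (ι (card S))
    point-≡ : pointSum S E r z ≡ pointMax (ι (card S))
    total-≡ : total S E r ≡ totalMax (ι (card S))

-- The bound on single resistances is carried along because an old vertex `z` gains the distance
-- `1ℚ + r y z` to a new pendant vertex: as this is at most the old number of vertices, the sums at
-- `z` grow no faster than the maxima.
record Bounded (lv : Level) (S : VertexSet n) (E : EdgeSet n) (r : Fin n → Fin n → ℚ) : Set where
  open Level lv
  field
    r-≤     : ∀ u v → S u ≡ true → S v ≡ true → r u v ≤ℚ ι (card S) - 1ℚ
    dist-≤  : ∀ z → S z ≡ true → distSum S r z ≤ℚ distMax (ι (card S))
    point-≤ : ∀ z → S z ≡ true → pointSum S E r z ≤ℚ pointMax (ι (card S))
    total-≤ : total S E r ≤ℚ totalMax (ι (card S))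

module _ {S S′ : VertexSet n} {E E′ : EdgeSet n} {x y : Fin n} (leaf : Leaf S E S′ E′ x y) where
  open Leaf leaf

  Euler-up : ∀ {c} → Euler c S′ E′ → Euler c S E
  Euler-up {c} euler = begin
    vol E ℕ.+ 2
      ≡⟨ cong (ℕ._+ 2) (vol-edge {E′ = E′} {E = E} edge) ⟩
    vol E′ ℕ.+ 2 ℕ.+ 2
      ≡⟨ cong (ℕ._+ 2) euler ⟩
    2 ℕ.* (card S′ ℕ.+ c) ℕ.+ 2
      ≡⟨ ℕ.+-comm (2 ℕ.* (card S′ ℕ.+ c)) 2 ⟩
    2 ℕ.+ 2 ℕ.* (card S′ ℕ.+ c)
      ≡⟨ ℕ.*-suc 2 (card S′ ℕ.+ c) ⟨
    2 ℕ.* (suc (card S′) ℕ.+ c)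
      ≡⟨ cong (λ t → 2 ℕ.* (t ℕ.+ c)) card-leaf ⟨
    2 ℕ.* (card S ℕ.+ c) ∎
    where open ≡-Reasoning

  Euler-down : ∀ {c} → Euler c S E → Euler c S′ E′
  Euler-down {c} euler = ℕ.+-cancelʳ-≡ 2 _ _ (begin
    vol E′ ℕ.+ 2 ℕ.+ 2
      ≡⟨ cong (ℕ._+ 2) (vol-edge {E′ = E′} {E = E} edge) ⟨
    vol E ℕ.+ 2
      ≡⟨ euler ⟩
    2 ℕ.* (card S ℕ.+ c)
      ≡⟨ cong (λ t → 2 ℕ.* (t ℕ.+ c)) card-leaf ⟩
    2 ℕ.* (suc (card S′) ℕ.+ c)
      ≡⟨ ℕ.*-suc 2 (card S′ ℕ.+ c) ⟩
    2 ℕ.+ 2 ℕ.* (card S′ ℕ.+ c)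
      ≡⟨ ℕ.+-comm 2 (2 ℕ.* (card S′ ℕ.+ c)) ⟩
    2 ℕ.* (card S′ ℕ.+ c) ℕ.+ 2 ∎)
    where open ≡-Reasoning

  module LeafBounds (lv : Level) (euler : Euler (Level.cyc lv) S′ E′) {r : Fin n → Fin n → ℚ} (res : Resistance S E r) where
    open Level lv
    open LeafSums leaf res

    private
      N C : ℚ
      N = ι (card S′)
      C = ι cyc

      card≡ : ι (card S) ≡ N + 1ℚ
      card≡ = trans (cong ι card-leaf) (ι-suc (card S′))

      vol≡ : ι (vol E′) ≡ 2ℚ * (N + C) - 2ℚ
      vol≡ = Euler-ℚ {S = S′} {E = E′} euler

      dist-step : N + distMax N ≡ distMax (N + 1ℚ)
      dist-step = solve 2 (λ N k → N :+ (con ½ :* (N :* (N :- con 1ℚ)) :- k)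
                                 := con ½ :* ((N :+ con 1ℚ) :* ((N :+ con 1ℚ) :- con 1ℚ)) :- k) refl N κ

      point-step : pointMax N + ((+ 4 / 1) * N + 2ℚ * C - 1ℚ) ≡ pointMax (N + 1ℚ)
      point-step = solve 3 (λ N C f →
        (con 2ℚ :* (N :* N) :- con (+ 3 / 1) :* N :+ con 1ℚ :+ con 2ℚ :* C :* N :- f) :+ (con (+ 4 / 1) :* N :+ con 2ℚ :* C :- con 1ℚ)
        := con 2ℚ :* ((N :+ con 1ℚ) :* (N :+ con 1ℚ)) :- con (+ 3 / 1) :* (N :+ con 1ℚ) :+ con 1ℚ :+ con 2ℚ :* C :* (N :+ con 1ℚ) :- f) refl N C φ

      total-step : totalMax N + pointMax N + ((+ 3 / 1) * N + 2ℚ * C - 1ℚ) ≡ totalMax (N + 1ℚ)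
      total-step = solve 4 (λ N C f a →
        let P = con 2ℚ :* (N :* N) :- con (+ 3 / 1) :* N :+ con 1ℚ :+ con 2ℚ :* C :* N :- f
            W = λ N → con ⅓ :* (N :* (N :- con 1ℚ) :* (con 2ℚ :* N :- con 1ℚ)) :+ C :* (N :* N) :+ (C :- f) :* N :- a
        in W N :+ P :+ (con (+ 3 / 1) :* N :+ con 2ℚ :* C :- con 1ℚ) := W (N :+ con 1ℚ)) refl N C φ α

      point-new : pointSum S E r x ≡ pointSum S′ E′ r y + ((+ 4 / 1) * N + 2ℚ * C - 1ℚ)
      point-new = trans
        (cong₂ (λ p q → p + p + q) distSum-new (trans degDistSum-new (cong (λ t → (t + degDistSum E′ r y) + 1ℚ) vol≡)))
        (solve 4 (λ N C R D → (N :+ R) :+ (N :+ R) :+ ((con 2ℚ :* (N :+ C) :- con 2ℚ :+ D) :+ con 1ℚ)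
                              := R :+ R :+ D :+ (con (+ 4 / 1) :* N :+ con 2ℚ :* C :- con 1ℚ)) refl N C (distSum S′ r y) (degDistSum E′ r y))

      total-new : total S E r ≡ total S′ E′ r + pointSum S′ E′ r y + ((+ 3 / 1) * N + 2ℚ * C - 1ℚ)
      total-new = trans total-leaf (trans (cong (λ t → total S′ E′ r + (t + degDistSum E′ r y) + ((N + distSum S′ r y) + (distSum S′ r y + 1ℚ))) vol≡)
        (solve 5 (λ N C R D W → W :+ (con 2ℚ :* (N :+ C) :- con 2ℚ :+ D) :+ ((N :+ R) :+ (R :+ con 1ℚ))
                                := W :+ (R :+ R :+ D) :+ (con (+ 3 / 1) :* N :+ con 2ℚ :* C :- con 1ℚ)) refl N C (distSum S′ r y) (degDistSum E′ r y) (total S′ E′ r)))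

      point-old : ∀ z → S′ z ≡ true → pointSum S E r z ≡ pointSum S′ E′ r z + ((+ 3 / 1) + (+ 4 / 1) * r y z)
      point-old z z∈ = trans (cong₂ (λ p q → p + p + q) (distSum-old z z∈) (degDistSum-old z z∈))
        (solve 3 (λ R D s → (R :+ (con 1ℚ :+ s)) :+ (R :+ (con 1ℚ :+ s)) :+ (D :+ ((con 1ℚ :+ s) :+ s))
                            := R :+ R :+ D :+ (con (+ 3 / 1) :+ con (+ 4 / 1) :* s)) refl (distSum S′ r z) (degDistSum E′ r z) (r y z))

    leaf-exact : Exact lv S′ E′ r y → Exact lv S E r x
    leaf-exact ex = record
      { dist-≡  = trans distSum-new (trans (cong (λ t → N + t) dist-≡) (trans dist-step (cong distMax (≡-sym card≡))))
      ; point-≡ = trans point-new (trans (cong (_+ ((+ 4 / 1) * N + 2ℚ * C - 1ℚ)) point-≡) (trans point-step (cong pointMax (≡-sym card≡))))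
      ; total-≡ = trans total-new (trans (cong₂ (λ p q → p + q + ((+ 3 / 1) * N + 2ℚ * C - 1ℚ)) total-≡ point-≡) (trans total-step (cong totalMax (≡-sym card≡))))
      } where open Exact ex

    leaf-bounded : Bounded lv S′ E′ r → Bounded lv S E r
    leaf-bounded bd = record
      { r-≤ = λ u v u∈ v∈ → subst (λ t → r u v ≤ℚ t) (≡-sym N≡) (r≤N u v (member↓ u u∈) (member↓ v v∈))
      ; dist-≤ = λ z z∈ → subst (λ t → distSum S r z ≤ℚ distMax t) (≡-sym card≡) (dist≤ z (member↓ z z∈))
      ; point-≤ = λ z z∈ → subst (λ t → pointSum S E r z ≤ℚ pointMax t) (≡-sym card≡) (point≤ z (member↓ z z∈))
      ; total-≤ = subst (λ t → total S E r ≤ℚ totalMax t) (≡-sym card≡) total≤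
      }
      where
      open Bounded bd
      open ℚ.≤-Reasoning
      N≡ : ι (card S) - 1ℚ ≡ N
      N≡ = trans (cong (_- 1ℚ) card≡) (solve 1 (λ N → (N :+ con 1ℚ) :- con 1ℚ := N) refl N)
      1+[N-1] : 1ℚ + (N - 1ℚ) ≡ N
      1+[N-1] = solve 1 (λ N → con 1ℚ :+ (N :- con 1ℚ) := N) refl N
      1+r≤N : ∀ v → S′ v ≡ true → 1ℚ + r y v ≤ℚ N
      1+r≤N v v∈ = begin
        1ℚ + r y v
          ≤⟨ ℚ.+-monoʳ-≤ 1ℚ (r-≤ y v anchor v∈) ⟩
        1ℚ + (N - 1ℚ)
          ≡⟨ 1+[N-1] ⟩
        N ∎
      r≤N : ∀ u v → S′ u ≡ true ⊎ u ≡ x → S′ v ≡ true ⊎ v ≡ x → r u v ≤ℚ N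
      r≤N u v (inj₁ u∈) (inj₁ v∈) = begin
        r u v
          ≤⟨ r-≤ u v u∈ v∈ ⟩
        N - 1ℚ
          ≡⟨ ℚ.+-identityˡ _ ⟨
        0ℚ + (N - 1ℚ)
          ≤⟨ ℚ.+-monoˡ-≤ (N - 1ℚ) 0≤1 ⟩
        1ℚ + (N - 1ℚ)
          ≡⟨ 1+[N-1] ⟩
        N ∎
      r≤N .x v (inj₂ refl) (inj₁ v∈) = ℚ.≤-trans (ℚ.≤-reflexive (r-leaf v v∈)) (1+r≤N v v∈)
      r≤N u .x (inj₁ u∈) (inj₂ refl) = ℚ.≤-trans (ℚ.≤-reflexive (r-leafʳ u u∈)) (1+r≤N u u∈)
      r≤N .x .x (inj₂ refl) (inj₂ refl) = ℚ.≤-trans (ℚ.≤-reflexive r-self) (0≤ι (card S′))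
      dist≤ : ∀ z → S′ z ≡ true ⊎ z ≡ x → distSum S r z ≤ℚ distMax (N + 1ℚ)
      dist≤ z (inj₁ z∈) = begin
        distSum S r z
          ≡⟨ distSum-old z z∈ ⟩
        distSum S′ r z + (1ℚ + r y z)
          ≤⟨ ℚ.+-mono-≤ (dist-≤ z z∈) (1+r≤N z z∈) ⟩
        distMax N + N
          ≡⟨ ℚ.+-comm (distMax N) N ⟩
        N + distMax N
          ≡⟨ dist-step ⟩
        distMax (N + 1ℚ) ∎
      dist≤ .x (inj₂ refl) = begin
        distSum S r x
          ≡⟨ distSum-new ⟩
        N + distSum S′ r y
          ≤⟨ ℚ.+-monoʳ-≤ N (dist-≤ y anchor) ⟩
        N + distMax N
          ≡⟨ dist-step ⟩
        distMax (N + 1ℚ) ∎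
      point≤ : ∀ z → S′ z ≡ true ⊎ z ≡ x → pointSum S E r z ≤ℚ pointMax (N + 1ℚ)
      point≤ z (inj₁ z∈) = begin
        pointSum S E r z
          ≡⟨ point-old z z∈ ⟩
        pointSum S′ E′ r z + ((+ 3 / 1) + (+ 4 / 1) * r y z)
          -- Written as 4(1 + r) - 1, so that 1 + r ≤ N applies; the slack against the wanted
          -- increment is 2C, which is nonnegative.
          ≡⟨ cong (λ t → pointSum S′ E′ r z + t) (solve 1 (λ s → con (+ 3 / 1) :+ con (+ 4 / 1) :* s := con (+ 4 / 1) :* (con 1ℚ :+ s) :+ (con 0ℚ :- con 1ℚ)) refl (r y z)) ⟩
        pointSum S′ E′ r z + ((+ 4 / 1) * (1ℚ + r y z) + (0ℚ - 1ℚ))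
          ≤⟨ ℚ.+-mono-≤ (point-≤ z z∈) (ℚ.+-mono-≤ (ℚ.*-monoˡ-≤-nonNeg (+ 4 / 1) (1+r≤N z z∈)) (ℚ.+-monoˡ-≤ (- 1ℚ) (0≤ι (2 ℕ.* cyc)))) ⟩
        pointMax N + ((+ 4 / 1) * N + (ι (2 ℕ.* cyc) - 1ℚ))
          ≡⟨ cong (λ t → pointMax N + t) (trans (cong (λ t → (+ 4 / 1) * N + (t - 1ℚ)) (ι-* 2 cyc)) (≡-sym (ℚ.+-assoc ((+ 4 / 1) * N) (2ℚ * C) (- 1ℚ)))) ⟩
        pointMax N + ((+ 4 / 1) * N + 2ℚ * C - 1ℚ)
          ≡⟨ point-step ⟩
        pointMax (N + 1ℚ) ∎
      point≤ .x (inj₂ refl) = begin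
        pointSum S E r x
          ≡⟨ point-new ⟩
        pointSum S′ E′ r y + ((+ 4 / 1) * N + 2ℚ * C - 1ℚ)
          ≤⟨ ℚ.+-monoˡ-≤ _ (point-≤ y anchor) ⟩
        pointMax N + ((+ 4 / 1) * N + 2ℚ * C - 1ℚ)
          ≡⟨ point-step ⟩
        pointMax (N + 1ℚ) ∎
      total≤ : total S E r ≤ℚ totalMax (N + 1ℚ)
      total≤ = begin
        total S E r
          ≡⟨ total-new ⟩
        total S′ E′ r + pointSum S′ E′ r y + ((+ 3 / 1) * N + 2ℚ * C - 1ℚ)
          ≤⟨ ℚ.+-monoˡ-≤ _ (ℚ.+-mono-≤ total-≤ (point-≤ y anchor)) ⟩
        totalMax N + pointMax N + ((+ 3 / 1) * N + 2ℚ * C - 1ℚ)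
          ≡⟨ total-step ⟩
        totalMax (N + 1ℚ) ∎

-- Pendant paths

-- S, E arises from S₁, E₁ by growing a pendant path of length ℓ from y to x. In applications w is the degree
-- after an edge x y has been added, which is 2 along the path.
data Chain (w : Fin n → ℕ) (S₁ : VertexSet n) (E₁ : EdgeSet n) (y : Fin n) : VertexSet n → EdgeSet n → Fin n → ℕ → Set where
  stop : Sym E₁ → S₁ y ≡ true → Chain w S₁ E₁ y S₁ E₁ y 0
  grow : ∀ {S E S′ E′ x x′ ℓ} → Leaf S E S′ E′ x x′ → w x ≡ 2 → Chain w S₁ E₁ y S′ E′ x′ ℓ → Chain w S₁ E₁ y S E x (suc ℓ)

module _ {w : Fin n → ℕ} {S₁ : VertexSet n} {E₁ : EdgeSet n} {y : Fin n} where

  Chain-sym : ∀ {S E x ℓ} → Chain w S₁ E₁ y S E x ℓ → Sym E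
  Chain-sym (stop s _)     = s
  Chain-sym (grow leaf _ _) = Leaf.sym-E leaf

  Chain-end∈ : ∀ {S E x ℓ} → Chain w S₁ E₁ y S E x ℓ → S y ≡ true
  Chain-end∈ (stop _ y∈)       = y∈
  Chain-end∈ (grow leaf _ ch) = Leaf.member↑ leaf (Chain-end∈ ch)

  Chain-start∈ : ∀ {S E x ℓ} → Chain w S₁ E₁ y S E x ℓ → S x ≡ true
  Chain-start∈ (stop _ y∈)       = y∈
  Chain-start∈ (grow leaf _ _) = Leaf.leaf∈ leaf

  Chain-card : ∀ {S E x ℓ} → Chain w S₁ E₁ y S E x ℓ → card S ≡ ℓ ℕ.+ card S₁
  Chain-card (stop _ _)        = refl
  Chain-card (grow leaf _ ch) = trans (Leaf.card-leaf leaf) (cong suc (Chain-card ch))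

  Chain-Euler-up : ∀ {S E x ℓ c} → Chain w S₁ E₁ y S E x ℓ → Euler c S₁ E₁ → Euler c S E
  Chain-Euler-up (stop _ _)        euler = euler
  Chain-Euler-up (grow leaf _ ch) euler = Euler-up leaf (Chain-Euler-up ch euler)

  Chain-resistance : ∀ {S E x ℓ r} → Chain w S₁ E₁ y S E x ℓ → Resistance S E r → Resistance S₁ E₁ r
  Chain-resistance (stop _ _)        res = res
  Chain-resistance (grow leaf _ ch) res = Chain-resistance ch (LeafSums.res′ leaf res)

  module _ (lv : Level) (euler : Euler (Level.cyc lv) S₁ E₁) where

    Chain-exact : ∀ {S E x ℓ r} → Chain w S₁ E₁ y S E x ℓ → Resistance S E r → Exact lv S₁ E₁ r y → Exact lv S E r x
    Chain-exact (stop _ _)        res ex = ex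
    Chain-exact (grow leaf _ ch) res ex =
      LeafBounds.leaf-exact leaf lv (Chain-Euler-up ch euler) res (Chain-exact ch (LeafSums.res′ leaf res) ex)

  -- All current runs along the path, so ψ is the distance to `y` on the path and 0 elsewhere. The
  -- plain sums are those of k and k² for k up to ℓ; the weighted ones are twice these, as `w` is 2
  -- on the path and the weight of `y` is multiplied by ψ y = 0. `on-path` separates base vertices,
  -- where ψ vanishes, from path vertices, whose resistance to `x` is a difference of values of ψ.
  record UnitPotential (S : VertexSet n) (E : EdgeSet n) (x : Fin n) (ℓ : ℕ) : Set where
    L : ℚ
    L = ι ℓ
    field
      ψ         : Fin n → ℚ
      potential : Potential E x y ψ
      at-end    : ψ y ≡ 0ℚ
      at-start  : ψ x ≡ L
      support   : ∀ u → S u ≡ false → ψ u ≡ 0ℚ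
      sum       : ∑ᵥ S ψ ≡ ½ * (L * (L + 1ℚ))
      sum²      : ∑ᵥ S (λ u → ψ u * ψ u) ≡ ⅓ * ½ * (L * (L + 1ℚ) * (2ℚ * L + 1ℚ))
      wsum      : ∑ (λ u → ι (w u) * ψ u) ≡ L * (L + 1ℚ)
      wsum²     : ∑ (λ u → ι (w u) * (ψ u * ψ u)) ≡ ⅓ * (L * (L + 1ℚ) * (2ℚ * L + 1ℚ))
      on-path   : ∀ r → Resistance S E r → ∀ z → S z ≡ true → (S₁ z ≡ true × ψ z ≡ 0ℚ) ⊎ (0ℚ ≤ℚ ψ z × r x z ≡ ψ x - ψ z)

  private
    potential-stop : Sym E₁ → S₁ y ≡ true → UnitPotential S₁ E₁ y 0
    potential-stop _ _ = record
      { ψ = λ _ → 0ℚ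
      ; potential = λ u → trans (∑-cong (λ t → ℚ.*-zeroʳ (b2ℚ (E₁ u t)))) (trans (∑-zero {n}) (≡-sym (ℚ.+-inverseʳ (δ u y))))
      ; at-end = refl
      ; at-start = refl
      ; support = λ _ _ → refl
      ; sum = ∑-*-zero (λ u → b2ℚ (S₁ u))
      ; sum² = ∑-*-zero (λ u → b2ℚ (S₁ u))
      ; wsum = ∑-*-zero (λ u → ι (w u))
      ; wsum² = ∑-*-zero (λ u → ι (w u))
      ; on-path = λ _ _ _ z∈ → inj₁ (z∈ , refl)
      }

    module Grow {S E S′ E′ x x′ ℓ} (leaf : Leaf S E S′ E′ x x′) (wx : w x ≡ 2) (y∈ : S′ y ≡ true) (up : UnitPotential S′ E′ x′ ℓ) where
      open Leaf leaf
      open UnitPotential up renaming (ψ to ψ′)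
      open ≡-Reasoning

      l : ℚ
      l = ι (suc ℓ)

      l≡ : l ≡ L + 1ℚ
      l≡ = ι-suc ℓ

      -- The old potential vanishes at `x`, which lies outside `S′`, so the added term sets the
      -- value there to the new length.
      ψ : Fin n → ℚ
      ψ u = ψ′ u + l * δ u x

      ψ-old : ∀ u → u ≢ x → ψ u ≡ ψ′ u
      ψ-old u u≢ = trans (cong (λ t → ψ′ u + l * t) (δ-≢ u≢)) (solve 2 (λ p l → p :+ l :* con 0ℚ := p) refl (ψ′ u) l)

      ψ-new : ψ x ≡ l
      ψ-new = trans (cong₂ (λ p t → p + l * t) (support x leaf∉) (δ-refl x)) (solve 1 (λ l → con 0ℚ :+ l :* con 1ℚ := l) refl l)

      lap-δ : ∀ u → lap E′ (λ t → δ t x) u ≡ 0ℚ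
      lap-δ u = trans (∑-cong term) (∑-zero {n})
        where
        zero-term : ∀ t → E′ u t ≡ true → δ u x - δ t x ≡ 0ℚ
        zero-term t e = trans (cong₂ _-_ (δ-≢ (≢leaf (within′ u t e))) (δ-≢ (≢leaf (within′ t u (trans (sym-E′ t u) e))))) refl
        term : ∀ t → b2ℚ (E′ u t) * (δ u x - δ t x) ≡ 0ℚ
        term t with E′ u t in e
        ... | true  = trans (ℚ.*-identityˡ _) (zero-term t e)
        ... | false = ℚ.*-zeroˡ (δ u x - δ t x)

      potential-grow : Potential E x y ψ
      potential-grow u = begin
        lap E ψ u
          ≡⟨ lap-edge {E′ = E′} {E = E} edge ψ u ⟩
        lap E′ ψ u + (ψ x - ψ x′) * (δ u x - δ u x′)
          ≡⟨ cong₂ (λ p q → p + q * (δ u x - δ u x′)) (lap-linear E′ ψ′ (λ t → δ t x) l u)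
               (trans (cong₂ _-_ ψ-new (trans (ψ-old x′ (≢leaf anchor)) at-start)) (trans (cong (_- L) l≡) (solve 1 (λ L → (L :+ con 1ℚ) :- L := con 1ℚ) refl L))) ⟩
        (lap E′ ψ′ u + l * lap E′ (λ t → δ t x) u) + 1ℚ * (δ u x - δ u x′)
          ≡⟨ cong₂ (λ p q → (p + l * q) + 1ℚ * (δ u x - δ u x′)) (potential u) (lap-δ u) ⟩
        ((δ u x′ - δ u y) + l * 0ℚ) + 1ℚ * (δ u x - δ u x′)
          ≡⟨ solve 4 (λ a b c l → ((a :- b) :+ l :* con 0ℚ) :+ con 1ℚ :* (c :- a) := c :- b) refl (δ u x′) (δ u y) (δ u x) l ⟩
        δ u x - δ u y ∎

      ψ² : ∀ u → ψ u * ψ u ≡ ψ′ u * ψ′ u + l * l * δ u x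
      ψ² u = begin
        ψ u * ψ u
          ≡⟨ solve 3 (λ p l d → (p :+ l :* d) :* (p :+ l :* d) := p :* p :+ ((l :+ l) :* (d :* p) :+ l :* l :* (d :* d))) refl (ψ′ u) l (δ u x) ⟩
        ψ′ u * ψ′ u + ((l + l) * (δ u x * ψ′ u) + l * l * (δ u x * δ u x))
          ≡⟨ cong₂ (λ p q → ψ′ u * ψ′ u + ((l + l) * p + l * l * q)) (trans (δ-subst ψ′ u x) (cong (δ u x *_) (support x leaf∉))) (trans (δ-subst (λ t → δ t x) u x) (cong (δ u x *_) (δ-refl x))) ⟩
        ψ′ u * ψ′ u + ((l + l) * (δ u x * 0ℚ) + l * l * (δ u x * 1ℚ))
          ≡⟨ solve 3 (λ p l d → p :+ ((l :+ l) :* (d :* con 0ℚ) :+ l :* l :* (d :* con 1ℚ)) := p :+ l :* l :* d) refl (ψ′ u * ψ′ u) l (δ u x) ⟩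
        ψ′ u * ψ′ u + l * l * δ u x ∎

      ∑-point : (f g : Fin n → ℚ) (a : ℚ) → ∑ (λ u → f u * (g u + a * δ u x)) ≡ ∑ (λ u → f u * g u) + f x * a
      ∑-point f g a = begin
        ∑ (λ u → f u * (g u + a * δ u x))
          ≡⟨ ∑-cong (λ u → solve 4 (λ f g a d → f :* (g :+ a :* d) := f :* g :+ d :* (f :* a)) refl (f u) (g u) a (δ u x)) ⟩
        ∑ (λ u → f u * g u + δ u x * (f u * a))
          ≡⟨ ∑-+ (λ u → f u * g u) _ ⟩
        ∑ (λ u → f u * g u) + ∑ (λ u → δ u x * (f u * a))
          ≡⟨ cong (λ t → ∑ (λ u → f u * g u) + t) (∑-δ (λ u → f u * a) x) ⟩
        ∑ (λ u → f u * g u) + f x * a ∎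

      ∑ᵥ-point : ∀ (g : Fin n → ℚ) a → g x ≡ 0ℚ → ∑ᵥ S (λ u → g u + a * δ u x) ≡ ∑ᵥ S′ g + a
      ∑ᵥ-point g a gx = begin
        ∑ᵥ S (λ u → g u + a * δ u x)
          ≡⟨ ∑-point (λ u → b2ℚ (S u)) g a ⟩
        ∑ᵥ S g + b2ℚ (S x) * a
          ≡⟨ cong₂ (λ p b → p + b2ℚ b * a) (∑ᵥ-leaf g) leaf∈ ⟩
        (∑ᵥ S′ g + g x) + 1ℚ * a
          ≡⟨ cong₂ _+_ (trans (cong (λ t → ∑ᵥ S′ g + t) gx) (ℚ.+-identityʳ (∑ᵥ S′ g))) (ℚ.*-identityˡ a) ⟩
        ∑ᵥ S′ g + a ∎

      private
        ∑w-point : ∀ (g : Fin n → ℚ) a → ∑ (λ u → ι (w u) * (g u + a * δ u x)) ≡ ∑ (λ u → ι (w u) * g u) + 2ℚ * a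
        ∑w-point g a = trans (∑-point (λ u → ι (w u)) g a) (cong (λ t → ∑ (λ u → ι (w u) * g u) + ι t * a) wx)

        support² : ψ′ x * ψ′ x ≡ 0ℚ
        support² = trans (cong (_* ψ′ x) (support x leaf∉)) (ℚ.*-zeroˡ (ψ′ x))

      grown : UnitPotential S E x (suc ℓ)
      grown = record
        { ψ = ψ
        ; potential = potential-grow
        ; at-end = trans (ψ-old y (≢leaf y∈)) at-end
        ; at-start = ψ-new
        ; support = support-grow
        ; sum = trans (∑ᵥ-point ψ′ l (support x leaf∉)) (trans (cong₂ _+_ sum l≡)
            (trans (solve 1 (λ L → con ½ :* (L :* (L :+ con 1ℚ)) :+ (L :+ con 1ℚ) := con ½ :* ((L :+ con 1ℚ) :* ((L :+ con 1ℚ) :+ con 1ℚ))) refl L)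
                   (cong (λ l → ½ * (l * (l + 1ℚ))) (≡-sym l≡))))
        ; sum² = trans (∑-cong (λ u → cong (b2ℚ (S u) *_) (ψ² u))) (trans (∑ᵥ-point (λ u → ψ′ u * ψ′ u) (l * l) support²) (trans (cong₂ (λ p l → p + l * l) sum² l≡)
            (trans (solve 1 (λ L → let q = λ L → con ⅓ :* con ½ :* (L :* (L :+ con 1ℚ) :* (con 2ℚ :* L :+ con 1ℚ)) in q L :+ (L :+ con 1ℚ) :* (L :+ con 1ℚ) := q (L :+ con 1ℚ)) refl L)
                   (cong (λ l → ⅓ * ½ * (l * (l + 1ℚ) * (2ℚ * l + 1ℚ))) (≡-sym l≡)))))
        ; wsum = trans (∑w-point ψ′ l) (trans (cong₂ (λ p l → p + 2ℚ * l) wsum l≡)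
            (trans (solve 1 (λ L → L :* (L :+ con 1ℚ) :+ con 2ℚ :* (L :+ con 1ℚ) := (L :+ con 1ℚ) :* ((L :+ con 1ℚ) :+ con 1ℚ)) refl L)
                   (cong (λ l → l * (l + 1ℚ)) (≡-sym l≡))))
        ; wsum² = trans (∑-cong (λ u → cong (ι (w u) *_) (ψ² u))) (trans (∑w-point (λ u → ψ′ u * ψ′ u) (l * l)) (trans (cong₂ (λ p l → p + 2ℚ * (l * l)) wsum² l≡)
            (trans (solve 1 (λ L → let q = λ L → con ⅓ :* (L :* (L :+ con 1ℚ) :* (con 2ℚ :* L :+ con 1ℚ)) in q L :+ con 2ℚ :* ((L :+ con 1ℚ) :* (L :+ con 1ℚ)) := q (L :+ con 1ℚ)) refl L)
                   (cong (λ l → ⅓ * (l * (l + 1ℚ) * (2ℚ * l + 1ℚ))) (≡-sym l≡)))))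
        ; on-path = λ r res z z∈ → on-path-grow r res z (member↓ z z∈)
        }
        where
        support-grow : ∀ u → S u ≡ false → ψ u ≡ 0ℚ
        support-grow u u∉ = trans (ψ-old u u≢x) (support u u∉′)
          where
          u≢x : u ≢ x
          u≢x refl = case trans (≡-sym leaf∈) u∉ of λ ()
          u∉′ : S′ u ≡ false
          u∉′ with S′ u in e
          ... | true  = case trans (≡-sym (member↑ e)) u∉ of λ ()
          ... | false = refl
        on-path-grow : ∀ r → Resistance S E r → ∀ z → S′ z ≡ true ⊎ z ≡ x → (S₁ z ≡ true × ψ z ≡ 0ℚ) ⊎ (0ℚ ≤ℚ ψ z × r x z ≡ ψ x - ψ z)
        on-path-grow r res z (inj₁ z∈) = old (on-path r (LeafSums.res′ leaf res) z z∈)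
          where
          ψz : ψ z ≡ ψ′ z
          ψz = ψ-old z (≢leaf z∈)
          old : (S₁ z ≡ true × ψ′ z ≡ 0ℚ) ⊎ (0ℚ ≤ℚ ψ′ z × r x′ z ≡ ψ′ x′ - ψ′ z) → (S₁ z ≡ true × ψ z ≡ 0ℚ) ⊎ (0ℚ ≤ℚ ψ z × r x z ≡ ψ x - ψ z)
          old (inj₁ (z∈₁ , e)) = inj₁ (z∈₁ , trans ψz e)
          old (inj₂ (0≤ , e))   = inj₂ (ℚ.≤-trans 0≤ (ℚ.≤-reflexive (≡-sym ψz)) , (begin
            r x z
              ≡⟨ LeafSums.r-leaf leaf res z z∈ ⟩
            1ℚ + r x′ z
              ≡⟨ cong (λ t → 1ℚ + t) (trans e (cong (_- ψ′ z) at-start)) ⟩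
            1ℚ + (L - ψ′ z)
              ≡⟨ solve 2 (λ L p → con 1ℚ :+ (L :- p) := (L :+ con 1ℚ) :- p) refl L (ψ′ z) ⟩
            (L + 1ℚ) - ψ′ z
              ≡⟨ cong₂ _-_ (trans ψ-new l≡) ψz ⟨
            ψ x - ψ z ∎))
        on-path-grow r res .x (inj₂ refl) = inj₂
          ( ℚ.≤-trans (0≤ι (suc ℓ)) (ℚ.≤-reflexive (≡-sym ψ-new))
          , trans (LeafSums.r-self leaf res) (≡-sym (ℚ.+-inverseʳ (ψ x))))

  unitPotential : ∀ {S E x ℓ} → Chain w S₁ E₁ y S E x ℓ → UnitPotential S E x ℓ
  unitPotential (stop s y∈)        = potential-stop s y∈
  unitPotential (grow leaf wx ch) = Grow.grown leaf wx (Chain-end∈ ch) (unitPotential ch)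

-- `level₀` fits a path seen from its end, `level₁` a triangle with a tail seen from the end of the
-- tail: 5/3, 32/3 and -18 are the constants that make the three polynomials exact for the triangle,
-- where they take the values 4/3, 16/3 and 8. For `level₂` it is `totalMax` that gets attained, and
-- its constants come from closing a second triangle at the end of the tail. Its κ repeats that of
-- `level₁`, since adding an edge does not raise resistances.
level₀ level₁ level₂ : Level
level₀ = level 0 0ℚ 0ℚ 0ℚ
level₁ = level 1 (+ 5 / 3) (+ 32 / 3) (- (+ 18 / 1))
level₂ = level 2 (+ 5 / 3) (+ 64 / 3) (- (+ 88 / 3))

-- Closing a pendant path by one edge

reciprocal : ∀ ℓ → ∃ λ κ → κ * (1ℚ + ι ℓ) ≡ 1ℚ × 0ℚ ≤ℚ κ
reciprocal ℓ = κ , ℚ.*-inverseˡ (1ℚ + ι ℓ) , ℚ.<⇒≤ (ℚ.positive⁻¹ κ {{ℚ.1/pos⇒pos (1ℚ + ι ℓ)}})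
  where
  instance
    pos : ℚ.Positive (1ℚ + ι ℓ)
    pos = ℚ.positive (ℚ.<-≤-trans (ℚ.positive⁻¹ 1ℚ) (subst (_≤ℚ 1ℚ + ι ℓ) (ℚ.+-identityʳ 1ℚ) (ℚ.+-monoʳ-≤ 1ℚ (0≤ι ℓ))))
    nonZero : ℚ.NonZero (1ℚ + ι ℓ)
    nonZero = ℚ.pos⇒nonZero (1ℚ + ι ℓ)
  κ : ℚ
  κ = ℚ.1/ (1ℚ + ι ℓ)

0≤-* : ∀ {p q} → 0ℚ ≤ℚ p → 0ℚ ≤ℚ q → 0ℚ ≤ℚ p * q
0≤-* {p} {q} 0≤p 0≤q = subst (_≤ℚ p * q) (ℚ.*-zeroʳ p) (ℚ.*-monoˡ-≤-nonNeg p {{ℚ.nonNegative 0≤p}} 0≤q)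

0≤-+ : ∀ {p q} → 0ℚ ≤ℚ p → 0ℚ ≤ℚ q → 0ℚ ≤ℚ p + q
0≤-+ = ℚ.+-mono-≤

0≤-square : ∀ p → 0ℚ ≤ℚ p * p
0≤-square p with ℚ.≤-total 0ℚ p
... | inj₁ 0≤p = 0≤-* 0≤p 0≤p
... | inj₂ p≤0 = subst (0ℚ ≤ℚ_) (solve 1 (λ p → (:- p) :* (:- p) := p :* p) refl p) (0≤-* (ℚ.neg-antimono-≤ p≤0) (ℚ.neg-antimono-≤ p≤0))

≤-by : ∀ {p q} d → 0ℚ ≤ℚ d → p + d ≡ q → p ≤ℚ q
≤-by {p} {q} d 0≤d e = subst₂ _≤ℚ_ (ℚ.+-identityʳ p) e (ℚ.+-monoʳ-≤ p 0≤d)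

module ClosedChain {S S₁ : VertexSet n} {E E₁ T : EdgeSet n} {y c : Fin n} {ℓ : ℕ} (ch : Chain (degE E) S₁ E₁ y S T c ℓ)
                   (add : AddEdge T c y E) (sym-E : Sym E) {cyc : ℕ} (euler : Euler cyc S E)
                   {r : Fin n → Fin n → ℚ} (res : Resistance S E r) where
  open UnitPotential (unitPotential ch) public using (ψ; L)
  open UnitPotential (unitPotential ch) hiding (ψ; L)
  open ≡-Reasoning

  κ : ℚ
  κ = proj₁ (reciprocal ℓ)

  κ-inv : κ * (1ℚ + L) ≡ 1ℚ
  κ-inv = proj₁ (proj₂ (reciprocal ℓ))

  0≤κ : 0ℚ ≤ℚ κ
  0≤κ = proj₂ (proj₂ (reciprocal ℓ))

  sym-T : Sym T
  sym-T = Chain-sym ch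

  c∈ : S c ≡ true
  c∈ = Chain-start∈ ch

  y∈ : S y ≡ true
  y∈ = Chain-end∈ ch

  open Closing {T = T} {E = E} add sym-T sym-E c∈ y∈ res ψ potential at-end L κ at-start κ-inv public

  private
    N C μ : ℚ
    N = ι (card S)
    C = ι cyc
    μ = ι (vol E)

    μ≡ : μ ≡ 2ℚ * (N + C) - 2ℚ
    μ≡ = Euler-ℚ {S = S} {E = E} euler

    -- κ is the inverse of L + 1, and each moment of ψ contains the factor L(L + 1). So κ disappears
    -- from the formulas below except in the term with the square of ψ z.
    cancel : ∀ a → κ * (L * (L + 1ℚ) * a) ≡ L * a
    cancel a = trans (solve 3 (λ k l a → k :* (l :* (l :+ con 1ℚ) :* a) := (k :* (con 1ℚ :+ l)) :* (l :* a)) refl κ L a)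
                     (trans (cong (_* (L * a)) κ-inv) (ℚ.*-identityˡ (L * a)))

  rT-ends-sum : ∀ z → S z ≡ true → rT z c + rT z y ≡ rT c z + rT c z + ((ψ z + ψ z) - L)
  rT-ends-sum z z∈ = begin
    rT z c + rT z y
      ≡⟨ cong₂ _+_ (r-sym sym-T resT z c z∈ c∈) (trans (r-sym sym-T resT z y z∈ y∈) (rT-ends z z∈)) ⟩
    rT c z + (rT c z + ((ψ z + ψ z) - L))
      ≡⟨ ℚ.+-assoc (rT c z) (rT c z) ((ψ z + ψ z) - L) ⟨
    rT c z + rT c z + ((ψ z + ψ z) - L) ∎

  rT-cy : rT c y ≡ L
  rT-cy = begin
    rT c y
      ≡⟨ solve 2 (λ a l → a := (a :+ ((con 0ℚ :+ con 0ℚ) :- l)) :+ l) refl (rT c y) L ⟩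
    (rT c y + ((0ℚ + 0ℚ) - L)) + L
      ≡⟨ cong (λ t → (rT c y + ((t + t) - L)) + L) at-end ⟨
    (rT c y + ((ψ y + ψ y) - L)) + L
      ≡⟨ cong (_+ L) (rT-ends y y∈) ⟨
    rT y y + L
      ≡⟨ cong (_+ L) (r-diag sym-T resT y y∈) ⟩
    0ℚ + L
      ≡⟨ ℚ.+-identityˡ L ⟩
    L ∎

  -- Rayleigh's monotonicity law, visible here from the sign of the rank-one term.
  r≤rT : ∀ u v → r u v ≤ℚ rT u v
  r≤rT u v = ≤-by (κ * sq u v) (0≤-* 0≤κ (0≤-square (ψ u - ψ v))) refl

  distSum-≤ : ∀ z → distSum S r z ≤ℚ distSum S rT z
  distSum-≤ z = ∑-mono (λ v → ℚ.*-monoˡ-≤-nonNeg (b2ℚ (S v)) {{ℚ.nonNegative (ℚ.≤-trans (0≤ι (b2ℕ (S v))) (ℚ.≤-reflexive (≡-sym (b2ℚ-ι (S v)))))}} (r≤rT z v))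

  dist-formula : ∀ z → distSum S r z ≡ distSum S rT z - (κ * (ψ z * ψ z * N) - L * ψ z + ⅓ * ½ * (L * (2ℚ * L + 1ℚ)))
  dist-formula z = begin
    distSum S r z
      ≡⟨ distSum-closing z ⟩
    distSum S rT z + (- κ) * (ψ z * ψ z * N - (ψ z + ψ z) * ∑ᵥ S ψ + ∑ᵥ S (λ u → ψ u * ψ u))
      ≡⟨ cong₂ (λ p q → distSum S rT z + (- κ) * (ψ z * ψ z * N - (ψ z + ψ z) * p + q)) sum sum² ⟩
    distSum S rT z + (- κ) * (ψ z * ψ z * N - (ψ z + ψ z) * (½ * (L * (L + 1ℚ))) + ⅓ * ½ * (L * (L + 1ℚ) * (2ℚ * L + 1ℚ)))
      ≡⟨ solve 5 (λ D k p n l → D :+ (:- k) :* (p :* p :* n :- (p :+ p) :* (con ½ :* (l :* (l :+ con 1ℚ))) :+ con ⅓ :* con ½ :* (l :* (l :+ con 1ℚ) :* (con 2ℚ :* l :+ con 1ℚ)))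
           := D :- (k :* (p :* p :* n) :- k :* (l :* (l :+ con 1ℚ) :* p) :+ con ⅓ :* con ½ :* (k :* (l :* (l :+ con 1ℚ) :* (con 2ℚ :* l :+ con 1ℚ))))) refl (distSum S rT z) κ (ψ z) N L ⟩
    distSum S rT z - (κ * (ψ z * ψ z * N) - κ * (L * (L + 1ℚ) * ψ z) + ⅓ * ½ * (κ * (L * (L + 1ℚ) * (2ℚ * L + 1ℚ))))
      ≡⟨ cong₂ (λ p q → distSum S rT z - (κ * (ψ z * ψ z * N) - p + ⅓ * ½ * q)) (cancel (ψ z)) (cancel (2ℚ * L + 1ℚ)) ⟩
    distSum S rT z - (κ * (ψ z * ψ z * N) - L * ψ z + ⅓ * ½ * (L * (2ℚ * L + 1ℚ))) ∎

  degDist-formula : ∀ z → S z ≡ true → degDistSum E r z ≡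
    degDistSum T rT z + (rT c z + rT c z + ((ψ z + ψ z) - L)) - (κ * (ψ z * ψ z * μ) - 2ℚ * (L * ψ z) + ⅓ * (L * (2ℚ * L + 1ℚ)))
  degDist-formula z z∈ = begin
    degDistSum E r z
      ≡⟨ degDistSum-closing z ⟩
    (degDistSum T rT z + (rT z c + rT z y)) + (- κ) * (ψ z * ψ z * μ - (ψ z + ψ z) * ∑ᵈ E ψ + ∑ᵈ E (λ u → ψ u * ψ u))
      ≡⟨ cong₂ (λ s pq → (degDistSum T rT z + s) + (- κ) * pq) (rT-ends-sum z z∈) (cong₂ (λ p q → ψ z * ψ z * μ - (ψ z + ψ z) * p + q) wsum wsum²) ⟩
    D + (- κ) * (ψ z * ψ z * μ - (ψ z + ψ z) * (L * (L + 1ℚ)) + ⅓ * (L * (L + 1ℚ) * (2ℚ * L + 1ℚ)))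
      ≡⟨ solve 5 (λ D k p n l → D :+ (:- k) :* (p :* p :* n :- (p :+ p) :* (l :* (l :+ con 1ℚ)) :+ con ⅓ :* (l :* (l :+ con 1ℚ) :* (con 2ℚ :* l :+ con 1ℚ)))
           := D :- (k :* (p :* p :* n) :- con 2ℚ :* (k :* (l :* (l :+ con 1ℚ) :* p)) :+ con ⅓ :* (k :* (l :* (l :+ con 1ℚ) :* (con 2ℚ :* l :+ con 1ℚ))))) refl D κ (ψ z) μ L ⟩
    D - (κ * (ψ z * ψ z * μ) - 2ℚ * (κ * (L * (L + 1ℚ) * ψ z)) + ⅓ * (κ * (L * (L + 1ℚ) * (2ℚ * L + 1ℚ))))
      ≡⟨ cong₂ (λ p q → D - (κ * (ψ z * ψ z * μ) - 2ℚ * p + ⅓ * q)) (cancel (ψ z)) (cancel (2ℚ * L + 1ℚ)) ⟩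
    D - (κ * (ψ z * ψ z * μ) - 2ℚ * (L * ψ z) + ⅓ * (L * (2ℚ * L + 1ℚ))) ∎
    where
    D : ℚ
    D = degDistSum T rT z + (rT c z + rT c z + ((ψ z + ψ z) - L))

  -- What closing the path adds to `total` beyond twice the resistance sum at `c`. The terms L(L +
  -- 1) - LN compare the resistance sums at `y` and `c`; the bracket is the rank-one correction
  -- after κ has cancelled.
  gain : ℚ → ℚ → ℚ → ℚ
  gain C N L = L * (L + 1ℚ) - L * N - (⅓ * (L * (2ℚ * L + 1ℚ)) * (2ℚ * N + C - 1ℚ) - L * L * (L + 1ℚ))

  total-formula : total S E r ≡ total S T rT + (distSum S rT c + distSum S rT c) + gain C N L
  total-formula = begin
    total S E r
      ≡⟨ total-closing ⟩
    (total S T rT + (R + distSum S rT y)) + (- κ) * (N * ∑ᵈ E (λ u → ψ u * ψ u) - (∑ᵥ S ψ + ∑ᵥ S ψ) * ∑ᵈ E ψ + μ * ∑ᵥ S (λ u → ψ u * ψ u))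
      ≡⟨ cong₂ (λ s t → (total S T rT + (R + s)) + (- κ) * t) (trans distSum-ends (cong (λ p → R + ((p + p) - L * N)) sum))
           (cong₂ _+_ (cong₂ (λ p q → N * p - q) wsum² (cong₂ (λ p q → (p + p) * q) sum wsum)) (cong₂ _*_ μ≡ sum²)) ⟩
    (total S T rT + (R + (R + ((½ * (L * (L + 1ℚ)) + ½ * (L * (L + 1ℚ))) - L * N))))
      + (- κ) * (N * (⅓ * (L * (L + 1ℚ) * (2ℚ * L + 1ℚ))) - (½ * (L * (L + 1ℚ)) + ½ * (L * (L + 1ℚ))) * (L * (L + 1ℚ)) + (2ℚ * (N + C) - 2ℚ) * (⅓ * ½ * (L * (L + 1ℚ) * (2ℚ * L + 1ℚ))))
      ≡⟨ solve 6 (λ W R n c k l → let p = l :* (l :+ con 1ℚ) in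
           (W :+ (R :+ (R :+ ((con ½ :* p :+ con ½ :* p) :- l :* n))))
             :+ (:- k) :* (n :* (con ⅓ :* (p :* (con 2ℚ :* l :+ con 1ℚ))) :- (con ½ :* p :+ con ½ :* p) :* p :+ (con 2ℚ :* (n :+ c) :- con 2ℚ) :* (con ⅓ :* con ½ :* (p :* (con 2ℚ :* l :+ con 1ℚ))))
           := W :+ (R :+ R) :+ (p :- l :* n :- (con ⅓ :* (k :* (p :* (con 2ℚ :* l :+ con 1ℚ))) :* (con 2ℚ :* n :+ c :- con 1ℚ) :- k :* (p :* (l :* (l :+ con 1ℚ)))))) refl (total S T rT) R N C κ L ⟩
    total S T rT + (R + R) + (L * (L + 1ℚ) - L * N - (⅓ * (κ * (L * (L + 1ℚ) * (2ℚ * L + 1ℚ))) * (2ℚ * N + C - 1ℚ) - κ * (L * (L + 1ℚ) * (L * (L + 1ℚ)))))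
      ≡⟨ cong₂ (λ p q → total S T rT + (R + R) + (L * (L + 1ℚ) - L * N - (⅓ * p * (2ℚ * N + C - 1ℚ) - q))) (cancel (2ℚ * L + 1ℚ)) (trans (cancel (L * (L + 1ℚ))) (≡-sym (ℚ.*-assoc L L (L + 1ℚ)))) ⟩
    total S T rT + (R + R) + gain C N L ∎
    where
    R : ℚ
    R = distSum S rT c

-- Single vertices and cycles

card-singleton : {S : VertexSet n} {y : Fin n} → S y ≡ true → (∀ z → S z ≡ true → z ≡ y) → card S ≡ 1
card-singleton {S = S} {y} y∈ only = trans (∑ℕ-cong pointwise) (∑ℕ-δ y)
  where
  pointwise : ∀ u → b2ℕ (S u) ≡ δℕ u y
  pointwise u with S u in u∈ | eqb u y in e
  ... | true  | true  = refl
  ... | false | false = refl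
  ... | true  | false = case trans (≡-sym e) (trans (cong (eqb u) (≡-sym (only u u∈))) (eqb-refl u)) of λ ()
  ... | false | true  = case trans (≡-sym u∈) (trans (cong S (eqb⇒≡ u y e)) y∈) of λ ()

Euler-edge : ∀ {c} {S : VertexSet n} {T E : EdgeSet n} {a b} → AddEdge T a b E → Euler (suc c) S E → Euler c S T
Euler-edge {c = c} {S} {T} {E} add euler = ℕ.+-cancelʳ-≡ 2 _ _ (begin
  vol T ℕ.+ 2 ℕ.+ 2
    ≡⟨ cong (ℕ._+ 2) (vol-edge {E′ = T} {E = E} add) ⟨
  vol E ℕ.+ 2
    ≡⟨ euler ⟩
  2 ℕ.* (card S ℕ.+ suc c)
    ≡⟨ cong (2 ℕ.*_) (ℕ.+-suc (card S) c) ⟩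
  2 ℕ.* suc (card S ℕ.+ c)
    ≡⟨ ℕ.*-suc 2 (card S ℕ.+ c) ⟩
  2 ℕ.+ 2 ℕ.* (card S ℕ.+ c)
    ≡⟨ ℕ.+-comm 2 (2 ℕ.* (card S ℕ.+ c)) ⟩
  2 ℕ.* (card S ℕ.+ c) ℕ.+ 2 ∎)
  where open ≡-Reasoning

Chain-Euler-down : ∀ {w S₁ E₁ y} {S : VertexSet n} {E x ℓ c} → Chain w S₁ E₁ y S E x ℓ → Euler c S E → Euler c S₁ E₁
Chain-Euler-down (stop _ _)       euler = euler
Chain-Euler-down (grow leaf _ ch) euler = Chain-Euler-down ch (Euler-down leaf euler)

singleton-exact : {S : VertexSet n} {E : EdgeSet n} {y : Fin n} {r : Fin n → Fin n → ℚ} → Sym E → Within E S → S y ≡ true → (∀ z → S z ≡ true → z ≡ y) →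
  Resistance S E r → Exact level₀ S E r y
singleton-exact {n} {S} {E} {y} {r} sym-E within y∈ only res = record
  { dist-≡  = trans dist0 (cong distMax (≡-sym card1))
  ; point-≡ = trans (cong₂ (λ p q → p + p + q) dist0 degDist0) (cong pointMax (≡-sym card1))
  ; total-≡ = trans total0 (cong totalMax (≡-sym card1))
  }
  where
  open Level level₀
  card1 : ι (card S) ≡ 1ℚ
  card1 = cong ι (card-singleton {S = S} y∈ only)
  ry : ∀ u v → S u ≡ true → S v ≡ true → r u v ≡ 0ℚ
  ry u v u∈ v∈ = trans (cong₂ r (only u u∈) (only v v∈)) (r-diag sym-E res y y∈)
  dist0′ : ∀ u → S u ≡ true → distSum S r u ≡ 0ℚ
  dist0′ u u∈ = trans (∑ᵥ-cong {S = S} (λ v → ry u v u∈)) (∑-*-zero (λ v → b2ℚ (S v)))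
  dist0 : distSum S r y ≡ 0ℚ
  dist0 = dist0′ y y∈
  degDist0 : degDistSum E r y ≡ 0ℚ
  degDist0 = trans (∑ᵈ-cong {E = E} within (λ u → ry y u y∈)) (∑-*-zero (λ u → ι (degE E u)))
  total0 : total S E r ≡ 0ℚ
  total0 = trans (∑ᵈ-cong {E = E} within dist0′) (∑-*-zero (λ u → ι (degE E u)))

-- For a cycle with L + 1 vertices the resistance sum at a vertex is the sum of k(L + 1 - k)/(L + 1)
-- for k from 1 to L. All degrees being 2, the other two values are 4 and 2(L + 1) times this one.
cycleDist cyclePoint cycleTotal : ℚ → ℚ
cycleDist  L = ⅓ * ½ * (L * (L + 2ℚ))
cyclePoint L = ⅓ * 2ℚ * (L * (L + 2ℚ))
cycleTotal L = ⅓ * ((L + 1ℚ) * (L * (L + 2ℚ)))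

module ClosedCycle {S S₁ : VertexSet n} {E E₁ T : EdgeSet n} {y c : Fin n} {ℓ : ℕ} (ch : Chain (degE E) S₁ E₁ y S T c ℓ)
                   (add : AddEdge T c y E) (sym-E : Sym E) (euler : Euler 1 S E)
                   (sym-E₁ : Sym E₁) (within₁ : Within E₁ S₁) (y∈₁ : S₁ y ≡ true) (only : ∀ z → S₁ z ≡ true → z ≡ y)
                   {r : Fin n → Fin n → ℚ} (res : Resistance S E r) where
  open ClosedChain {T = T} ch add sym-E {cyc = 1} euler res
  open UnitPotential (unitPotential ch) using (at-start; at-end; on-path)

  cycle-card : ι (card S) ≡ L + 1ℚ
  cycle-card = trans (cong ι (trans (Chain-card ch) (cong (ℓ ℕ.+_) (card-singleton {S = S₁} y∈₁ only)))) (ι-+ ℓ 1)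

  private
    euler₁ : Euler 0 S₁ E₁
    euler₁ = Chain-Euler-down ch (Euler-edge {T = T} {E = E} add euler)

    -- Without its closing edge the cycle is a path grown from the single vertex `y`.
    ex : Exact level₀ S T rT c
    ex = Chain-exact level₀ euler₁ ch resT (singleton-exact {E = E₁} sym-E₁ within₁ y∈₁ only (Chain-resistance ch resT))
    open Exact ex

    open ≡-Reasoning
    cancel : ∀ a → κ * (a * (L + 1ℚ)) ≡ a
    cancel a = trans (solve 3 (λ k a l → k :* (a :* (l :+ con 1ℚ)) := (k :* (con 1ℚ :+ l)) :* a) refl κ a L) (trans (cong (_* a) κ-inv) (ℚ.*-identityˡ a))

  cycle-dist : distSum S r c ≡ cycleDist L
  cycle-dist = begin
    distSum S r c
      ≡⟨ dist-formula c ⟩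
    distSum S rT c - (κ * (ψ c * ψ c * ι (card S)) - L * ψ c + ⅓ * ½ * (L * (2ℚ * L + 1ℚ)))
      ≡⟨ cong₂ (λ p q → p - (κ * q - L * ψ c + ⅓ * ½ * (L * (2ℚ * L + 1ℚ)))) dist-≡ (cong₂ (λ p q → p * p * q) at-start cycle-card) ⟩
    Level.distMax level₀ (ι (card S)) - (κ * (L * L * (L + 1ℚ)) - L * ψ c + ⅓ * ½ * (L * (2ℚ * L + 1ℚ)))
      ≡⟨ cong₂ (λ p q → Level.distMax level₀ p - (q - L * ψ c + ⅓ * ½ * (L * (2ℚ * L + 1ℚ)))) cycle-card (cancel (L * L)) ⟩
    Level.distMax level₀ (L + 1ℚ) - (L * L - L * ψ c + ⅓ * ½ * (L * (2ℚ * L + 1ℚ)))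
      ≡⟨ cong (λ p → Level.distMax level₀ (L + 1ℚ) - (L * L - L * p + ⅓ * ½ * (L * (2ℚ * L + 1ℚ)))) at-start ⟩
    Level.distMax level₀ (L + 1ℚ) - (L * L - L * L + ⅓ * ½ * (L * (2ℚ * L + 1ℚ)))
      ≡⟨ solve 1 (λ l → (con ½ :* ((l :+ con 1ℚ) :* ((l :+ con 1ℚ) :- con 1ℚ)) :- con 0ℚ) :- (l :* l :- l :* l :+ con ⅓ :* con ½ :* (l :* (con 2ℚ :* l :+ con 1ℚ)))
           := con ⅓ :* con ½ :* (l :* (l :+ con 2ℚ))) refl L ⟩
    cycleDist L ∎

  cycle-point : pointSum S E r c ≡ cyclePoint L
  cycle-point = begin
    pointSum S E r c
      ≡⟨ cong₂ (λ p q → p + p + q) (dist-formula c) (degDist-formula c c∈) ⟩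
    (R - (κ * (ψ c * ψ c * N) - L * ψ c + q)) + (R - (κ * (ψ c * ψ c * N) - L * ψ c + q))
      + (D + (rT c c + rT c c + ((ψ c + ψ c) - L)) - (κ * (ψ c * ψ c * ι (vol E)) - 2ℚ * (L * ψ c) + q′))
      ≡⟨ cong₂ (λ p s → (R - (κ * (p * p * N) - L * p + q)) + (R - (κ * (p * p * N) - L * p + q)) + (D + (s + s + ((p + p) - L)) - (κ * (p * p * ι (vol E)) - 2ℚ * (L * p) + q′)))
           at-start (r-diag sym-T resT c c∈) ⟩
    (R - (κ * (L * L * N) - L * L + q)) + (R - (κ * (L * L * N) - L * L + q)) + (D + (0ℚ + 0ℚ + ((L + L) - L)) - (κ * (L * L * ι (vol E)) - 2ℚ * (L * L) + q′))
      ≡⟨ cong₂ (λ s t → (R - (s - L * L + q)) + (R - (s - L * L + q)) + (D + (0ℚ + 0ℚ + ((L + L) - L)) - (t - 2ℚ * (L * L) + q′)))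
           (trans (cong (λ t → κ * (L * L * t)) cycle-card) (cancel (L * L)))
           (trans (cong (λ t → κ * (L * L * t)) vol≡) (trans (cong (κ *_) (solve 1 (λ l → l :* l :* (con 2ℚ :* (l :+ con 1ℚ)) := con 2ℚ :* (l :* l) :* (l :+ con 1ℚ)) refl L)) (cancel (2ℚ * (L * L))))) ⟩
    (R - (L * L - L * L + q)) + (R - (L * L - L * L + q)) + (D + (0ℚ + 0ℚ + ((L + L) - L)) - (2ℚ * (L * L) - 2ℚ * (L * L) + q′))
      ≡⟨ solve 3 (λ R D l → let q = con ⅓ :* con ½ :* (l :* (con 2ℚ :* l :+ con 1ℚ)) ; q′ = con ⅓ :* (l :* (con 2ℚ :* l :+ con 1ℚ)) in
           (R :- (l :* l :- l :* l :+ q)) :+ (R :- (l :* l :- l :* l :+ q)) :+ (D :+ (con 0ℚ :+ con 0ℚ :+ ((l :+ l) :- l)) :- (con 2ℚ :* (l :* l) :- con 2ℚ :* (l :* l) :+ q′))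
           := (R :+ R :+ D) :+ (l :- con 2ℚ :* q′)) refl R D L ⟩
    pointSum S T rT c + (L - 2ℚ * q′)
      ≡⟨ cong (_+ (L - 2ℚ * q′)) (trans point-≡ (cong (Level.pointMax level₀) cycle-card)) ⟩
    Level.pointMax level₀ (L + 1ℚ) + (L - 2ℚ * q′)
      ≡⟨ solve 1 (λ l → let N = l :+ con 1ℚ in
           (con 2ℚ :* (N :* N) :- con (+ 3 / 1) :* N :+ con 1ℚ :+ con 2ℚ :* con 0ℚ :* N :- con 0ℚ) :+ (l :- con 2ℚ :* (con ⅓ :* (l :* (con 2ℚ :* l :+ con 1ℚ))))
           := con ⅓ :* con 2ℚ :* (l :* (l :+ con 2ℚ))) refl L ⟩
    cyclePoint L ∎
    where
    R D N q q′ : ℚ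
    R = distSum S rT c
    D = degDistSum T rT c
    N = ι (card S)
    q = ⅓ * ½ * (L * (2ℚ * L + 1ℚ))
    q′ = ⅓ * (L * (2ℚ * L + 1ℚ))
    vol≡ : ι (vol E) ≡ 2ℚ * (L + 1ℚ)
    vol≡ = trans (Euler-ℚ {c = 1} {S = S} {E = E} euler) (trans (cong (λ t → 2ℚ * (t + 1ℚ) - 2ℚ) cycle-card)
      (solve 1 (λ l → con 2ℚ :* ((l :+ con 1ℚ) :+ con 1ℚ) :- con 2ℚ := con 2ℚ :* (l :+ con 1ℚ)) refl L))

  cycle-total : total S E r ≡ cycleTotal L
  cycle-total = begin
    total S E r
      ≡⟨ total-formula ⟩
    total S T rT + (distSum S rT c + distSum S rT c) + gain 1ℚ (ι (card S)) L
      ≡⟨ cong₂ (λ p q → p + (q + q) + gain 1ℚ (ι (card S)) L) total-≡ dist-≡ ⟩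
    Level.totalMax level₀ (ι (card S)) + (Level.distMax level₀ (ι (card S)) + Level.distMax level₀ (ι (card S))) + gain 1ℚ (ι (card S)) L
      ≡⟨ cong (λ N → Level.totalMax level₀ N + (Level.distMax level₀ N + Level.distMax level₀ N) + gain 1ℚ N L) cycle-card ⟩
    Level.totalMax level₀ (L + 1ℚ) + (Level.distMax level₀ (L + 1ℚ) + Level.distMax level₀ (L + 1ℚ)) + gain 1ℚ (L + 1ℚ) L
      ≡⟨ solve 1 (λ l → let N = l :+ con 1ℚ ; d = con ½ :* (N :* (N :- con 1ℚ)) :- con 0ℚ in
           (con ⅓ :* (N :* (N :- con 1ℚ) :* (con 2ℚ :* N :- con 1ℚ)) :+ con 0ℚ :* (N :* N) :+ (con 0ℚ :- con 0ℚ) :* N :- con 0ℚ) :+ (d :+ d)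
             :+ (l :* (l :+ con 1ℚ) :- l :* N :- (con ⅓ :* (l :* (con 2ℚ :* l :+ con 1ℚ)) :* (con 2ℚ :* N :+ con 1ℚ :- con 1ℚ) :- l :* l :* (l :+ con 1ℚ)))
           := con ⅓ :* ((l :+ con 1ℚ) :* (l :* (l :+ con 2ℚ)))) refl L ⟩
    cycleTotal L ∎

  cycle-r : ∀ z → S z ≡ true → r c z ≤ℚ L
  cycle-r z z∈ = ℚ.≤-trans (r≤rT c z) (rT≤ (on-path rT resT z z∈))
    where
    rT≤ : (S₁ z ≡ true × ψ z ≡ 0ℚ) ⊎ (0ℚ ≤ℚ ψ z × rT c z ≡ ψ c - ψ z) → rT c z ≤ℚ L
    rT≤ (inj₁ (z∈₁ , _)) = ℚ.≤-reflexive (trans (cong (rT c) (only z z∈₁)) rT-cy)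
    rT≤ (inj₂ (0≤ , e))  = ≤-by (ψ z) 0≤ (trans (cong (_+ ψ z) (trans e (cong (_- ψ z) at-start))) (solve 2 (λ l p → (l :- p) :+ p := l) refl L (ψ z)))

  triangle-exact : ℓ ≡ 2 → Exact level₁ S E r c
  triangle-exact refl = record
    { dist-≡  = trans cycle-dist (cong (Level.distMax level₁) (≡-sym cycle-card))
    ; point-≡ = trans cycle-point (cong (Level.pointMax level₁) (≡-sym cycle-card))
    ; total-≡ = trans cycle-total (cong (Level.totalMax level₁) (≡-sym cycle-card))
    }

0≤-c*ι : ∀ c .{{_ : ℚ.NonNegative c}} t → 0ℚ ≤ℚ c * ι t
0≤-c*ι c t = 0≤-* (ℚ.nonNegative⁻¹ c) (0≤ι t)

module _ (t : ℕ) where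
  private
    τ L : ℚ
    τ = ι t
    L = ι (2 ℕ.+ t)

    L≡ : L ≡ 2ℚ + τ
    L≡ = ι-+ 2 t

    0≤τ² : 0ℚ ≤ℚ τ * τ
    0≤τ² = 0≤-* (0≤ι t) (0≤ι t)

    at-L : (f g : ℚ → ℚ) → f (2ℚ + τ) ≤ℚ g (2ℚ + τ) → f L ≤ℚ g L
    at-L f g = subst (λ l → f l ≤ℚ g l) (≡-sym L≡)

  -- Substituting L = 2 + τ turns the difference of the two sides into a polynomial in τ with
  -- nonnegative coefficients and no constant term, so the triangle gives equality. The next two
  -- bounds arise in the same way.
  cycleDist-≤ : cycleDist L ≤ℚ Level.distMax level₁ (L + 1ℚ)
  cycleDist-≤ = at-L cycleDist (λ l → Level.distMax level₁ (l + 1ℚ)) (≤-by ((+ 3 / 2) * τ + ⅓ * (τ * τ))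
    (0≤-+ (0≤-c*ι (+ 3 / 2) t) (0≤-* (ℚ.nonNegative⁻¹ ⅓) 0≤τ²))
    (solve 1 (λ t → let l = con 2ℚ :+ t ; N = l :+ con 1ℚ in
      con ⅓ :* con ½ :* (l :* (l :+ con 2ℚ)) :+ (con (+ 3 / 2) :* t :+ con ⅓ :* (t :* t)) := con ½ :* (N :* (N :- con 1ℚ)) :- con (+ 5 / 3)) refl τ))

  cyclePoint-≤ : cyclePoint L ≤ℚ Level.pointMax level₁ (L + 1ℚ)
  cyclePoint-≤ = at-L cyclePoint (λ l → Level.pointMax level₁ (l + 1ℚ)) (≤-by ((+ 7 / 1) * τ + (+ 4 / 3) * (τ * τ))
    (0≤-+ (0≤-c*ι (+ 7 / 1) t) (0≤-* (ℚ.nonNegative⁻¹ (+ 4 / 3)) 0≤τ²))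
    (solve 1 (λ t → let l = con 2ℚ :+ t ; N = l :+ con 1ℚ in
      con ⅓ :* con 2ℚ :* (l :* (l :+ con 2ℚ)) :+ (con (+ 7 / 1) :* t :+ con (+ 4 / 3) :* (t :* t))
      := con 2ℚ :* (N :* N) :- con (+ 3 / 1) :* N :+ con 1ℚ :+ con 2ℚ :* con 1ℚ :* N :- con (+ 32 / 3)) refl τ))

  cycleTotal-≤ : cycleTotal L ≤ℚ Level.totalMax level₁ (L + 1ℚ)
  cycleTotal-≤ = at-L cycleTotal (λ l → Level.totalMax level₁ (l + 1ℚ)) (≤-by ((+ 3 / 1) * (τ * τ) + ⅓ * (τ * (τ * τ)))
    (0≤-+ (0≤-* (ℚ.nonNegative⁻¹ (+ 3 / 1)) 0≤τ²) (0≤-* (ℚ.nonNegative⁻¹ ⅓) (0≤-* (0≤ι t) 0≤τ²)))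
    (solve 1 (λ t → let l = con 2ℚ :+ t ; N = l :+ con 1ℚ in
      con ⅓ :* ((l :+ con 1ℚ) :* (l :* (l :+ con 2ℚ))) :+ (con (+ 3 / 1) :* (t :* t) :+ con ⅓ :* (t :* (t :* t)))
      := con ⅓ :* (N :* (N :- con 1ℚ) :* (con 2ℚ :* N :- con 1ℚ)) :+ con 1ℚ :* (N :* N) :+ (con 1ℚ :- con (+ 32 / 3)) :* N :- con (- (+ 18 / 1))) refl τ))

record CycleAt (S : VertexSet n) (E : EdgeSet n) (r : Fin n → Fin n → ℚ) (L : ℚ) (z : Fin n) : Set where
  field
    dist-≡  : distSum S r z ≡ cycleDist L
    point-≡ : pointSum S E r z ≡ cyclePoint L
    total-≡ : total S E r ≡ cycleTotal L
    r-≤     : ∀ v → S v ≡ true → r z v ≤ℚ L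

cycle-bounded : {S : VertexSet n} {E : EdgeSet n} {r : Fin n → Fin n → ℚ} (t : ℕ) → ι (card S) ≡ ι (2 ℕ.+ t) + 1ℚ →
  (z : Fin n) → S z ≡ true → (∀ z → S z ≡ true → CycleAt S E r (ι (2 ℕ.+ t)) z) → Bounded level₁ S E r
cycle-bounded {S = S} {E} {r} t N≡ z₀ z₀∈ at = record
  { r-≤     = λ u v u∈ v∈ → ℚ.≤-trans (CycleAt.r-≤ (at u u∈) v v∈) (ℚ.≤-reflexive (≡-sym (trans (cong (_- 1ℚ) N≡) (solve 1 (λ l → (l :+ con 1ℚ) :- con 1ℚ := l) refl (ι (2 ℕ.+ t))))))
  ; dist-≤  = λ z z∈ → subst₂ _≤ℚ_ (≡-sym (CycleAt.dist-≡ (at z z∈))) (cong (Level.distMax level₁) (≡-sym N≡)) (cycleDist-≤ t)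
  ; point-≤ = λ z z∈ → subst₂ _≤ℚ_ (≡-sym (CycleAt.point-≡ (at z z∈))) (cong (Level.pointMax level₁) (≡-sym N≡)) (cyclePoint-≤ t)
  ; total-≤ = subst₂ _≤ℚ_ (≡-sym (CycleAt.total-≡ (at z₀ z₀∈))) (cong (Level.totalMax level₁) (≡-sym N≡)) (cycleTotal-≤ t)
  }

-- Closing a path attached to a unicyclic network

module ClosedSecond {S S₁ : VertexSet n} {E E₁ T : EdgeSet n} {y c : Fin n} {ℓ : ℕ} (ch : Chain (degE E) S₁ E₁ y S T c ℓ)
                    (add : AddEdge T c y E) (sym-E : Sym E) (euler : Euler 2 S E)
                    {r : Fin n → Fin n → ℚ} (res : Resistance S E r) where
  open ClosedChain {T = T} ch add sym-E {cyc = 2} euler res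
  open UnitPotential (unitPotential ch) using (at-start; at-end; on-path)

  private
    N : ℚ
    N = ι (card S)

    -- The origin of φ and α in `level₂`: a triangle, hence L = 2, is closed where `level₁` is
    -- attained.
    total-peak : ∀ N → Level.totalMax level₁ N + (Level.distMax level₁ N + Level.distMax level₁ N) + gain 2ℚ N 2ℚ ≡ Level.totalMax level₂ N
    total-peak = solve 1 (λ N → let d = con ½ :* (N :* (N :- con 1ℚ)) :- con (+ 5 / 3) ; l = con 2ℚ in
      (con ⅓ :* (N :* (N :- con 1ℚ) :* (con 2ℚ :* N :- con 1ℚ)) :+ con 1ℚ :* (N :* N) :+ (con 1ℚ :- con (+ 32 / 3)) :* N :- con (- (+ 18 / 1))) :+ (d :+ d)
        :+ (l :* (l :+ con 1ℚ) :- l :* N :- (con ⅓ :* (l :* (con 2ℚ :* l :+ con 1ℚ)) :* (con 2ℚ :* N :+ con 2ℚ :- con 1ℚ) :- l :* l :* (l :+ con 1ℚ)))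
      := con ⅓ :* (N :* (N :- con 1ℚ) :* (con 2ℚ :* N :- con 1ℚ)) :+ con 2ℚ :* (N :* N) :+ (con 2ℚ :- con (+ 64 / 3)) :* N :- con (- (+ 88 / 3))) refl

  total-exact : ℓ ≡ 2 → distSum S rT c ≡ Level.distMax level₁ N → total S T rT ≡ Level.totalMax level₁ N → total S E r ≡ Level.totalMax level₂ N
  total-exact refl dist≡ total≡ = trans total-formula (trans (cong₂ (λ p q → p + (q + q) + gain 2ℚ N 2ℚ) total≡ dist≡) (total-peak N))

  module _ (t m : ℕ) (ℓ≡ : ℓ ≡ 2 ℕ.+ t) (card≡ : card S ≡ ℓ ℕ.+ (3 ℕ.+ m)) (bd : Bounded level₁ S T rT) where
    open Bounded bd
    open ℚ.≤-Reasoning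

    private
      τ m′ : ℚ
      τ = ι t
      m′ = ι m

      L≡ : L ≡ 2ℚ + τ
      L≡ = trans (cong ι ℓ≡) (ι-+ 2 t)

      N≡ : N ≡ L + ((+ 3 / 1) + m′)
      N≡ = trans (cong ι card≡) (trans (ι-+ ℓ (3 ℕ.+ m)) (cong (λ s → L + s) (ι-+ 3 m)))

      0≤τ : 0ℚ ≤ℚ τ
      0≤τ = 0≤ι t

      0≤m′ : 0ℚ ≤ℚ m′
      0≤m′ = 0≤ι m

      -- With L = 2 + τ and N = L + 3 + m′ the difference is τ times a polynomial with nonnegative
      -- coefficients. The 3 reserves the vertices that the other cycle needs at least. So for a
      -- given N no cycle gains more than a triangle.
      gain-≤ : gain 2ℚ N L ≤ℚ gain 2ℚ N 2ℚ
      gain-≤ = subst₂ (λ n l → gain 2ℚ n l ≤ℚ gain 2ℚ n 2ℚ) (≡-sym (trans N≡ (cong (_+ ((+ 3 / 1) + m′)) L≡))) (≡-sym L≡) (≤-by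
        (τ * ((+ 43 / 3) + (+ 13 / 3) * (τ + m′) + ⅓ * ((2ℚ + τ) * ((+ 4 / 1) + τ + (+ 4 / 1) * m′))))
        (0≤-* 0≤τ (0≤-+ (0≤-+ (ℚ.nonNegative⁻¹ (+ 43 / 3)) (0≤-* (ℚ.nonNegative⁻¹ (+ 13 / 3)) (0≤-+ 0≤τ 0≤m′)))
          (0≤-* (ℚ.nonNegative⁻¹ ⅓) (0≤-* (0≤-+ (ℚ.nonNegative⁻¹ 2ℚ) 0≤τ) (0≤-+ (0≤-+ (ℚ.nonNegative⁻¹ (+ 4 / 1)) 0≤τ) (0≤-* (ℚ.nonNegative⁻¹ (+ 4 / 1)) 0≤m′))))))
        (solve 2 (λ t m → let l = con 2ℚ :+ t ; N = l :+ (con (+ 3 / 1) :+ m)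
                              g = λ l → l :* (l :+ con 1ℚ) :- l :* N :- (con ⅓ :* (l :* (con 2ℚ :* l :+ con 1ℚ)) :* (con 2ℚ :* N :+ con 2ℚ :- con 1ℚ) :- l :* l :* (l :+ con 1ℚ)) in
          g l :+ t :* (con (+ 43 / 3) :+ con (+ 13 / 3) :* (t :+ m) :+ con ⅓ :* ((con 2ℚ :+ t) :* (con (+ 4 / 1) :+ t :+ con (+ 4 / 1) :* m)))
          := g (con 2ℚ)) refl τ m′))

      total≤ : total S E r ≤ℚ Level.totalMax level₂ N
      total≤ = begin
        total S E r
          ≡⟨ total-formula ⟩
        total S T rT + (distSum S rT c + distSum S rT c) + gain 2ℚ N L
          ≤⟨ ℚ.+-mono-≤ (ℚ.+-mono-≤ total-≤ (ℚ.+-mono-≤ (dist-≤ c c∈) (dist-≤ c c∈))) gain-≤ ⟩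
        Level.totalMax level₁ N + (Level.distMax level₁ N + Level.distMax level₁ N) + gain 2ℚ N 2ℚ
          ≡⟨ total-peak N ⟩
        Level.totalMax level₂ N ∎

      -- The change of `pointSum` at `z` caused by the closing edge. The factor 4N + 2 is 2N from
      -- the two plain sums plus the volume 2N + 2 from the weighted one. It has to stay below
      -- `shift-target`, the difference of the two `pointMax` polynomials.
      shift : Fin n → ℚ
      shift z = (rT c z + rT c z + ((ψ z + ψ z) - L))
        - (κ * (ψ z * ψ z * ((+ 4 / 1) * N + 2ℚ)) - (+ 4 / 1) * (L * ψ z) + ⅓ * 2ℚ * (L * (2ℚ * L + 1ℚ)))

      point-shift : ∀ z → S z ≡ true → pointSum S E r z ≡ pointSum S T rT z + shift z
      point-shift z z∈ = trans (cong₂ (λ p q → p + p + q) (dist-formula z) (trans (degDist-formula z z∈) (cong (λ v → D + s - (κ * (p * p * v) - 2ℚ * (L * p) + ⅓ * (L * (2ℚ * L + 1ℚ)))) (Euler-ℚ {c = 2} {S = S} {E = E} euler))))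
        (solve 7 (λ R D s k p N l →
          (R :- (k :* (p :* p :* N) :- l :* p :+ con ⅓ :* con ½ :* (l :* (con 2ℚ :* l :+ con 1ℚ)))) :+ (R :- (k :* (p :* p :* N) :- l :* p :+ con ⅓ :* con ½ :* (l :* (con 2ℚ :* l :+ con 1ℚ))))
            :+ (D :+ s :- (k :* (p :* p :* (con 2ℚ :* (N :+ con 2ℚ) :- con 2ℚ)) :- con 2ℚ :* (l :* p) :+ con ⅓ :* (l :* (con 2ℚ :* l :+ con 1ℚ))))
          := (R :+ R :+ D) :+ (s :- (k :* (p :* p :* (con (+ 4 / 1) :* N :+ con 2ℚ)) :- con (+ 4 / 1) :* (l :* p) :+ con ⅓ :* con 2ℚ :* (l :* (con 2ℚ :* l :+ con 1ℚ))))) refl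
          (distSum S rT z) D s κ p N L)
        where
        D s p : ℚ
        D = degDistSum T rT z
        p = ψ z
        s = rT c z + rT c z + ((ψ z + ψ z) - L)

      shift-target : ℚ
      shift-target = 2ℚ * N - (+ 32 / 3)

      shift-off-path : ∀ z → S z ≡ true → ψ z ≡ 0ℚ → shift z ≤ℚ shift-target
      shift-off-path z z∈ ψz = begin
        shift z
          ≡⟨ cong (λ p → (rT c z + rT c z + ((p + p) - L)) - (κ * (p * p * ((+ 4 / 1) * N + 2ℚ)) - (+ 4 / 1) * (L * p) + ⅓ * 2ℚ * (L * (2ℚ * L + 1ℚ)))) ψz ⟩
        (rT c z + rT c z + ((0ℚ + 0ℚ) - L)) - (κ * (0ℚ * 0ℚ * ((+ 4 / 1) * N + 2ℚ)) - (+ 4 / 1) * (L * 0ℚ) + ⅓ * 2ℚ * (L * (2ℚ * L + 1ℚ)))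
          ≡⟨ solve 4 (λ s l k N → (s :+ ((con 0ℚ :+ con 0ℚ) :- l)) :- (k :* (con 0ℚ :* con 0ℚ :* (con (+ 4 / 1) :* N :+ con 2ℚ)) :- con (+ 4 / 1) :* (l :* con 0ℚ) :+ con ⅓ :* con 2ℚ :* (l :* (con 2ℚ :* l :+ con 1ℚ)))
               := s :- (l :+ con ⅓ :* con 2ℚ :* (l :* (con 2ℚ :* l :+ con 1ℚ)))) refl (rT c z + rT c z) L κ N ⟩
        (rT c z + rT c z) - (L + ⅓ * 2ℚ * (L * (2ℚ * L + 1ℚ)))
          -- The crude bound N - 1 suffices off the path, because for L ≥ 2 the subtracted term is
          -- at least 26/3 and 2(N - 1) - 26/3 is the target.
          ≤⟨ ℚ.+-monoˡ-≤ _ (ℚ.+-mono-≤ (r-≤ c z c∈ z∈) (r-≤ c z c∈ z∈)) ⟩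
        ((N - 1ℚ) + (N - 1ℚ)) - (L + ⅓ * 2ℚ * (L * (2ℚ * L + 1ℚ)))
          ≡⟨ cong (λ l → ((N - 1ℚ) + (N - 1ℚ)) - (l + ⅓ * 2ℚ * (l * (2ℚ * l + 1ℚ)))) L≡ ⟩
        ((N - 1ℚ) + (N - 1ℚ)) - ((2ℚ + τ) + ⅓ * 2ℚ * ((2ℚ + τ) * (2ℚ * (2ℚ + τ) + 1ℚ)))
          ≤⟨ ≤-by ((+ 7 / 1) * τ + (+ 4 / 3) * (τ * τ)) (0≤-+ (0≤-* (ℚ.nonNegative⁻¹ (+ 7 / 1)) 0≤τ) (0≤-* (ℚ.nonNegative⁻¹ (+ 4 / 3)) (0≤-* 0≤τ 0≤τ)))
               (solve 2 (λ N t → let l = con 2ℚ :+ t in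
                 ((N :- con 1ℚ) :+ (N :- con 1ℚ)) :- (l :+ con ⅓ :* con 2ℚ :* (l :* (con 2ℚ :* l :+ con 1ℚ))) :+ (con (+ 7 / 1) :* t :+ con (+ 4 / 3) :* (t :* t))
                 := con 2ℚ :* N :- con (+ 32 / 3)) refl N τ) ⟩
        shift-target ∎

      -- Splitting 4N + 2 = 4(L + 1) + (10 + 4m) leaves a square and terms of known sign.
      shift-on-path : ∀ z → rT c z ≡ ψ c - ψ z → shift z ≤ℚ shift-target
      shift-on-path z e = ≤-by d 0≤d (begin-equality
        shift z + d
          ≡⟨ cong₂ (λ s n → ((s + s + ((p + p) - L)) - (κ * (p * p * ((+ 4 / 1) * n + 2ℚ)) - (+ 4 / 1) * (L * p) + ⅓ * 2ℚ * (L * (2ℚ * L + 1ℚ)))) + d) (trans e (cong (_- p) at-start)) N≡ ⟩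
        (((L - p) + (L - p) + ((p + p) - L)) - (κ * (p * p * ((+ 4 / 1) * (L + ((+ 3 / 1) + m′)) + 2ℚ)) - (+ 4 / 1) * (L * p) + ⅓ * 2ℚ * (L * (2ℚ * L + 1ℚ)))) + d
          -- The solver treats κ as a free variable, so the identity holds only up to a multiple of
          -- 1 - κ(1 + L), which `κ-inv` removes afterwards.
          ≡⟨ solve 4 (λ l p k m →
               (((l :- p) :+ (l :- p) :+ ((p :+ p) :- l)) :- (k :* (p :* p :* (con (+ 4 / 1) :* (l :+ (con (+ 3 / 1) :+ m)) :+ con 2ℚ)) :- con (+ 4 / 1) :* (l :* p) :+ con ⅓ :* con 2ℚ :* (l :* (con 2ℚ :* l :+ con 1ℚ))))
                 :+ (k :* (p :* p) :* (con (+ 10 / 1) :+ con (+ 4 / 1) :* m) :+ (con 2ℚ :* p :- l) :* (con 2ℚ :* p :- l) :+ (con ⅓ :* (l :* l :+ con (+ 5 / 1) :* l :- con (+ 14 / 1)) :+ con 2ℚ :* m))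
               := con 2ℚ :* (l :+ (con (+ 3 / 1) :+ m)) :- con (+ 32 / 3) :+ con (+ 4 / 1) :* ((con 1ℚ :- k :* (con 1ℚ :+ l)) :* (p :* p))) refl L p κ m′ ⟩
        2ℚ * (L + ((+ 3 / 1) + m′)) - (+ 32 / 3) + (+ 4 / 1) * ((1ℚ - κ * (1ℚ + L)) * (p * p))
          ≡⟨ cong₂ (λ n k → 2ℚ * n - (+ 32 / 3) + (+ 4 / 1) * ((1ℚ - k) * (p * p))) (≡-sym N≡) κ-inv ⟩
        shift-target + (+ 4 / 1) * ((1ℚ - 1ℚ) * (p * p))
          ≡⟨ solve 2 (λ s q → s :+ con (+ 4 / 1) :* ((con 1ℚ :- con 1ℚ) :* q) := s) refl shift-target (p * p) ⟩
        shift-target ∎)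
        where
        p q d : ℚ
        p = ψ z
        -- This is (L - 2)(L + 7)/3, which vanishes for a triangle and becomes τ(τ + 9)/3 under L =
        -- 2 + τ.
        q = ⅓ * (L * L + (+ 5 / 1) * L - (+ 14 / 1))
        d = κ * (p * p) * ((+ 10 / 1) + (+ 4 / 1) * m′) + (2ℚ * p - L) * (2ℚ * p - L) + (q + 2ℚ * m′)
        0≤q : 0ℚ ≤ℚ q
        0≤q = ℚ.≤-trans (0≤-* (ℚ.nonNegative⁻¹ ⅓) (0≤-+ (0≤-* (ℚ.nonNegative⁻¹ (+ 9 / 1)) 0≤τ) (0≤-* 0≤τ 0≤τ)))
          (ℚ.≤-reflexive (trans (solve 1 (λ t → con ⅓ :* (con (+ 9 / 1) :* t :+ t :* t) := con ⅓ :* ((con 2ℚ :+ t) :* (con 2ℚ :+ t) :+ con (+ 5 / 1) :* (con 2ℚ :+ t) :- con (+ 14 / 1))) refl τ)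
            (cong (λ l → ⅓ * (l * l + (+ 5 / 1) * l - (+ 14 / 1))) (≡-sym L≡))))
        0≤d : 0ℚ ≤ℚ d
        0≤d = 0≤-+ (0≤-+ (0≤-* (0≤-* 0≤κ (0≤-square p)) (0≤-+ (ℚ.nonNegative⁻¹ (+ 10 / 1)) (0≤-* (ℚ.nonNegative⁻¹ (+ 4 / 1)) 0≤m′))) (0≤-square (2ℚ * p - L)))
                   (0≤-+ 0≤q (0≤-* (ℚ.nonNegative⁻¹ 2ℚ) 0≤m′))

      shift-≤ : ∀ z → S z ≡ true → shift z ≤ℚ shift-target
      shift-≤ z z∈ = [ (λ (_ , ψz) → shift-off-path z z∈ ψz) , (λ (_ , e) → shift-on-path z e) ]′ (on-path rT resT z z∈)

      point≤ : ∀ z → S z ≡ true → pointSum S E r z ≤ℚ Level.pointMax level₂ N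
      point≤ z z∈ = begin
        pointSum S E r z
          ≡⟨ point-shift z z∈ ⟩
        pointSum S T rT z + shift z
          ≤⟨ ℚ.+-mono-≤ (point-≤ z z∈) (shift-≤ z z∈) ⟩
        Level.pointMax level₁ N + shift-target
          ≡⟨ solve 1 (λ N → (con 2ℚ :* (N :* N) :- con (+ 3 / 1) :* N :+ con 1ℚ :+ con 2ℚ :* con 1ℚ :* N :- con (+ 32 / 3)) :+ (con 2ℚ :* N :- con (+ 32 / 3))
                                                        := con 2ℚ :* (N :* N) :- con (+ 3 / 1) :* N :+ con 1ℚ :+ con 2ℚ :* con 2ℚ :* N :- con (+ 64 / 3)) refl N ⟩
        Level.pointMax level₂ N ∎

    second-bounded : Bounded level₂ S E r
    second-bounded = record
      { r-≤     = λ u v u∈ v∈ → ℚ.≤-trans (r≤rT u v) (r-≤ u v u∈ v∈)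
      ; dist-≤  = λ z z∈ → ℚ.≤-trans (distSum-≤ z) (dist-≤ z z∈)
      ; point-≤ = point≤
      ; total-≤ = total≤
      }

-- Finite search and comparison of degrees

search : (P : Fin n → Bool) → (∃ λ i → P i ≡ true) ⊎ (∀ i → P i ≡ false)
search {zero}  P = inj₂ λ ()
search {suc n} P with P zero in e | search (P ∘ suc)
... | true  | _            = inj₁ (zero , e)
... | false | inj₁ (i , p) = inj₁ (suc i , p)
... | false | inj₂ none    = inj₂ λ { zero → e ; (suc i) → none i }

≡⇒True : ∀ {b} → b ≡ true → True b
≡⇒True refl = tt

True⇒≡ : ∀ {b} → True b → b ≡ true
True⇒≡ {true} _ = refl

∧-true : ∀ {a b} → a ∧ b ≡ true → a ≡ true × b ≡ true
∧-true {true} {true} _ = refl , refl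

b2ℕ-mono : ∀ {a b} → (a ≡ true → b ≡ true) → b2ℕ a ≤ b2ℕ b
b2ℕ-mono {false}         _ = z≤n
b2ℕ-mono {true}  {true}  _ = ℕ.≤-refl
b2ℕ-mono {true}  {false} h = case h refl of λ ()

b2ℕ≤1 : ∀ b → b2ℕ b ≤ 1
b2ℕ≤1 true  = ℕ.≤-refl
b2ℕ≤1 false = z≤n

_⊆_ : EdgeSet n → EdgeSet n → Set
E ⊆ F = ∀ u v → E u v ≡ true → F u v ≡ true

degE-mono : {E F : EdgeSet n} → E ⊆ F → ∀ u → degE E u ≤ degE F u
degE-mono sub u = ∑ℕ-mono (λ v → b2ℕ-mono (sub u v))

degE-tight : {E F : EdgeSet n} → E ⊆ F → ∀ u → degE E u ≡ degE F u → ∀ v → F u v ≡ true → E u v ≡ true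
degE-tight {E = E} {F} sub u e v uv with E u v | ∑ℕ-tight (λ v → b2ℕ (E u v)) (λ v → b2ℕ (F u v)) (λ v → b2ℕ-mono (sub u v)) e v
... | true  | _ = refl
... | false | q rewrite uv = case q of λ ()

neighbour : (E : EdgeSet n) (u : Fin n) → 1 ≤ degE E u → ∃ λ v → E u v ≡ true
neighbour {n} E u 1≤ with search (E u)
... | inj₁ found = found
... | inj₂ none  = case subst (1 ≤_) (trans (∑ℕ-cong (λ v → cong b2ℕ (none v))) (∑ℕ-zero {n})) 1≤ of λ ()

degE-pos : (E : EdgeSet n) (u v : Fin n) → E u v ≡ true → 1 ≤ degE E u
degE-pos E u v e = ℕ.≤-trans (ℕ.≤-reflexive (≡-sym (cong b2ℕ e))) (term≤∑ℕ (λ v → b2ℕ (E u v)) v)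

neighbour-unique : (E : EdgeSet n) (u v : Fin n) → degE E u ≡ 1 → E u v ≡ true → ∀ w → E u w ≡ true → w ≡ v
neighbour-unique E u v deg1 uv w uw = eqb⇒≡ w v (from-1 (trans (∑ℕ-tight (λ w → δℕ w v) (λ w → b2ℕ (E u w)) below (trans (∑ℕ-δ v) (≡-sym deg1)) w) (cong b2ℕ uw)))
  where
  below : ∀ w → δℕ w v ≤ b2ℕ (E u w)
  below w = b2ℕ-mono (λ e → subst (λ w → E u w ≡ true) (≡-sym (eqb⇒≡ w v e)) uv)
  from-1 : ∀ {b} → b2ℕ b ≡ 1 → b ≡ true
  from-1 {true} _ = refl

-- Deleting edges and vertices

cut : EdgeSet n → Fin n → Fin n → EdgeSet n
cut E a b u w = E u w ∧ not ((eqb u a ∧ eqb w b) ∨ (eqb u b ∧ eqb w a))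

drop : VertexSet n → Fin n → VertexSet n
drop S x u = S u ∧ not (eqb u x)

cut-sym : {E : EdgeSet n} → Sym E → ∀ a b → Sym (cut E a b)
cut-sym {E = E} sym-E a b u w = cong₂ (λ e f → e ∧ not f) (sym-E u w)
  (trans (∨-comm (eqb u a ∧ eqb w b) (eqb u b ∧ eqb w a)) (cong₂ _∨_ (∧-comm (eqb u b) (eqb w a)) (∧-comm (eqb u a) (eqb w b))))

cut-⊆ : (E : EdgeSet n) (a b : Fin n) → cut E a b ⊆ E
cut-⊆ E a b u w e = proj₁ (∧-true e)

cut-removed : (E : EdgeSet n) (a b : Fin n) → cut E a b a b ≡ false
cut-removed E a b rewrite eqb-refl a | eqb-refl b = ∧-zeroʳ (E a b)

private
  keep : ∀ e → b2ℕ e ≡ b2ℕ (e ∧ true) ℕ.+ 0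
  keep true  = refl
  keep false = refl

cut-add : {E : EdgeSet n} → Sym E → ∀ {a b} → a ≢ b → E a b ≡ true → AddEdge (cut E a b) a b E
cut-add {E = E} sym-E {a} {b} a≢b ab u w with eqb u a in ua | eqb w b in wb | eqb u b in ub | eqb w a in wa
... | true  | _     | true  | _     = ⊥-elim (a≢b (trans (≡-sym (eqb⇒≡ u a ua)) (eqb⇒≡ u b ub)))
... | _     | true  | _     | true  = ⊥-elim (a≢b (trans (≡-sym (eqb⇒≡ w a wa)) (eqb⇒≡ w b wb)))
... | true  | true  | false | false = trans (cong b2ℕ (trans (cong₂ E (eqb⇒≡ u a ua) (eqb⇒≡ w b wb)) ab)) (cong (λ t → b2ℕ t ℕ.+ 1) (≡-sym (∧-zeroʳ (E u w))))
... | false | false | true  | true  = trans (cong b2ℕ (trans (cong₂ E (eqb⇒≡ u b ub) (eqb⇒≡ w a wa)) (trans (sym-E b a) ab))) (cong (λ t → b2ℕ t ℕ.+ 1) (≡-sym (∧-zeroʳ (E u w))))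
... | true  | false | false | _     = keep (E u w)
... | false | true  | true  | false = keep (E u w)
... | false | true  | false | false = keep (E u w)
... | false | false | true  | false = keep (E u w)
... | false | false | false | _     = keep (E u w)

module _ {E′ E : EdgeSet n} {a b : Fin n} (add : AddEdge E′ a b E) where

  AddEdge-cases : ∀ u w → E u w ≡ true → E′ u w ≡ true ⊎ (u ≡ a × w ≡ b) ⊎ (u ≡ b × w ≡ a)
  AddEdge-cases u w e with E′ u w | eqb u a in ua | eqb w b in wb | eqb u b in ub | eqb w a in wa | add u w
  ... | true  | _     | _     | _     | _     | _ = inj₁ refl
  ... | false | true  | true  | _     | _     | _ = inj₂ (inj₁ (eqb⇒≡ u a ua , eqb⇒≡ w b wb))
  ... | false | _     | _     | true  | true  | _ = inj₂ (inj₂ (eqb⇒≡ u b ub , eqb⇒≡ w a wa))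
  ... | false | true  | false | true  | false | q rewrite e = case q of λ ()
  ... | false | true  | false | false | _     | q rewrite e = case q of λ ()
  ... | false | false | _     | true  | false | q rewrite e = case q of λ ()
  ... | false | false | _     | false | _     | q rewrite e = case q of λ ()

  AddEdge-⊆ : E′ ⊆ E
  AddEdge-⊆ u w e with E u w | add u w
  ... | true  | _ = refl
  ... | false | q rewrite e = case q of λ ()

  AddEdge-new : E a b ≡ true
  AddEdge-new with E a b | add a b
  ... | true  | _ = refl
  ... | false | q rewrite eqb-refl a | eqb-refl b | ℕ.+-suc (b2ℕ (E′ a b)) (δℕ a b ℕ.* δℕ b a) = case q of λ ()

-- Connected networks

record Simple (S : VertexSet n) (E : EdgeSet n) : Set where
  field
    sym-E  : Sym E
    within : Within E S
    loopless : ∀ u → E u u ≡ false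

  within₂ : ∀ u v → E u v ≡ true → S v ≡ true
  within₂ u v e = within v u (trans (sym-E v u) e)

  edge-≢ : ∀ {u v} → E u v ≡ true → u ≢ v
  edge-≢ {u} e refl = case trans (≡-sym e) (loopless u) of λ ()

  cut-simple : ∀ a b → Simple S (cut E a b)
  cut-simple a b = record
    { sym-E    = cut-sym sym-E a b
    ; within   = λ u w e → within u w (cut-⊆ E a b u w e)
    ; loopless = λ u → cong (_∧ not ((eqb u a ∧ eqb u b) ∨ (eqb u b ∧ eqb u a))) (loopless u)
    }

  pendant : ∀ {x y} → E x y ≡ true → degE E x ≡ 1 → Leaf S E (drop S x) (cut E x y) x y
  pendant {x} {y} xy deg1 = record
    { edge    = cut-add sym-E (edge-≢ xy) xy
    ; vertex  = vertex′
    ; anchor  = cong₂ (λ s b → s ∧ not b) (within₂ x y xy) (≢⇒eqb (edge-≢ xy ∘ ≡-sym))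
    ; sym-E   = sym-E
    ; sym-E′  = cut-sym sym-E x y
    ; within′ = within′
    }
    where
    vertex′ : ∀ u → b2ℕ (S u) ≡ b2ℕ (drop S x u) ℕ.+ δℕ u x
    vertex′ u with S u in u∈ | eqb u x in e
    ... | true  | true  = refl
    ... | true  | false = refl
    ... | false | false = refl
    ... | false | true  = case trans (≡-sym u∈) (trans (cong S (eqb⇒≡ u x e)) (within x y xy)) of λ ()
    within′ : Within (cut E x y) (drop S x)
    within′ u w e = by-cases (eqb u x) refl
      where
      not-x : u ≡ x → ⊥
      not-x refl with refl ← neighbour-unique E x y deg1 xy w (cut-⊆ E x y x w e) = case trans (≡-sym e) (cut-removed E x y) of λ ()
      by-cases : ∀ b → eqb u x ≡ b → S u ∧ not b ≡ true
      by-cases true  ux = ⊥-elim (not-x (eqb⇒≡ u x ux))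
      by-cases false _  = cong (_∧ true) (within u w (cut-⊆ E x y u w e))

Closed : EdgeSet n → (Fin n → Bool) → Set
Closed E P = ∀ u v → E u v ≡ true → P u ≡ P v

-- Connectedness by two-valued labellings: no labelling constant along edges separates `S`. When a
-- network shrinks, a labelling has to be extended, which is easier than rerouting walks.
Joined : VertexSet n → EdgeSet n → Set
Joined S E = ∀ P → Closed E P → ∀ u v → S u ≡ true → S v ≡ true → P u ≡ P v

record Net (c : ℕ) (S : VertexSet n) (E : EdgeSet n) : Set where
  field
    simple : Simple S E
    joined : Joined S E
    euler  : Euler c S E
    root   : ∃ λ u → S u ≡ true
  open Simple simple public

Leaf-simple : {S S′ : VertexSet n} {E E′ : EdgeSet n} {x y : Fin n} → Leaf S E S′ E′ x y → Simple S E → Simple S′ E′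
Leaf-simple {E = E} {E′} leaf simple = record
  { sym-E    = Leaf.sym-E′ leaf
  ; within   = Leaf.within′ leaf
  ; loopless = loopless′
  }
  where
  loopless′ : ∀ u → E′ u u ≡ false
  loopless′ u with E′ u u in e
  ... | true  = trans (≡-sym (AddEdge-⊆ {E′ = E′} {E = E} (Leaf.edge leaf) u u e)) (Simple.loopless simple u)
  ... | false = refl

Leaf-net : ∀ {c} {S S′ : VertexSet n} {E E′ : EdgeSet n} {x y : Fin n} → Leaf S E S′ E′ x y → Net c S E → Net c S′ E′
Leaf-net {S = S} {S′} {E} {E′} {x} {y} leaf net = record
  { simple = Leaf-simple leaf simple
  ; joined = joined′
  ; euler  = Euler-down leaf euler
  ; root   = y , anchor
  }
  where
  open Net net using (simple; joined; euler)
  open Leaf leaf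
  joined′ : Joined S′ E′
  joined′ P closed u v u∈ v∈ = begin
    P u
      ≡⟨ P⁺-old u∈ ⟨
    P⁺ u
      ≡⟨ joined P⁺ closed⁺ u v (member↑ u∈) (member↑ v∈) ⟩
    P⁺ v
      ≡⟨ P⁺-old v∈ ⟩
    P v ∎
    where
    open ≡-Reasoning
    -- The leaf receives the label of its only neighbour, so the extended labelling is still
    -- constant along edges.
    P⁺ : Fin _ → Bool
    P⁺ u = if eqb u x then P y else P u
    P⁺-old : ∀ {u} → S′ u ≡ true → P⁺ u ≡ P u
    P⁺-old {u} u∈ = cong (λ b → if b then P y else P u) (≢⇒eqb (≢leaf u∈))
    P⁺-leaf : P⁺ x ≡ P y
    P⁺-leaf = cong (λ b → if b then P y else P x) (eqb-refl x)
    closed⁺ : Closed E P⁺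
    closed⁺ u v e with AddEdge-cases {E′ = E′} {E = E} edge u v e
    ... | inj₁ e′                  = trans (P⁺-old (within′ u v e′)) (trans (closed u v e′) (≡-sym (P⁺-old (within′ v u (trans (sym-E′ v u) e′)))))
    ... | inj₂ (inj₁ (refl , refl)) = trans P⁺-leaf (≡-sym (P⁺-old anchor))
    ... | inj₂ (inj₂ (refl , refl)) = trans (P⁺-old anchor) (≡-sym P⁺-leaf)

module _ {w : Fin n → ℕ} {S₁ : VertexSet n} {E₁ : EdgeSet n} {y : Fin n} where

  Chain-net : ∀ {S E x ℓ c} → Chain w S₁ E₁ y S E x ℓ → Net c S E → Net c S₁ E₁
  Chain-net (stop _ _)       net = net
  Chain-net (grow leaf _ ch) net = Chain-net ch (Leaf-net leaf net)

  Chain-joins : ∀ {S E x ℓ} → Chain w S₁ E₁ y S E x ℓ → ∀ P → Closed E P → P x ≡ P y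
  Chain-joins (stop _ _)                P closed = refl
  Chain-joins {E = E} (grow {E′ = E′} {x′ = x′} leaf _ ch) P closed = trans
    (closed _ x′ (AddEdge-new {E′ = E′} {E = E} (Leaf.edge leaf)))
    (Chain-joins ch P (λ u v e → closed u v (AddEdge-⊆ {E′ = E′} {E = E} (Leaf.edge leaf) u v e)))

  -- Length 0 would identify the ends and length 1 would make them adjacent. Applied after the edge
  -- between the ends is deleted, this says that a cycle has at least three vertices.
  Chain-length≥2 : ∀ {S E x ℓ} → Chain w S₁ E₁ y S E x ℓ → x ≢ y → E x y ≡ false → ∃ λ t → ℓ ≡ 2 ℕ.+ t
  Chain-length≥2 (stop _ _) x≢y _ = ⊥-elim (x≢y refl)
  Chain-length≥2 {E = E} (grow {E′ = E′} leaf _ (stop _ _)) _ e = case trans (≡-sym (AddEdge-new {E′ = E′} {E = E} (Leaf.edge leaf))) e of λ ()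
  Chain-length≥2 (grow _ _ (grow {ℓ = ℓ} _ _ _)) _ _ = ℓ , refl

-- The path itself still connects the ends of the deleted edge, so a labelling constant along `T` is
-- constant along that edge too.
Chain-closed-joined : ∀ {w S₁ E₁ y} {S : VertexSet n} {T E : EdgeSet n} {c ℓ} → Chain w S₁ E₁ y S T c ℓ → AddEdge T c y E → Joined S E → Joined S T
Chain-closed-joined {T = T} {E} chain add joined P closed = joined P closed-E
  where
  closed-E : Closed E P
  closed-E u v e with AddEdge-cases {E′ = T} {E = E} add u v e
  ... | inj₁ e′                   = closed u v e′
  ... | inj₂ (inj₁ (refl , refl)) = Chain-joins chain P closed
  ... | inj₂ (inj₂ (refl , refl)) = ≡-sym (Chain-joins chain P closed)

-- Deleting an edge c y of a cycle and then pendant vertices, starting from c, unravels the cycle up to y.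
record Unravelled (w : Fin n → ℕ) (S : VertexSet n) (T : EdgeSet n) (c y : Fin n) : Set where
  field
    S₁       : VertexSet n
    E₁       : EdgeSet n
    ℓ        : ℕ
    chain    : Chain w S₁ E₁ y S T c ℓ
    simple₁  : Simple S₁ E₁
    y∈₁      : S₁ y ≡ true
    degrees₁ : ∀ u → S₁ u ≡ true → degE E₁ u ℕ.+ (δℕ u y ℕ.+ δℕ u y) ≡ w u

-- The last hypothesis counts an imaginary edge between `y` and `c` besides `T`; at the start it is
-- the deleted edge. When `c` is removed, it moves to the neighbour `c′` and `w` is preserved. A
-- vertex of `Q` other than `y` has 2 edges in this count, so `c` has degree 1 in `T` and the
-- process can stop only at `y`. The number of vertices bounds the recursion.
unravel : (w : Fin n → ℕ) (Q : Fin n → Bool) (y : Fin n) → (∀ u → Q u ≡ true → u ≢ y → w u ≡ 2) →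
  ∀ N {S : VertexSet n} {T : EdgeSet n} {c : Fin n} → card S ≡ N → Simple S T → S y ≡ true → S c ≡ true → Q c ≡ true →
  (∀ u v → Q u ≡ true → u ≢ y → T u v ≡ true → Q v ≡ true) →
  (∀ u → S u ≡ true → degE T u ℕ.+ (δℕ u y ℕ.+ δℕ u c) ≡ w u) → Unravelled w S T c y
unravel {n} w Q y Q⇒2 N {S} {T} {c} card≡ simple y∈ c∈ Qc Q-step degrees with eqb c y in cy
... | true rewrite eqb⇒≡ c y cy = record
  { chain = stop (Simple.sym-E simple) y∈ ; simple₁ = simple ; y∈₁ = y∈ ; degrees₁ = degrees }
... | false = onward N card≡
  where
  open Simple simple
  c≢y : c ≢ y
  c≢y refl = case trans (≡-sym (eqb-refl c)) cy of λ ()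
  deg1 : degE T c ≡ 1
  deg1 = ℕ.+-cancelʳ-≡ 1 _ _ (begin
    degE T c ℕ.+ 1
      ≡⟨ cong₂ (λ p q → degE T c ℕ.+ (p ℕ.+ q)) (δℕ-≢ c≢y) (δℕ-refl c) ⟨
    degE T c ℕ.+ (δℕ c y ℕ.+ δℕ c c)
      ≡⟨ degrees c c∈ ⟩
    w c
      ≡⟨ Q⇒2 c Qc c≢y ⟩
    2 ∎)
    where open ≡-Reasoning
  next : ∃ λ v → T c v ≡ true
  next = neighbour T c (ℕ.≤-reflexive (≡-sym deg1))
  c′ : Fin n
  c′ = proj₁ next
  leaf : Leaf S T (drop S c) (cut T c c′) c c′
  leaf = pendant (proj₂ next) deg1
  open Leaf leaf using (card-leaf; anchor; edge; member↑; ≢leaf)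
  degrees′ : ∀ u → drop S c u ≡ true → degE (cut T c c′) u ℕ.+ (δℕ u y ℕ.+ δℕ u c′) ≡ w u
  degrees′ u u∈ = begin
    degE (cut T c c′) u ℕ.+ (δℕ u y ℕ.+ δℕ u c′)
      ≡⟨ cong (degE (cut T c c′) u ℕ.+_) (ℕ.+-comm (δℕ u y) (δℕ u c′)) ⟩
    degE (cut T c c′) u ℕ.+ (δℕ u c′ ℕ.+ δℕ u y)
      ≡⟨ ℕ.+-assoc (degE (cut T c c′) u) (δℕ u c′) (δℕ u y) ⟨
    degE (cut T c c′) u ℕ.+ δℕ u c′ ℕ.+ δℕ u y
      ≡⟨ cong (λ t → degE (cut T c c′) u ℕ.+ (t ℕ.+ δℕ u c′) ℕ.+ δℕ u y) (δℕ-≢ (≢leaf u∈)) ⟨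
    degE (cut T c c′) u ℕ.+ (δℕ u c ℕ.+ δℕ u c′) ℕ.+ δℕ u y
      ≡⟨ cong (ℕ._+ δℕ u y) (deg-edge {E′ = cut T c c′} {E = T} edge u) ⟨
    degE T u ℕ.+ δℕ u y
      ≡⟨ cong (degE T u ℕ.+_) (ℕ.+-identityʳ (δℕ u y)) ⟨
    degE T u ℕ.+ (δℕ u y ℕ.+ 0)
      ≡⟨ cong (λ t → degE T u ℕ.+ (δℕ u y ℕ.+ t)) (δℕ-≢ (≢leaf u∈)) ⟨
    degE T u ℕ.+ (δℕ u y ℕ.+ δℕ u c)
      ≡⟨ degrees u (member↑ u∈) ⟩
    w u ∎
    where open ≡-Reasoning
  onward : ∀ N → card S ≡ N → Unravelled w S T c y
  onward zero    card≡ = case trans (≡-sym card-leaf) card≡ of λ ()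
  onward (suc N) card≡ = record
    { chain = grow leaf (Q⇒2 c Qc c≢y) (Unravelled.chain rest)
    ; simple₁ = Unravelled.simple₁ rest ; y∈₁ = Unravelled.y∈₁ rest ; degrees₁ = Unravelled.degrees₁ rest }
    where
    rest : Unravelled w (drop S c) (cut T c c′) c′ y
    rest = unravel w Q y Q⇒2 N (ℕ.suc-injective (trans (≡-sym card-leaf) card≡)) (Leaf-simple leaf simple)
      (cong₂ (λ s b → s ∧ not b) y∈ (≢⇒eqb (c≢y ∘ ≡-sym))) anchor (Q-step c c′ Qc c≢y (proj₂ next))
      (λ u v Qu u≢ e → Q-step u v Qu u≢ (cut-⊆ T c c′ u v e)) degrees′

card-positive : ∀ {c} {S : VertexSet n} {E : EdgeSet n} → Net c S E → 1 ≤ card S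
card-positive {S = S} net = let u , u∈ = Net.root net in
  ℕ.≤-trans (ℕ.≤-reflexive (≡-sym (cong b2ℕ u∈))) (term≤∑ℕ (λ u → b2ℕ (S u)) u)

isolated-only : ∀ {c} {S : VertexSet n} {E : EdgeSet n} → Net c S E → ∀ x → S x ≡ true → degE E x ≡ 0 → ∀ z → S z ≡ true → z ≡ x
isolated-only {n} {S = S} {E} net x x∈ deg0 z z∈ = eqb⇒≡ z x (trans (Net.joined net (λ u → eqb u x) closed z x z∈ x∈) (eqb-refl x))
  where
  no-edge : ∀ v → E x v ≡ true → ⊥
  no-edge v e = case subst (1 ≤_) deg0 (degE-pos E x v e) of λ ()
  closed : Closed E (λ u → eqb u x)
  closed u v e with eqb u x in ux | eqb v x in vx
  ... | true  | true  = refl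
  ... | false | false = refl
  ... | true  | false = ⊥-elim (no-edge v (subst (λ u → E u v ≡ true) (eqb⇒≡ u x ux) e))
  ... | false | true  = ⊥-elim (no-edge u (subst (λ v → E v u ≡ true) (eqb⇒≡ v x vx) (trans (Net.sym-E net v u) e)))

-- By connectedness an isolated vertex would be the whole network, which has volume 0 and hence
-- cyclomatic number 0.
no-isolated : ∀ {c} {S : VertexSet n} {E : EdgeSet n} → Net (suc c) S E → ∀ x → S x ≡ true → degE E x ≢ 0
no-isolated {n} {c} {S} {E} net x x∈ deg0 = case ℕ.*-cancelˡ-≡ 1 (2 ℕ.+ c) 2 absurd of λ ()
  where
  open Net net using (within; euler)
  only : ∀ z → S z ≡ true → z ≡ x
  only = isolated-only net x x∈ deg0
  all-zero : ∀ u → degE E u ≡ 0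
  all-zero u with S u in u∈
  ... | true  = subst (λ u → degE E u ≡ 0) (≡-sym (only u u∈)) deg0
  ... | false = degE-outside within u u∈
  absurd : 2 ≡ 2 ℕ.* (1 ℕ.+ suc c)
  absurd = begin
    2
      ≡⟨ cong (ℕ._+ 2) (trans (∑ℕ-cong all-zero) (∑ℕ-zero {n})) ⟨
    vol E ℕ.+ 2
      ≡⟨ euler ⟩
    2 ℕ.* (card S ℕ.+ suc c)
      ≡⟨ cong (λ t → 2 ℕ.* (t ℕ.+ suc c)) (card-singleton {S = S} x∈ only) ⟩
    2 ℕ.* (1 ℕ.+ suc c) ∎
    where open ≡-Reasoning

pendant-or-core : ∀ {c} {S : VertexSet n} {E : EdgeSet n} → Net (suc c) S E →
  (∃ λ x → S x ≡ true × degE E x ≡ 1) ⊎ (∀ u → S u ≡ true → 2 ≤ degE E u)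
pendant-or-core {S = S} {E} net with search (λ u → S u ∧ (degE E u ≤ᵇ 1))
... | inj₁ (x , p) = inj₁ (x , proj₁ (∧-true p) , ℕ.≤-antisym (ℕ.≤ᵇ⇒≤ (degE E x) 1 (≡⇒True (proj₂ (∧-true {S x} p)))) (ℕ.n≢0⇒n>0 (no-isolated net x (proj₁ (∧-true p)))))
... | inj₂ none    = inj₂ λ u u∈ → ℕ.≰⇒> λ deg≤1 → case trans (≡-sym (none u)) (cong₂ _∧_ u∈ (True⇒≡ (ℕ.≤⇒≤ᵇ deg≤1))) of λ ()

2s≤deg : {S : VertexSet n} {E : EdgeSet n} → (∀ u → S u ≡ true → 2 ≤ degE E u) → ∀ u → 2 ℕ.* b2ℕ (S u) ≤ degE E u
2s≤deg {S = S} core u with S u in u∈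
... | true  = core u u∈
... | false = z≤n

closing-degrees : {E : EdgeSet n} → Sym E → ∀ {c y} → c ≢ y → E c y ≡ true → ∀ u → degE (cut E c y) u ℕ.+ (δℕ u y ℕ.+ δℕ u c) ≡ degE E u
closing-degrees {E = E} sym-E {c} {y} c≢y cy u = trans (cong (degE (cut E c y) u ℕ.+_) (ℕ.+-comm (δℕ u y) (δℕ u c)))
  (≡-sym (deg-edge {E′ = cut E c y} {E = E} (cut-add sym-E c≢y cy) u))

vol-unicyclic : {S : VertexSet n} {E : EdgeSet n} → Euler 1 S E → vol E ≡ 2 ℕ.* card S
vol-unicyclic {S = S} {E} euler = ℕ.+-cancelʳ-≡ 2 _ _ (trans euler (trans (cong (2 ℕ.*_) (ℕ.+-comm (card S) 1)) (trans (ℕ.*-suc 2 (card S)) (ℕ.+-comm 2 (2 ℕ.* card S)))))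

-- Unicyclic networks

module CycleNet {S : VertexSet n} {E : EdgeSet n} (net : Net 1 S E) (core : ∀ u → S u ≡ true → 2 ≤ degE E u)
                {r : Fin n → Fin n → ℚ} (res : Resistance S E r) where
  open Net net

  private
    -- The degrees are at least 2 and their sum is twice the number of vertices, so none can exceed
    -- 2.
    degree-2 : ∀ u → S u ≡ true → degE E u ≡ 2
    degree-2 u u∈ = trans (≡-sym (∑ℕ-tight (λ u → 2 ℕ.* b2ℕ (S u)) (degE E) (2s≤deg {E = E} core)
      (trans (∑ℕ-*ˡ 2 (λ u → b2ℕ (S u))) (≡-sym (vol-unicyclic {S = S} {E} euler))) u)) (cong (λ s → 2 ℕ.* b2ℕ s) u∈)

    -- The formulas for a closed path hold at its start, so the cycle is opened anew at each vertex
    -- `z`.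
    module At (z : Fin n) (z∈ : S z ≡ true) where
      next : ∃ λ y → E z y ≡ true
      next = neighbour E z (ℕ.≤-trans (s≤s z≤n) (core z z∈))
      y : Fin n
      y = proj₁ next
      zy : E z y ≡ true
      zy = proj₂ next
      T : EdgeSet n
      T = cut E z y
      open Unravelled (unravel (degE E) S y (λ u u∈ _ → degree-2 u u∈) (card S) refl (cut-simple z y) (within₂ z y zy) z∈ z∈
        (λ u v _ _ e → within₂ u v (cut-⊆ E z y u v e)) (λ u _ → closing-degrees sym-E (edge-≢ zy) zy u)) public
      add : AddEdge T z y E
      add = cut-add sym-E (edge-≢ zy) zy
      net₁ : Net 0 S₁ E₁
      net₁ = Chain-net chain (record { simple = cut-simple z y ; joined = Chain-closed-joined chain add joined ; euler = Euler-edge {T = T} {E = E} add euler ; root = root })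
      -- The imaginary edge has become a loop at `y` and uses up its degree 2; what remains of the
      -- network is `y` alone.
      y-isolated : degE E₁ y ≡ 0
      y-isolated = ℕ.+-cancelʳ-≡ 2 _ _ (trans (cong (λ t → degE E₁ y ℕ.+ (t ℕ.+ t)) (≡-sym (δℕ-refl y))) (trans (degrees₁ y y∈₁) (degree-2 y (within₂ z y zy))))
      open ClosedCycle {T = T} chain add sym-E euler (Simple.sym-E simple₁) (Simple.within simple₁) y∈₁
        (isolated-only net₁ y y∈₁ y-isolated) res public
      length : ∃ λ t → ℓ ≡ 2 ℕ.+ t
      length = Chain-length≥2 chain (edge-≢ zy) (cut-removed E z y)
      card≡ : card S ≡ suc ℓ
      card≡ = trans (Chain-card chain) (trans (cong (ℓ ℕ.+_) (card-singleton {S = S₁} y∈₁ (isolated-only net₁ y y∈₁ y-isolated))) (ℕ.+-comm ℓ 1))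
      at : CycleAt S E r (ι ℓ) z
      at = record { dist-≡ = cycle-dist ; point-≡ = cycle-point ; total-≡ = cycle-total ; r-≤ = cycle-r }

  cycleNet-bounded : Bounded level₁ S E r
  cycleNet-bounded = cycle-bounded t (trans At₀.cycle-card (cong (λ l → ι l + 1ℚ) (proj₂ At₀.length))) (proj₁ root) (proj₂ root)
    -- The path lengths found from different vertices agree, each being one less than the number of
    -- vertices.
    (λ z z∈ → subst (λ l → CycleAt S E r (ι l) z) (trans (ℕ.suc-injective (trans (≡-sym (At.card≡ z z∈)) At₀.card≡)) (proj₂ At₀.length)) (At.at z z∈))
    where
    module At₀ = At (proj₁ root) (proj₂ root)
    t : ℕ
    t = proj₁ At₀.length

unicyclic-bounded : ∀ N {S : VertexSet n} {E : EdgeSet n} {r : Fin n → Fin n → ℚ} → card S ≡ N → Net 1 S E → Resistance S E r → Bounded level₁ S E r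
unicyclic-bounded {n} N {S} {E} {r} card≡ net res = [ with-pendant N card≡ , (λ core → CycleNet.cycleNet-bounded net core res) ]′ (pendant-or-core net)
  where
  with-pendant : ∀ N → card S ≡ N → (∃ λ x → S x ≡ true × degE E x ≡ 1) → Bounded level₁ S E r
  with-pendant zero    card≡ _ = case subst (1 ≤_) card≡ (card-positive net) of λ ()
  with-pendant (suc N) card≡ (x , x∈ , deg1) =
    LeafBounds.leaf-bounded leaf level₁ (Net.euler net′) res
      (unicyclic-bounded N (ℕ.suc-injective (trans (≡-sym (Leaf.card-leaf leaf)) card≡)) net′ (LeafSums.res′ leaf res))
    where
    next : ∃ λ y → E x y ≡ true
    next = neighbour E x (ℕ.≤-reflexive (≡-sym deg1))
    leaf : Leaf S E (drop S x) (cut E x (proj₁ next)) x (proj₁ next)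
    leaf = Net.pendant net (proj₂ next) deg1
    net′ : Net 1 (drop S x) (cut E x (proj₁ next))
    net′ = Leaf-net leaf net

-- A vertex and its neighbours are distinct members of `S`, so every degree plus one is at most the
-- number of vertices. Summed over `S`, the left side is three times that number and the right side
-- its square.
unicyclic-card≥3 : {S : VertexSet n} {E : EdgeSet n} → Net 1 S E → 3 ≤ card S
unicyclic-card≥3 {n} {S} {E} net = ℕ.*-cancelʳ-≤ 3 (card S) (card S) {{ℕ.>-nonZero (card-positive net)}} (begin
  3 ℕ.* card S
    ≡⟨ ℕ.+-comm (card S) (2 ℕ.* card S) ⟩
  2 ℕ.* card S ℕ.+ card S
    ≡⟨ cong (ℕ._+ card S) (vol-unicyclic {S = S} {E} (Net.euler net)) ⟨
  vol E ℕ.+ card S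
    ≡⟨ ∑ℕ-+ (degE E) (λ u → b2ℕ (S u)) ⟨
  ∑ℕ (λ u → degE E u ℕ.+ b2ℕ (S u))
    ≤⟨ ∑ℕ-mono bound ⟩
  ∑ℕ (λ u → card S ℕ.* b2ℕ (S u))
    ≡⟨ ∑ℕ-*ˡ (card S) (λ u → b2ℕ (S u)) ⟩
  card S ℕ.* card S ∎)
  where
  open ℕ.≤-Reasoning
  open Net net
  bound : ∀ u → degE E u ℕ.+ b2ℕ (S u) ≤ card S ℕ.* b2ℕ (S u)
  bound u with S u in u∈
  ... | false = ℕ.≤-reflexive (trans (cong (ℕ._+ 0) (degE-outside within u u∈)) (≡-sym (ℕ.*-zeroʳ (card S))))
  ... | true  = begin
    degE E u ℕ.+ 1
      ≡⟨ cong (degE E u ℕ.+_) (∑ℕ-δ u) ⟨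
    degE E u ℕ.+ ∑ℕ (λ v → δℕ v u)
      ≡⟨ ∑ℕ-+ (λ v → b2ℕ (E u v)) (λ v → δℕ v u) ⟨
    ∑ℕ (λ v → b2ℕ (E u v) ℕ.+ δℕ v u)
      ≤⟨ ∑ℕ-mono single ⟩
    card S
      ≡⟨ ℕ.*-identityʳ (card S) ⟨
    card S ℕ.* 1 ∎
    where
    single : ∀ v → b2ℕ (E u v) ℕ.+ δℕ v u ≤ b2ℕ (S v)
    single v with E u v in e | eqb v u in vu
    ... | true  | true  = ⊥-elim (edge-≢ e (≡-sym (eqb⇒≡ v u vu)))
    ... | true  | false = ℕ.≤-reflexive (≡-sym (cong b2ℕ (within₂ u v e)))
    ... | false | true  = ℕ.≤-reflexive (≡-sym (cong b2ℕ (trans (cong S (eqb⇒≡ v u vu)) u∈)))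
    ... | false | false = z≤n

-- Bicyclic networks

-- The local part of `IsCycle`, relative to an edge set, so that it can be handed on when pendant
-- vertices are deleted.
record TwoRegular (C E : EdgeSet n) : Set where
  field
    sym-C    : Sym C
    ⊆E       : C ⊆ E
    nonempty : ∃ λ u → ∃ λ v → C u v ≡ true
    deg02    : ∀ u → degE C u ≡ 0 ⊎ degE C u ≡ 2

  edge⇒2 : ∀ u v → C u v ≡ true → degE C u ≡ 2
  edge⇒2 u v e = [ (λ d0 → case subst (1 ≤_) d0 (degE-pos C u v e) of λ ()) , (λ d2 → d2) ]′ (deg02 u)

  on : Fin n → Bool
  on u = degE C u ≡ᵇ 2

  on⇒2 : ∀ {u} → on u ≡ true → degE C u ≡ 2
  on⇒2 {u} p = ℕ.≡ᵇ⇒≡ (degE C u) 2 (≡⇒True p)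

  2⇒on : ∀ {u} → degE C u ≡ 2 → on u ≡ true
  2⇒on {u} e = True⇒≡ (ℕ.≡⇒≡ᵇ (degE C u) 2 e)

  -- At a vertex of degree 2 in `E` the two edges of `C` are all there are.
  stays : ∀ {u v} → on u ≡ true → degE E u ≡ 2 → E u v ≡ true → on v ≡ true
  stays {u} {v} p d e = 2⇒on (edge⇒2 v u (trans (sym-C v u) (degE-tight ⊆E u (trans (on⇒2 p) (≡-sym d)) v e)))

-- The edge set is quantified inside, so the statement is proved once for the given graph and
-- remains usable after any number of pendant deletions.
NoShare : (C₁ C₂ : EdgeSet n) → Set
NoShare C₁ C₂ = ∀ E → C₁ ⊆ E → C₂ ⊆ E → (∀ u → degE E u ≤ 3) → ∀ z → degE C₁ z ≡ 2 → degE C₂ z ≡ 2 → ⊥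

record EndCycle (S : VertexSet n) (E : EdgeSet n) : Set where
  field
    C       : EdgeSet n
    regular : TwoRegular C E
    y       : Fin n
  open TwoRegular regular public
  field
    y-on    : on y ≡ true
    others  : ∀ u → on u ≡ true → u ≢ y → degE E u ≡ 2

module Core {S : VertexSet n} {E : EdgeSet n} (net : Net 2 S E) (core : ∀ u → S u ≡ true → 2 ≤ degE E u) where
  open Net net

  vol≡ : vol E ≡ 2 ℕ.* card S ℕ.+ 2
  vol≡ = ℕ.+-cancelʳ-≡ 2 _ _ (begin
    vol E ℕ.+ 2
      ≡⟨ euler ⟩
    2 ℕ.* (card S ℕ.+ 2)
      ≡⟨ ℕ.*-distribˡ-+ 2 (card S) 2 ⟩
    2 ℕ.* card S ℕ.+ 4
      ≡⟨ ℕ.+-assoc (2 ℕ.* card S) 2 2 ⟨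
    2 ℕ.* card S ℕ.+ 2 ℕ.+ 2 ∎)
    where open ≡-Reasoning

  excess : EdgeSet n → Fin n → Bool
  excess C u = (degE C u ≡ᵇ 2) ∧ (3 ≤ᵇ degE E u)

  module _ {C : EdgeSet n} (reg : TwoRegular C E) where
    open TwoRegular reg

    C-within : ∀ {u} → on u ≡ true → S u ≡ true
    C-within {u} p = let v , uv = neighbour C u (subst (1 ≤_) (≡-sym (on⇒2 p)) (s≤s z≤n)) in within u v (⊆E u v uv)

    not-excess : ∀ {u} → on u ≡ true → (3 ≤ᵇ degE E u) ≡ false → degE E u ≡ 2
    not-excess {u} p q = ℕ.≤-antisym (ℕ.≤-pred (ℕ.≰⇒> λ 3≤ → case trans (≡-sym (True⇒≡ (ℕ.≤⇒≤ᵇ 3≤))) q of λ ())) (core u (C-within p))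

    -- If all vertices of `C` had degree 2 in `E`, no edge would leave them; by connectedness they
    -- would be all of `S`, and the volume would miss the value 2|S| + 2.
    has-excess : ∃ λ x → on x ≡ true × 3 ≤ degE E x
    has-excess with search (excess C)
    ... | inj₁ (x , p) = x , proj₁ (∧-true p) , ℕ.≤ᵇ⇒≤ 3 (degE E x) (≡⇒True (proj₂ (∧-true {on x} p)))
    ... | inj₂ none    = case ℕ.+-cancelˡ-≡ (2 ℕ.* card S) 2 0 (trans (≡-sym vol≡) (trans vol-2 (≡-sym (ℕ.+-identityʳ (2 ℕ.* card S))))) of λ ()
      where
      deg2 : ∀ u → on u ≡ true → degE E u ≡ 2
      deg2 u p = not-excess p (subst (λ b → b ∧ (3 ≤ᵇ degE E u) ≡ false) p (none u))
      closed : Closed E on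
      closed u v e with on u in pu | on v in pv
      ... | true  | true  = refl
      ... | false | false = refl
      ... | true  | false = trans (≡-sym (stays pu (deg2 u pu) e)) pv
      ... | false | true  = trans (≡-sym pu) (stays pv (deg2 v pv) (trans (sym-E v u) e))
      all-on : ∀ u → S u ≡ true → on u ≡ true
      all-on u u∈ = let a , b , ab = nonempty in
        trans (joined on closed u a u∈ (within a b (⊆E a b ab))) (2⇒on (edge⇒2 a b ab))
      vol-2 : vol E ≡ 2 ℕ.* card S
      vol-2 = trans (∑ℕ-cong pointwise) (∑ℕ-*ˡ 2 (λ u → b2ℕ (S u)))
        where
        pointwise : ∀ u → degE E u ≡ 2 ℕ.* b2ℕ (S u)
        pointwise u with S u in u∈
        ... | true  = deg2 u (all-on u u∈)
        ... | false = degE-outside within u u∈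

  -- The sum of deg − 2 over S is 2.
  two-excess : ∀ {x x′} → x ≢ x′ → 3 ≤ degE E x → 3 ≤ degE E x′ → S x ≡ true → S x′ ≡ true →
    ∀ u → degE E u ≡ 2 ℕ.* b2ℕ (S u) ℕ.+ (δℕ u x ℕ.+ δℕ u x′)
  two-excess {x} {x′} x≢x′ 3≤x 3≤x′ x∈ x′∈ u = ≡-sym (∑ℕ-tight f (degE E) below (begin
    ∑ℕ f
      ≡⟨ ∑ℕ-+ (λ u → 2 ℕ.* b2ℕ (S u)) (λ u → δℕ u x ℕ.+ δℕ u x′) ⟩
    ∑ℕ (λ u → 2 ℕ.* b2ℕ (S u)) ℕ.+ ∑ℕ (λ u → δℕ u x ℕ.+ δℕ u x′)
      ≡⟨ cong₂ ℕ._+_ (∑ℕ-*ˡ 2 (λ u → b2ℕ (S u))) (trans (∑ℕ-+ (λ u → δℕ u x) (λ u → δℕ u x′)) (cong₂ ℕ._+_ (∑ℕ-δ x) (∑ℕ-δ x′))) ⟩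
    2 ℕ.* card S ℕ.+ 2
      ≡⟨ vol≡ ⟨
    vol E ∎) u)
    where
    open ≡-Reasoning
    f : Fin n → ℕ
    f u = 2 ℕ.* b2ℕ (S u) ℕ.+ (δℕ u x ℕ.+ δℕ u x′)
    below : ∀ u → f u ≤ degE E u
    below u with eqb u x in ux | eqb u x′ in ux′ | S u in u∈
    ... | true  | true  | _     = ⊥-elim (x≢x′ (trans (≡-sym (eqb⇒≡ u x ux)) (eqb⇒≡ u x′ ux′)))
    ... | true  | false | true  = subst (λ u → 3 ≤ degE E u) (≡-sym (eqb⇒≡ u x ux)) 3≤x
    ... | false | true  | true  = subst (λ u → 3 ≤ degE E u) (≡-sym (eqb⇒≡ u x′ ux′)) 3≤x′
    ... | true  | false | false = case trans (≡-sym u∈) (trans (cong S (eqb⇒≡ u x ux)) x∈) of λ ()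
    ... | false | true  | false = case trans (≡-sym u∈) (trans (cong S (eqb⇒≡ u x′ ux′)) x′∈) of λ ()
    ... | false | false | true  = core u u∈
    ... | false | false | false = z≤n

  -- If `C₁` has a second vertex of degree above 2, the two of them use up the whole excess: both
  -- have degree 3 and all others degree 2. A vertex of `C₂` of degree above 2 must then be one of
  -- them, so the cycles meet in a network of maximal degree 3, against `NoShare`.
  endCycle : ∀ {C₁ C₂} → TwoRegular C₁ E → TwoRegular C₂ E → NoShare C₁ C₂ → EndCycle S E
  endCycle {C₁} {C₂} reg₁ reg₂ noShare with has-excess reg₁ | search (λ u → excess C₁ u ∧ not (eqb u (proj₁ (has-excess reg₁))))
  ... | x , x-on , _ | inj₂ none = record
    { regular = reg₁ ; y = x ; y-on = x-on
    ; others = λ u p u≢x → not-excess reg₁ p (b-false (subst₂ (λ b e → (b ∧ (3 ≤ᵇ degE E u)) ∧ not e ≡ false) p (≢⇒eqb u≢x) (none u))) }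
    where
    b-false : ∀ {b} → b ∧ true ≡ false → b ≡ false
    b-false {false} _ = refl
  ... | x , x-on , 3≤x | inj₁ (x′ , p) = ⊥-elim (noShare E (TwoRegular.⊆E reg₁) (TwoRegular.⊆E reg₂) deg≤3 x₂ (TwoRegular.on⇒2 reg₁ x₂-on₁) (TwoRegular.on⇒2 reg₂ x₂-on))
    where
    p₁ : excess C₁ x′ ≡ true
    p₁ = proj₁ (∧-true p)
    x′-on : TwoRegular.on reg₁ x′ ≡ true
    x′-on = proj₁ (∧-true p₁)
    3≤x′ : 3 ≤ degE E x′
    3≤x′ = ℕ.≤ᵇ⇒≤ 3 (degE E x′) (≡⇒True (proj₂ (∧-true {TwoRegular.on reg₁ x′} p₁)))
    x≢x′ : x ≢ x′
    x≢x′ refl = case trans (≡-sym (proj₂ (∧-true {excess C₁ x} p))) (cong not (eqb-refl x)) of λ ()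
    degrees : ∀ u → degE E u ≡ 2 ℕ.* b2ℕ (S u) ℕ.+ (δℕ u x ℕ.+ δℕ u x′)
    degrees = two-excess x≢x′ 3≤x 3≤x′ (C-within reg₁ x-on) (C-within reg₁ x′-on)
    deg≤3 : ∀ u → degE E u ≤ 3
    deg≤3 u = ℕ.≤-trans (ℕ.≤-reflexive (degrees u)) (ℕ.+-mono-≤ (ℕ.*-monoʳ-≤ 2 (b2ℕ≤1 (S u))) at-most-one)
      where
      at-most-one : δℕ u x ℕ.+ δℕ u x′ ≤ 1
      at-most-one with eqb u x in ux | eqb u x′ in ux′
      ... | true  | true  = ⊥-elim (x≢x′ (trans (≡-sym (eqb⇒≡ u x ux)) (eqb⇒≡ u x′ ux′)))
      ... | true  | false = ℕ.≤-refl
      ... | false | true  = ℕ.≤-refl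
      ... | false | false = z≤n
    x₂ : Fin n
    x₂ = proj₁ (has-excess reg₂)
    x₂-on : TwoRegular.on reg₂ x₂ ≡ true
    x₂-on = proj₁ (proj₂ (has-excess reg₂))
    3≤x₂ : 3 ≤ degE E x₂
    3≤x₂ = proj₂ (proj₂ (has-excess reg₂))
    x₂-on₁ : TwoRegular.on reg₁ x₂ ≡ true
    x₂-on₁ with eqb x₂ x in e | eqb x₂ x′ in e′ | degrees x₂
    ... | true  | _     | _ = subst (λ u → TwoRegular.on reg₁ u ≡ true) (≡-sym (eqb⇒≡ x₂ x e)) x-on
    ... | false | true  | _ = subst (λ u → TwoRegular.on reg₁ u ≡ true) (≡-sym (eqb⇒≡ x₂ x′ e′)) x′-on
    ... | false | false | d = case ℕ.≤-trans 3≤x₂ (ℕ.≤-trans (ℕ.≤-reflexive (trans d (ℕ.+-identityʳ _))) (ℕ.*-monoʳ-≤ 2 (b2ℕ≤1 (S x₂)))) of λ { (s≤s (s≤s ())) }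

module EndCycleNet {S : VertexSet n} {E : EdgeSet n} (net : Net 2 S E) (end : EndCycle S E)
                   {r : Fin n → Fin n → ℚ} (res : Resistance S E r) where
  open Net net
  open EndCycle end

  private
    next : ∃ λ c → C y c ≡ true
    next = neighbour C y (subst (1 ≤_) (≡-sym (on⇒2 y-on)) (s≤s z≤n))
    c : Fin n
    c = proj₁ next
    cy : E c y ≡ true
    cy = ⊆E c y (trans (sym-C c y) (proj₂ next))
    T : EdgeSet n
    T = cut E c y
    add : AddEdge T c y E
    add = cut-add sym-E (edge-≢ cy) cy
    open Unravelled (unravel (degE E) on y others (card S) refl (cut-simple c y) (within₂ c y cy) (within c y cy)
      (2⇒on (edge⇒2 c y (trans (sym-C c y) (proj₂ next))))
      (λ u v p u≢y e → stays p (others u p u≢y) (cut-⊆ E c y u v e))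
      (λ u _ → closing-degrees sym-E (edge-≢ cy) cy u))
    net-T : Net 1 S T
    net-T = record { simple = cut-simple c y ; joined = Chain-closed-joined chain add joined ; euler = Euler-edge {T = T} {E = E} add euler ; root = root }
    length : ∃ λ t → ℓ ≡ 2 ℕ.+ t
    length = Chain-length≥2 chain (edge-≢ cy) (cut-removed E c y)
    -- What remains after unravelling is unicyclic and so supplies the three vertices required for
    -- `gain-≤`.
    card₁ : card S₁ ≡ 3 ℕ.+ (card S₁ ℕ.∸ 3)
    card₁ = ≡-sym (ℕ.m+[n∸m]≡n (unicyclic-card≥3 (Chain-net chain net-T)))
    module Second = ClosedSecond {T = T} chain add sym-E euler res
    module Closed′ = ClosedChain {T = T} chain add sym-E {cyc = 2} euler res

  endCycle-bounded : Bounded level₂ S E r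
  endCycle-bounded = Second.second-bounded (proj₁ length) (card S₁ ℕ.∸ 3) (proj₂ length) (trans (Chain-card chain) (cong (ℓ ℕ.+_) card₁))
    (unicyclic-bounded (card S) refl net-T Closed′.resT)

bicyclic-bounded : ∀ N {S : VertexSet n} {E C₁ C₂ : EdgeSet n} {r : Fin n → Fin n → ℚ} → card S ≡ N → Net 2 S E →
  TwoRegular C₁ E → TwoRegular C₂ E → NoShare C₁ C₂ → Resistance S E r → Bounded level₂ S E r
bicyclic-bounded {n} N {S} {E} {C₁} {C₂} {r} card≡ net reg₁ reg₂ noShare res =
  [ with-pendant N card≡ , (λ core → EndCycleNet.endCycle-bounded net (Core.endCycle net core reg₁ reg₂ noShare) res) ]′ (pendant-or-core net)
  where
  with-pendant : ∀ N → card S ≡ N → (∃ λ x → S x ≡ true × degE E x ≡ 1) → Bounded level₂ S E r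
  with-pendant zero    card≡ _ = case subst (1 ≤_) card≡ (card-positive net) of λ ()
  with-pendant (suc N) card≡ (x , x∈ , deg1) =
    LeafBounds.leaf-bounded leaf level₂ (Net.euler net′) res
      (bicyclic-bounded N (ℕ.suc-injective (trans (≡-sym (Leaf.card-leaf leaf)) card≡)) net′ (survives reg₁) (survives reg₂) noShare (LeafSums.res′ leaf res))
    where
    next : ∃ λ y → E x y ≡ true
    next = neighbour E x (ℕ.≤-reflexive (≡-sym deg1))
    leaf : Leaf S E (drop S x) (cut E x (proj₁ next)) x (proj₁ next)
    leaf = Net.pendant net (proj₂ next) deg1
    net′ : Net 2 (drop S x) (cut E x (proj₁ next))
    net′ = Leaf-net leaf net
    -- A vertex on `C` has degree at least 2, so the edge at the pendant vertex is not an edge of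
    -- `C`.
    survives : ∀ {C} → TwoRegular C E → TwoRegular C (cut E x (proj₁ next))
    survives {C} reg = record { sym-C = sym-C ; ⊆E = ⊆cut ; nonempty = nonempty ; deg02 = deg02 }
      where
      open TwoRegular reg
      avoids : ∀ v → C x v ≡ true → ⊥
      avoids v e = case subst₂ _≤_ (edge⇒2 x v e) deg1 (degE-mono ⊆E x) of λ { (s≤s ()) }
      ⊆cut : C ⊆ cut E x (proj₁ next)
      ⊆cut u v e with AddEdge-cases {E′ = cut E x (proj₁ next)} {E = E} (Leaf.edge leaf) u v (⊆E u v e)
      ... | inj₁ e′                   = e′
      ... | inj₂ (inj₁ (refl , refl)) = ⊥-elim (avoids v e)
      ... | inj₂ (inj₂ (refl , refl)) = ⊥-elim (avoids u (trans (sym-C x u) e))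

-- Components and the third cycle

search₂ : ∀ {m} (P : Fin m → Fin n → Bool) → (∃ λ u → ∃ λ v → P u v ≡ true) ⊎ (∀ u v → P u v ≡ false)
search₂ {m = zero}  P = inj₂ λ ()
search₂ {m = suc m} P with search (P zero) | search₂ (P ∘ suc)
... | inj₁ (v , p) | _                = inj₁ (zero , v , p)
... | inj₂ _       | inj₁ (u , v , p) = inj₁ (suc u , v , p)
... | inj₂ none    | inj₂ none′       = inj₂ λ { zero → none ; (suc u) → none′ u }

module _ {E : EdgeSet n} where

  Reach-++ : ∀ {u v w} → Reach E u v → Reach E v w → Reach E u w
  Reach-++ here       q = q
  Reach-++ (step e p) q = step e (Reach-++ p q)

  Reach-sym : Sym E → ∀ {u v} → Reach E u v → Reach E v u
  Reach-sym sym-E here                       = here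
  Reach-sym sym-E (step {u} {v} e p) = Reach-++ (Reach-sym sym-E p) (step (trans (sym-E v u) e) here)

record Component (H : EdgeSet n) (v₀ : Fin n) : Set where
  field
    K       : VertexSet n
    base    : K v₀ ≡ true
    reached : ∀ u → K u ≡ true → Reach H v₀ u
    closed  : ∀ u v → H u v ≡ true → K u ≡ true → K v ≡ true

-- Saturation: an edge leaving `K` enlarges it, and the number of vertices outside `K` bounds the
-- rounds.
component : (H : EdgeSet n) (v₀ : Fin n) → Component H v₀
component {n} H v₀ = expand _ (λ u → eqb u v₀) refl (eqb-refl v₀) (λ u e → subst (Reach H v₀) (≡-sym (eqb⇒≡ u v₀ e)) here)
  where
  expand : ∀ N (K : VertexSet n) → card (not ∘ K) ≡ N → K v₀ ≡ true → (∀ u → K u ≡ true → Reach H v₀ u) → Component H v₀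
  expand N K N≡ base reached with search₂ (λ u v → (H u v ∧ K u) ∧ not (K v))
  ... | inj₂ none = record { K = K ; base = base ; reached = reached ; closed = closed }
    where
    closed : ∀ u v → H u v ≡ true → K u ≡ true → K v ≡ true
    closed u v uv Ku with K v | none u v
    ... | true  | _ = refl
    ... | false | q rewrite uv | Ku = case q of λ ()
  ... | inj₁ (u , v , p) = shrink N N≡
    where
    uv : H u v ≡ true
    uv = proj₁ (∧-true (proj₁ (∧-true {H u v ∧ K u} p)))
    Ku : K u ≡ true
    Ku = proj₂ (∧-true {H u v} (proj₁ (∧-true {H u v ∧ K u} p)))
    Kv : not (K v) ≡ true
    Kv = proj₂ (∧-true {H u v ∧ K u} p)
    K⁺ : VertexSet n
    K⁺ w = K w ∨ eqb w v
    reached⁺ : ∀ w → K⁺ w ≡ true → Reach H v₀ w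
    reached⁺ w q with K w in Kw | eqb w v in wv
    ... | true  | _     = reached w Kw
    ... | false | true  = subst (Reach H v₀) (≡-sym (eqb⇒≡ w v wv)) (Reach-++ (reached u Ku) (step uv here))
    ... | false | false = case q of λ ()
    split : ∀ w → b2ℕ (not (K w)) ≡ b2ℕ (not (K⁺ w)) ℕ.+ δℕ w v
    split w with K w in Kw | eqb w v in wv
    ... | true  | false = refl
    ... | false | true  = refl
    ... | false | false = refl
    ... | true  | true  = case trans (≡-sym Kv) (cong not (trans (cong K (≡-sym (eqb⇒≡ w v wv))) Kw)) of λ ()
    card⁺ : card (not ∘ K) ≡ suc (card (not ∘ K⁺))
    card⁺ = trans (∑ℕ-cong split) (trans (∑ℕ-+ (λ w → b2ℕ (not (K⁺ w))) (λ w → δℕ w v)) (trans (cong (card (not ∘ K⁺) ℕ.+_) (∑ℕ-δ v)) (ℕ.+-comm (card (not ∘ K⁺)) 1)))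
    shrink : ∀ N → card (not ∘ K) ≡ N → Component H v₀
    shrink zero    N≡ = case trans (≡-sym card⁺) N≡ of λ ()
    shrink (suc N) N≡ = expand N K⁺ (ℕ.suc-injective (trans (≡-sym card⁺) N≡)) (cong (_∨ eqb v₀ v) base) reached⁺

-- Restriction to a component keeps all edges at its vertices and removes all others, so degrees
-- stay 0 or 2 while connectedness is gained.
component-cycle : (G : Graph n) (H : EdgeSet n) → Sym H → H ⊆ adj G → (∀ u → degE H u ≡ 0 ⊎ degE H u ≡ 2) →
  ∀ a b → H a b ≡ true → ∃ λ C → IsCycle G C × C ⊆ H
component-cycle {n} G H sym-H H⊆G deg02 a b ab = C , record
  { csym     = csym
  ; sub      = λ u v e → H⊆G u v (C⊆H u v e)
  ; nonempty = a , b , cong₂ _∧_ base ab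
  ; deg02    = deg02′
  ; conn     = λ u v u≢0 v≢0 → Reach-++ (Reach-sym csym (from-base (in-K u u≢0))) (from-base (in-K v v≢0))
  } , C⊆H
  where
  open Component (component H a)
  C : EdgeSet n
  C u v = K u ∧ H u v
  C⊆H : C ⊆ H
  C⊆H u v e = proj₂ (∧-true {K u} e)
  csym : Sym C
  csym u v with H u v in e | K u in Ku | K v in Kv
  ... | false | _     | _     = trans (∧-zeroʳ _) (≡-sym (trans (cong (_ ∧_) (trans (sym-H v u) e)) (∧-zeroʳ _)))
  ... | true  | true  | true  = ≡-sym (trans (sym-H v u) e)
  ... | true  | false | false = refl
  ... | true  | true  | false = case trans (≡-sym (closed u v e Ku)) Kv of λ ()
  ... | true  | false | true  = case trans (≡-sym (closed v u (trans (sym-H v u) e) Kv)) Ku of λ ()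
  deg02′ : ∀ u → degE C u ≡ 0 ⊎ degE C u ≡ 2
  deg02′ u with K u
  ... | true  = deg02 u
  ... | false = inj₁ (∑ℕ-zero {n})
  in-K : ∀ u → degE C u ≢ 0 → K u ≡ true
  in-K u ≢0 with K u
  ... | true  = refl
  ... | false = ⊥-elim (≢0 (∑ℕ-zero {n}))
  restrict : ∀ {u v} → K u ≡ true → Reach H u v → Reach C u v
  restrict Ku here                = here
  restrict Ku (step {u} {w} e p) = step (cong₂ _∧_ Ku e) (restrict (closed u w e Ku) p)
  from-base : ∀ {u} → K u ≡ true → Reach C a u
  from-base {u} Ku = restrict base (reached u Ku)

-- If C₁ and C₂ share a vertex but no vertex has degree 4, then C₁ and C₂ share an edge there, and
-- their symmetric difference has all degrees 0 or 2 and hence contains a third cycle.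
twoCycles-noShare : (G : Graph n) {C₁ C₂ : EdgeSet n} → IsCycle G C₁ → IsCycle G C₂ → ¬ SameEdges C₁ C₂ →
  (∀ C → IsCycle G C → SameEdges C C₁ ⊎ SameEdges C C₂) → NoShare C₁ C₂
twoCycles-noShare {n} G {C₁} {C₂} cyc₁ cyc₂ distinct only E C₁⊆E C₂⊆E deg≤3 z z₁ z₂ = contradiction (search₂ H)
  where
  module C₁ = IsCycle cyc₁
  module C₂ = IsCycle cyc₂
  H I : EdgeSet n
  H u v = C₁ u v xor C₂ u v
  I u v = C₁ u v ∧ C₂ u v

  degrees : ∀ u → degE H u ℕ.+ (degE I u ℕ.+ degE I u) ≡ degE C₁ u ℕ.+ degE C₂ u
  degrees u = begin
    degE H u ℕ.+ (degE I u ℕ.+ degE I u)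
      ≡⟨ trans (∑ℕ-+ (λ v → b2ℕ (H u v)) _) (cong (degE H u ℕ.+_) (∑ℕ-+ (λ v → b2ℕ (I u v)) (λ v → b2ℕ (I u v)))) ⟨
    ∑ℕ (λ v → b2ℕ (H u v) ℕ.+ (b2ℕ (I u v) ℕ.+ b2ℕ (I u v)))
      ≡⟨ ∑ℕ-cong (λ v → table (C₁ u v) (C₂ u v)) ⟩
    ∑ℕ (λ v → b2ℕ (C₁ u v) ℕ.+ b2ℕ (C₂ u v))
      ≡⟨ ∑ℕ-+ (λ v → b2ℕ (C₁ u v)) (λ v → b2ℕ (C₂ u v)) ⟩
    degE C₁ u ℕ.+ degE C₂ u ∎
    where
    open ≡-Reasoning
    table : ∀ a b → b2ℕ (a xor b) ℕ.+ (b2ℕ (a ∧ b) ℕ.+ b2ℕ (a ∧ b)) ≡ b2ℕ a ℕ.+ b2ℕ b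
    table true  true  = refl
    table true  false = refl
    table false true  = refl
    table false false = refl

  -- Inclusion and exclusion for the neighbourhoods of `u` in `C₁` and `C₂`, whose union lies in
  -- that of `E`.
  union : ∀ u → degE C₁ u ℕ.+ degE C₂ u ≤ degE E u ℕ.+ degE I u
  union u = subst₂ _≤_ (∑ℕ-+ (λ v → b2ℕ (C₁ u v)) (λ v → b2ℕ (C₂ u v))) (∑ℕ-+ (λ v → b2ℕ (E u v)) (λ v → b2ℕ (I u v))) (∑ℕ-mono single)
    where
    single : ∀ v → b2ℕ (C₁ u v) ℕ.+ b2ℕ (C₂ u v) ≤ b2ℕ (E u v) ℕ.+ b2ℕ (I u v)
    single v with C₁ u v in e₁ | C₂ u v in e₂
    ... | false | false = z≤n
    ... | true  | false = ℕ.≤-trans (ℕ.≤-reflexive (≡-sym (cong b2ℕ (C₁⊆E u v e₁)))) (ℕ.m≤m+n _ _)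
    ... | false | true  = ℕ.≤-trans (ℕ.≤-reflexive (≡-sym (cong b2ℕ (C₂⊆E u v e₂)))) (ℕ.m≤m+n _ _)
    ... | true  | true  = ℕ.+-monoˡ-≤ 1 (ℕ.≤-reflexive (≡-sym (cong b2ℕ (C₁⊆E u v e₁))))

  shared-edge : ∀ u → degE C₁ u ≡ 2 → degE C₂ u ≡ 2 → 1 ≤ degE I u
  shared-edge u d₁ d₂ = ℕ.+-cancelˡ-≤ 3 1 (degE I u) (begin
    4
      ≡⟨ cong₂ ℕ._+_ d₁ d₂ ⟨
    degE C₁ u ℕ.+ degE C₂ u
      ≤⟨ union u ⟩
    degE E u ℕ.+ degE I u
      ≤⟨ ℕ.+-monoˡ-≤ (degE I u) (deg≤3 u) ⟩
    3 ℕ.+ degE I u ∎)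
    where open ℕ.≤-Reasoning

  I≤₁ : ∀ u → degE I u ≤ degE C₁ u
  I≤₁ = degE-mono (λ u v e → proj₁ (∧-true e))

  I≤₂ : ∀ u → degE I u ≤ degE C₂ u
  I≤₂ = degE-mono (λ u v e → proj₂ (∧-true {C₁ u v} e))

  -- At a vertex of both cycles the degree is 4 - 2i with i common edges. Degree bound 3 forces i ≥
  -- 1, which excludes the value 4; elsewhere no edge is common and one cycle alone contributes.
  H-deg02 : ∀ u → degE H u ≡ 0 ⊎ degE H u ≡ 2
  H-deg02 u with C₁.deg02 u | C₂.deg02 u | degrees u
  ... | inj₁ d₁ | d₂      | e rewrite d₁ | ℕ.n≤0⇒n≡0 (subst (degE I u ≤_) d₁ (I≤₁ u)) | ℕ.+-identityʳ (degE H u) =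
    [ (λ d → inj₁ (trans e d)) , (λ d → inj₂ (trans e d)) ]′ d₂
  ... | inj₂ d₁ | inj₁ d₂ | e rewrite d₁ | d₂ | ℕ.n≤0⇒n≡0 (subst (degE I u ≤_) d₂ (I≤₂ u)) | ℕ.+-identityʳ (degE H u) = inj₂ e
  ... | inj₂ d₁ | inj₂ d₂ | e = parity (degE H u) (degE I u) (shared-edge u d₁ d₂) (trans e (cong₂ ℕ._+_ d₁ d₂))
    where
    parity : ∀ h i → 1 ≤ i → h ℕ.+ (i ℕ.+ i) ≡ 4 → h ≡ 0 ⊎ h ≡ 2
    parity h 1 _ e = inj₂ (ℕ.+-cancelʳ-≡ 2 h 2 e)
    parity h 2 _ e = inj₁ (ℕ.+-cancelʳ-≡ 4 h 0 e)
    parity h (suc (suc (suc i))) _ e = case ℕ.≤-trans (ℕ.≤-trans (ℕ.m≤n+m 5 (h ℕ.+ (i ℕ.+ i) ℕ.+ 1)) (ℕ.≤-reflexive (arith h i))) (ℕ.≤-reflexive e) of λ { (s≤s (s≤s (s≤s (s≤s ())))) }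
      where
      open ℕ-Solver using () renaming (solve to solveℕ; _:+_ to _⊹_; _:=_ to _≗_; con to conℕ)
      arith : ∀ h i → h ℕ.+ (i ℕ.+ i) ℕ.+ 1 ℕ.+ 5 ≡ h ℕ.+ (suc (suc (suc i)) ℕ.+ suc (suc (suc i)))
      arith = solveℕ 2 (λ h i → h ⊹ (i ⊹ i) ⊹ conℕ 1 ⊹ conℕ 5 ≗ h ⊹ ((conℕ 3 ⊹ i) ⊹ (conℕ 3 ⊹ i))) refl

  -- The symmetric difference omits common edges, whereas a cycle equal to `C₁` or `C₂` contains the
  -- common edge at `z`.
  no-common-edge : ∀ {C} → SameEdges C C₁ ⊎ SameEdges C C₂ → C ⊆ H → ∀ v → I z v ≡ true → ⊥
  no-common-edge {C} same C⊆H v e = clash (C₁ z v) (C₂ z v) e (C⊆H z v (in-C same))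
    where
    clash : ∀ a b → a ∧ b ≡ true → a xor b ≡ true → ⊥
    clash true true _ ()
    in-C : SameEdges C C₁ ⊎ SameEdges C C₂ → C z v ≡ true
    in-C (inj₁ same₁) = trans (same₁ z v) (proj₁ (∧-true e))
    in-C (inj₂ same₂) = trans (same₂ z v) (proj₂ (∧-true {C₁ z v} e))

  H⊆G : H ⊆ adj G
  H⊆G u v e with C₁ u v in e₁ | C₂ u v in e₂
  ... | true  | _    = C₁.sub u v e₁
  ... | false | true = C₂.sub u v e₂

  contradiction : (∃ λ a → ∃ λ b → H a b ≡ true) ⊎ (∀ u v → H u v ≡ false) → ⊥
  contradiction (inj₂ none) = distinct λ u v → same (C₁ u v) (C₂ u v) (none u v)
    where
    same : ∀ a b → a xor b ≡ false → a ≡ b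
    same true  true  _ = refl
    same false false _ = refl
  contradiction (inj₁ (a , b , ab)) =
    let C , cyc , C⊆H = component-cycle G H (λ u v → cong₂ _xor_ (C₁.csym u v) (C₂.csym u v)) H⊆G H-deg02 a b ab
        v , zv = neighbour I z (shared-edge z z₁ z₂)
    in no-common-edge (only C cyc) C⊆H v zv

-- The graph of two triangles joined by a path

-- Evaluates `f` with the smaller label first, as `adjP` does, so that lifting `edgeℕ n` gives
-- `adjP n` by computation.
symm : (ℕ → ℕ → Bool) → ℕ → ℕ → Bool
symm f a b = ((a <ᵇ b) ∧ f a b) ∨ ((b <ᵇ a) ∧ f b a)

lift : (ℕ → ℕ → Bool) → EdgeSet n
lift f u v = symm f (toℕ u) (toℕ v)

initial : ℕ → VertexSet n
initial k u = toℕ u <ᵇ k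

<⇒<ᵇ≡ : ∀ {a b} → a ℕ.< b → (a <ᵇ b) ≡ true
<⇒<ᵇ≡ a<b = True⇒≡ (ℕ.<⇒<ᵇ a<b)

≮⇒<ᵇ≡ : ∀ {a b} → ¬ (a ℕ.< b) → (a <ᵇ b) ≡ false
≮⇒<ᵇ≡ {a} {b} a≮b with a <ᵇ b in e
... | true  = ⊥-elim (a≮b (ℕ.<ᵇ⇒< a b (≡⇒True e)))
... | false = refl

<ᵇ≡⇒< : ∀ {a b} → (a <ᵇ b) ≡ true → a ℕ.< b
<ᵇ≡⇒< {a} {b} e = ℕ.<ᵇ⇒< a b (≡⇒True e)

≡ᵇ≡⇒≡ : ∀ {a b} → (a ≡ᵇ b) ≡ true → a ≡ b
≡ᵇ≡⇒≡ {a} {b} e = ℕ.≡ᵇ⇒≡ a b (≡⇒True e)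

module _ (f : ℕ → ℕ → Bool) where

  symm-< : ∀ {a b} → a ℕ.< b → symm f a b ≡ f a b
  symm-< {a} {b} a<b rewrite <⇒<ᵇ≡ a<b | ≮⇒<ᵇ≡ (ℕ.<-asym a<b) = ∨-identityʳ (f a b)

  symm-> : ∀ {a b} → b ℕ.< a → symm f a b ≡ f b a
  symm-> {a} {b} b<a rewrite <⇒<ᵇ≡ b<a | ≮⇒<ᵇ≡ (ℕ.<-asym b<a) = refl

  symm-diag : ∀ a → symm f a a ≡ false
  symm-diag a rewrite ≮⇒<ᵇ≡ (ℕ.<-irrefl {a} refl) = refl

  symm-comm : ∀ a b → symm f a b ≡ symm f b a
  symm-comm a b = ∨-comm ((a <ᵇ b) ∧ f a b) ((b <ᵇ a) ∧ f b a)

lift-sym : (f : ℕ → ℕ → Bool) → Sym (lift {n} f)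
lift-sym f u v = symm-comm f (toℕ u) (toℕ v)

private
  no-product : ∀ {a p b q} → ¬ (a ≡ p × b ≡ q) → b2ℕ (a ≡ᵇ p) ℕ.* b2ℕ (b ≡ᵇ q) ≡ 0
  no-product {a} {p} {b} {q} differ with a ≡ᵇ p in e | b ≡ᵇ q in e′
  ... | true  | true  = ⊥-elim (differ (≡ᵇ≡⇒≡ {a} e , ≡ᵇ≡⇒≡ {b} e′))
  ... | true  | false = refl
  ... | false | _     = refl

  disjoint-∨ : ∀ c A B → (A ∧ B ≡ true → c ≡ false) → b2ℕ (c ∨ (A ∧ B)) ≡ b2ℕ c ℕ.+ b2ℕ A ℕ.* b2ℕ B
  disjoint-∨ true  true  true  h = case h refl of λ ()
  disjoint-∨ true  true  false h = refl
  disjoint-∨ true  false B     h = refl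
  disjoint-∨ false true  true  h = refl
  disjoint-∨ false true  false h = refl
  disjoint-∨ false false B     h = refl

-- `p<q` records the orientation in which `symm` evaluates the new edge; `fresh` lets the
-- disjunction be counted as a sum.
record Extends (f g : ℕ → ℕ → Bool) (p q : ℕ) : Set where
  field
    p<q    : p ℕ.< q
    fresh  : f p q ≡ false
    extend : ∀ a b → g a b ≡ f a b ∨ ((a ≡ᵇ p) ∧ (b ≡ᵇ q))

extends-edge : ∀ {f g p q} → Extends f g p q → {x y : Fin n} → toℕ x ≡ q → toℕ y ≡ p → AddEdge (lift f) x y (lift g)
extends-edge {f = f} {g} {p} {q} ext refl refl u v = pointwise (toℕ u) (toℕ v)
  where
  open Extends ext
  open ≡-Reasoning
  new : ∀ a b → b2ℕ (g a b) ≡ b2ℕ (f a b) ℕ.+ b2ℕ (a ≡ᵇ p) ℕ.* b2ℕ (b ≡ᵇ q)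
  new a b = trans (cong b2ℕ (extend a b)) (disjoint-∨ (f a b) (a ≡ᵇ p) (b ≡ᵇ q)
    (λ e → trans (cong₂ f (≡ᵇ≡⇒≡ {a} (proj₁ (∧-true e))) (≡ᵇ≡⇒≡ {b} (proj₂ (∧-true {a ≡ᵇ p} e)))) fresh))
  pointwise : ∀ a b → b2ℕ (symm g a b) ≡ b2ℕ (symm f a b) ℕ.+ (b2ℕ (a ≡ᵇ q) ℕ.* b2ℕ (b ≡ᵇ p) ℕ.+ b2ℕ (a ≡ᵇ p) ℕ.* b2ℕ (b ≡ᵇ q))
  pointwise a b with ℕ.<-cmp a b
  ... | tri< a<b _ _ = begin
    b2ℕ (symm g a b)
      ≡⟨ cong b2ℕ (symm-< g a<b) ⟩
    b2ℕ (g a b)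
      ≡⟨ new a b ⟩
    b2ℕ (f a b) ℕ.+ b2ℕ (a ≡ᵇ p) ℕ.* b2ℕ (b ≡ᵇ q)
      ≡⟨ cong₂ (λ s t → b2ℕ s ℕ.+ (t ℕ.+ b2ℕ (a ≡ᵇ p) ℕ.* b2ℕ (b ≡ᵇ q))) (symm-< f a<b) (no-product {a} {q} {b} {p} (λ { (refl , refl) → ℕ.<-asym a<b p<q })) ⟨
    b2ℕ (symm f a b) ℕ.+ (b2ℕ (a ≡ᵇ q) ℕ.* b2ℕ (b ≡ᵇ p) ℕ.+ b2ℕ (a ≡ᵇ p) ℕ.* b2ℕ (b ≡ᵇ q)) ∎
  ... | tri> _ _ b<a = begin
    b2ℕ (symm g a b)
      ≡⟨ cong b2ℕ (symm-> g b<a) ⟩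
    b2ℕ (g b a)
      ≡⟨ new b a ⟩
    b2ℕ (f b a) ℕ.+ b2ℕ (b ≡ᵇ p) ℕ.* b2ℕ (a ≡ᵇ q)
      ≡⟨ cong (b2ℕ (f b a) ℕ.+_) (trans (ℕ.*-comm (b2ℕ (b ≡ᵇ p)) (b2ℕ (a ≡ᵇ q))) (≡-sym (ℕ.+-identityʳ _))) ⟩
    b2ℕ (f b a) ℕ.+ (b2ℕ (a ≡ᵇ q) ℕ.* b2ℕ (b ≡ᵇ p) ℕ.+ 0)
      ≡⟨ cong₂ (λ s t → b2ℕ s ℕ.+ (b2ℕ (a ≡ᵇ q) ℕ.* b2ℕ (b ≡ᵇ p) ℕ.+ t)) (symm-> f b<a) (no-product {a} {p} {b} {q} (λ { (refl , refl) → ℕ.<-asym b<a p<q })) ⟨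
    b2ℕ (symm f a b) ℕ.+ (b2ℕ (a ≡ᵇ q) ℕ.* b2ℕ (b ≡ᵇ p) ℕ.+ b2ℕ (a ≡ᵇ p) ℕ.* b2ℕ (b ≡ᵇ q)) ∎
  ... | tri≈ _ refl _ = begin
    b2ℕ (symm g a a)
      ≡⟨ cong b2ℕ (trans (symm-diag g a) (≡-sym (symm-diag f a))) ⟩
    b2ℕ (symm f a a)
      ≡⟨ ℕ.+-identityʳ _ ⟨
    b2ℕ (symm f a a) ℕ.+ 0
      ≡⟨ cong₂ (λ s t → b2ℕ (symm f a a) ℕ.+ (s ℕ.+ t)) (no-product {a} {q} {a} {p} (λ { (refl , e) → ℕ.<-irrefl (≡-sym e) p<q })) (no-product {a} {p} {a} {q} (λ { (refl , e) → ℕ.<-irrefl e p<q })) ⟨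
    b2ℕ (symm f a a) ℕ.+ (b2ℕ (a ≡ᵇ q) ℕ.* b2ℕ (a ≡ᵇ p) ℕ.+ b2ℕ (a ≡ᵇ p) ℕ.* b2ℕ (a ≡ᵇ q)) ∎

Below : (ℕ → ℕ → Bool) → ℕ → Set
Below f q = ∀ a b → f a b ≡ true → b ℕ.< q

lift-within : ∀ {f q} → Below f q → Within (lift {n} f) (initial q)
lift-within {f = f} {q} below u w e = <⇒<ᵇ≡ (bound (toℕ u) (toℕ w) e)
  where
  bound : ∀ a b → symm f a b ≡ true → a ℕ.< q
  bound a b e with ℕ.<-cmp a b
  ... | tri< a<b _ _  = ℕ.<-trans a<b (below a b (trans (≡-sym (symm-< f a<b)) e))
  ... | tri> _ _ b<a  = below b a (trans (≡-sym (symm-> f b<a)) e)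
  ... | tri≈ _ refl _ = case trans (≡-sym (symm-diag f a)) e of λ ()

<ᵇ-suc : ∀ a q → (a <ᵇ suc q) ≡ (a <ᵇ q) ∨ (a ≡ᵇ q)
<ᵇ-suc zero    zero    = refl
<ᵇ-suc zero    (suc q) = refl
<ᵇ-suc (suc a) zero    = refl
<ᵇ-suc (suc a) (suc q) = <ᵇ-suc a q

initial-suc : ∀ a q → b2ℕ (a <ᵇ suc q) ≡ b2ℕ (a <ᵇ q) ℕ.+ b2ℕ (a ≡ᵇ q)
initial-suc zero    zero    = refl
initial-suc zero    (suc q) = refl
initial-suc (suc a) zero    = refl
initial-suc (suc a) (suc q) = initial-suc a q

extends-leaf : ∀ {f g p q} → Extends f g p q → Below f q → {x y : Fin n} → toℕ x ≡ q → toℕ y ≡ p →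
  Leaf (initial (suc q)) (lift g) (initial q) (lift f) x y
extends-leaf {f = f} {g} {p} {q} ext below {x} {y} x≡ y≡ = record
  { edge    = extends-edge {f = f} {g} ext x≡ y≡
  ; vertex  = λ u → trans (initial-suc (toℕ u) q) (cong (λ t → b2ℕ (toℕ u <ᵇ q) ℕ.+ b2ℕ (toℕ u ≡ᵇ t)) (≡-sym x≡))
  ; anchor  = <⇒<ᵇ≡ (subst (ℕ._< q) (≡-sym y≡) (Extends.p<q ext))
  ; sym-E   = lift-sym g
  ; sym-E′  = lift-sym f
  ; within′ = lift-within {f = f} below
  }

-- The vertices 0, 1, 2 form the triangle, and 2, 3, …, j + 2 the tail.
triangle : ℕ → ℕ → Bool
triangle a b = ((a ≡ᵇ 0) ∧ (b ≡ᵇ 1)) ∨ ((a ≡ᵇ 0) ∧ (b ≡ᵇ 2)) ∨ ((a ≡ᵇ 1) ∧ (b ≡ᵇ 2))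

tadpole : ℕ → ℕ → ℕ → Bool
tadpole j a b = triangle a b ∨ ((b ≡ᵇ suc a) ∧ (2 ≤ᵇ a) ∧ (b ≤ᵇ (2 ℕ.+ j)))

with-edge : (ℕ → ℕ → Bool) → ℕ → ℕ → ℕ → ℕ → Bool
with-edge f p q a b = f a b ∨ ((a ≡ᵇ p) ∧ (b ≡ᵇ q))

below-with-edge : ∀ {f p q} → Below f q → Below (with-edge f p q) (suc q)
below-with-edge {f} {p} {q} below a b e with f a b in fab
... | true  = ℕ.m<n⇒m<1+n (below a b fab)
... | false = subst (ℕ._< suc q) (≡-sym (≡ᵇ≡⇒≡ {b} (proj₂ (∧-true {a ≡ᵇ p} e)))) (ℕ.n<1+n q)

below-fresh : ∀ f p q → Below f q → f p q ≡ false
below-fresh f p q below with f p q in e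
... | true  = ⊥-elim (ℕ.<-irrefl refl (below p q e))
... | false = refl

extends-with-edge : ∀ {f p q} → p ℕ.< q → Below f q → Extends f (with-edge f p q) p q
extends-with-edge {f} {p} {q} p<q below = record { p<q = p<q ; fresh = below-fresh f p q below ; extend = λ _ _ → refl }

tadpole-below : ∀ j → Below (tadpole j) (3 ℕ.+ j)
tadpole-below j a b e with b ≤ᵇ (2 ℕ.+ j) in b≤
... | true  = s≤s (ℕ.≤ᵇ⇒≤ b (2 ℕ.+ j) (≡⇒True b≤))
... | false = small a b (trans (≡-sym (trans (cong (triangle a b ∨_) (trans (cong ((b ≡ᵇ suc a) ∧_) (∧-zeroʳ (2 ≤ᵇ a))) (∧-zeroʳ (b ≡ᵇ suc a)))) (∨-identityʳ (triangle a b)))) e)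
  where
  small : ∀ a b → triangle a b ≡ true → b ℕ.< 3 ℕ.+ j
  small zero          1 _ = s≤s (s≤s z≤n)
  small zero          2 _ = s≤s (s≤s (s≤s z≤n))
  small (suc zero)    2 _ = s≤s (s≤s (s≤s z≤n))

tadpole-suc : ∀ j → Extends (tadpole j) (tadpole (suc j)) (2 ℕ.+ j) (3 ℕ.+ j)
tadpole-suc j = record { p<q = ℕ.n<1+n (2 ℕ.+ j) ; fresh = below-fresh (tadpole j) (2 ℕ.+ j) (3 ℕ.+ j) (tadpole-below j) ; extend = extend }
  where
  successor : ∀ a → (2 ≤ᵇ a) ∧ (suc a ≤ᵇ (3 ℕ.+ j)) ≡ ((2 ≤ᵇ a) ∧ (suc a ≤ᵇ (2 ℕ.+ j))) ∨ ((a ≡ᵇ (2 ℕ.+ j)) ∧ (suc a ≡ᵇ (3 ℕ.+ j)))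
  successor zero          = refl
  successor (suc zero)    = refl
  successor (suc (suc a)) = trans (<ᵇ-suc a j) (cong ((a <ᵇ j) ∨_) (≡-sym (∧-idem (a ≡ᵇ j))))
  path-part : ∀ a b → (b ≡ᵇ suc a) ∧ (2 ≤ᵇ a) ∧ (b ≤ᵇ (3 ℕ.+ j)) ≡ ((b ≡ᵇ suc a) ∧ (2 ≤ᵇ a) ∧ (b ≤ᵇ (2 ℕ.+ j))) ∨ ((a ≡ᵇ (2 ℕ.+ j)) ∧ (b ≡ᵇ (3 ℕ.+ j)))
  path-part a b with b ≡ᵇ suc a in e
  ... | true rewrite ≡ᵇ≡⇒≡ {b} e = successor a
  ... | false = ≡-sym (absent (a ≡ᵇ (2 ℕ.+ j)) refl)
    where
    absent : ∀ c → (a ≡ᵇ (2 ℕ.+ j)) ≡ c → c ∧ (b ≡ᵇ (3 ℕ.+ j)) ≡ false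
    absent false _  = refl
    absent true  e′ = trans (cong (λ t → b ≡ᵇ suc t) (≡-sym (≡ᵇ≡⇒≡ {a} e′))) e
  extend : ∀ a b → tadpole (suc j) a b ≡ tadpole j a b ∨ ((a ≡ᵇ (2 ℕ.+ j)) ∧ (b ≡ᵇ (3 ℕ.+ j)))
  extend a b = trans (cong (triangle a b ∨_) (path-part a b)) (≡-sym (∨-assoc (triangle a b) ((b ≡ᵇ suc a) ∧ (2 ≤ᵇ a) ∧ (b ≤ᵇ (2 ℕ.+ j))) ((a ≡ᵇ (2 ℕ.+ j)) ∧ (b ≡ᵇ (3 ℕ.+ j)))))

Euler-edge-up : ∀ {c} {S : VertexSet n} {T E : EdgeSet n} {a b} → AddEdge T a b E → Euler c S T → Euler (suc c) S E
Euler-edge-up {c = c} {S} {T} {E} add euler = begin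
  vol E ℕ.+ 2
    ≡⟨ cong (ℕ._+ 2) (vol-edge {E′ = T} {E = E} add) ⟩
  vol T ℕ.+ 2 ℕ.+ 2
    ≡⟨ cong (ℕ._+ 2) euler ⟩
  2 ℕ.* (card S ℕ.+ c) ℕ.+ 2
    ≡⟨ ℕ.+-comm (2 ℕ.* (card S ℕ.+ c)) 2 ⟩
  2 ℕ.+ 2 ℕ.* (card S ℕ.+ c)
    ≡⟨ ℕ.*-suc 2 (card S ℕ.+ c) ⟨
  2 ℕ.* suc (card S ℕ.+ c)
    ≡⟨ cong (2 ℕ.*_) (ℕ.+-suc (card S) c) ⟨
  2 ℕ.* (card S ℕ.+ suc c) ∎
  where open ≡-Reasoning

private
  -- Here `a`, `b`, `d` are the deltas at the middle, the base and the end of a path of length 2,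
  -- and the three summands are the edges of the triangle that it closes to.
  degree-sum₁ : ∀ {a b d} → a ≡ 1 → b ≡ 0 → d ≡ 0 → (a ℕ.+ b) ℕ.+ (d ℕ.+ a) ℕ.+ (d ℕ.+ b) ≡ 2
  degree-sum₁ refl refl refl = refl

  degree-sum₂ : ∀ {a b d} → a ≡ 0 → b ≡ 0 → d ≡ 1 → (a ℕ.+ b) ℕ.+ (d ℕ.+ a) ℕ.+ (d ℕ.+ b) ≡ 2
  degree-sum₂ refl refl refl = refl

-- Keeping n a variable prevents the sums over Fin n from unfolding.
module TwoTriangles (n m : ℕ) (n≡ : n ≡ 5 ℕ.+ m) where

  private
    V : Set
    V = Fin n

    at : ∀ {k} → k ℕ.< 5 ℕ.+ m → V
    at {k} k< = fromℕ< (subst (k ℕ.<_) (≡-sym n≡) k<)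

    toℕ-at : ∀ {k} (k< : k ℕ.< 5 ℕ.+ m) → toℕ (at k<) ≡ k
    toℕ-at {k} k< = Fin.toℕ-fromℕ< (subst (k ℕ.<_) (≡-sym n≡) k<)

    f₀ f₁ f₂ : ℕ → ℕ → Bool
    f₀ _ _ = false
    f₁ = with-edge f₀ 0 1
    f₂ = with-edge f₁ 1 2

    below₀ : Below f₀ 1
    below₀ _ _ ()
    below₁ : Below f₁ 2
    below₁ = below-with-edge {f₀} below₀

    p₀ : 0 ℕ.< 5 ℕ.+ m
    p₀ = s≤s z≤n
    p₁ : 1 ℕ.< 5 ℕ.+ m
    p₁ = s≤s (s≤s z≤n)
    p₂ : 2 ℕ.< 5 ℕ.+ m
    p₂ = s≤s (s≤s (s≤s z≤n))

    v₀ v₁ v₂ : V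
    v₀ = at p₀
    v₁ = at p₁
    v₂ = at p₂

    apart : ∀ {j k} (j< : j ℕ.< 5 ℕ.+ m) (k< : k ℕ.< 5 ℕ.+ m) → j ≢ k → at j< ≢ at k<
    apart j< k< j≢k e = j≢k (trans (≡-sym (toℕ-at j<)) (trans (cong toℕ e) (toℕ-at k<)))

    leaf₁ : Leaf (initial 2) (lift f₁) (initial 1) (lift f₀) v₁ v₀
    leaf₁ = extends-leaf (extends-with-edge {f₀} (s≤s z≤n) below₀) below₀ (toℕ-at p₁) (toℕ-at p₀)

    leaf₂ : Leaf (initial 3) (lift f₂) (initial 2) (lift f₁) v₂ v₁
    leaf₂ = extends-leaf (extends-with-edge {f₁} (s≤s (s≤s z≤n)) below₁) below₁ (toℕ-at p₂) (toℕ-at p₁)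

    -- The path 0, 1, 2 is built first and the edge between 0 and 2 last, which presents the
    -- triangle as a closed path of length 2.
    closes : Extends f₂ (tadpole 0) 0 2
    closes = record { p<q = s≤s z≤n ; fresh = refl ; extend = extend }
      where
      extend : ∀ a b → tadpole 0 a b ≡ f₂ a b ∨ ((a ≡ᵇ 0) ∧ (b ≡ᵇ 2))
      extend a b = trans (cong (triangle a b ∨_) (no-path a b))
        (B.solve 3 (λ p q r → (p B.:+ (q B.:+ r)) B.:+ B.con false B.:= (p B.:+ r) B.:+ q) refl ((a ≡ᵇ 0) ∧ (b ≡ᵇ 1)) ((a ≡ᵇ 0) ∧ (b ≡ᵇ 2)) ((a ≡ᵇ 1) ∧ (b ≡ᵇ 2)))
        where
        no-path : ∀ a b → (b ≡ᵇ suc a) ∧ (2 ≤ᵇ a) ∧ (b ≤ᵇ 2) ≡ false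
        no-path zero          b = ∧-zeroʳ (b ≡ᵇ 1)
        no-path (suc zero)    b = ∧-zeroʳ (b ≡ᵇ 2)
        no-path (suc (suc a)) 0 = refl
        no-path (suc (suc a)) 1 = refl
        no-path (suc (suc a)) 2 = refl
        no-path (suc (suc a)) (suc (suc (suc b))) = ∧-zeroʳ (b ≡ᵇ a)

    chord : AddEdge {n} (lift f₂) v₂ v₀ (lift (tadpole 0))
    chord = extends-edge {f = f₂} {tadpole 0} closes (toℕ-at p₂) (toℕ-at p₀)

    degree₀ : ∀ (u : V) → degE (lift f₀) u ≡ 0
    degree₀ u = trans (∑ℕ-cong {n} (λ v → none (toℕ u) (toℕ v))) (∑ℕ-zero {n})
      where
      none : ∀ a b → b2ℕ (symm f₀ a b) ≡ 0
      none a b rewrite ∧-zeroʳ (a <ᵇ b) | ∧-zeroʳ (b <ᵇ a) = refl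

    triangle-degree : ∀ (u : V) → degE (lift (tadpole 0)) u ≡ (δℕ u v₁ ℕ.+ δℕ u v₀) ℕ.+ (δℕ u v₂ ℕ.+ δℕ u v₁) ℕ.+ (δℕ u v₂ ℕ.+ δℕ u v₀)
    triangle-degree u = trans (deg-edge {E′ = lift f₂} {E = lift (tadpole 0)} chord u) (cong (ℕ._+ (δℕ u v₂ ℕ.+ δℕ u v₀))
      (trans (deg-edge {E′ = lift f₁} {E = lift f₂} (Leaf.edge leaf₂) u) (cong (ℕ._+ (δℕ u v₂ ℕ.+ δℕ u v₁))
        (trans (deg-edge {E′ = lift f₀} {E = lift f₁} (Leaf.edge leaf₁) u) (cong (ℕ._+ (δℕ u v₁ ℕ.+ δℕ u v₀)) (degree₀ u))))))

    triangle-chain : Chain (degE (lift (tadpole 0))) (initial 1) (lift f₀) v₀ (initial 3) (lift f₂) v₂ 2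
    triangle-chain = grow leaf₂ degree₂ (grow leaf₁ degree₁ (stop (lift-sym f₀) (Leaf.anchor leaf₁)))
      where
      degree₁ : degE (lift (tadpole 0)) v₁ ≡ 2
      degree₁ = trans (triangle-degree v₁) (degree-sum₁ (δℕ-refl v₁) (δℕ-≢ (apart p₁ p₀ λ ())) (δℕ-≢ (apart p₁ p₂ λ ())))
      degree₂ : degE (lift (tadpole 0)) v₂ ≡ 2
      degree₂ = trans (triangle-degree v₂) (degree-sum₂ (δℕ-≢ (apart p₂ p₁ λ ())) (δℕ-≢ (apart p₂ p₀ λ ())) (δℕ-refl v₂))

    only-v₀ : ∀ (z : V) → initial 1 z ≡ true → z ≡ v₀
    only-v₀ z z∈ = Fin.toℕ-injective (trans (ℕ.n<1⇒n≡0 (<ᵇ≡⇒< z∈)) (≡-sym (toℕ-at p₀)))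

    euler₀ : Euler 0 (initial {n} 1) (lift f₀)
    euler₀ = trans (cong (ℕ._+ 2) (trans (∑ℕ-cong {n} degree₀) (∑ℕ-zero {n}))) (cong (λ t → 2 ℕ.* (t ℕ.+ 0)) (≡-sym (card-singleton {S = initial 1} {v₀} (Leaf.anchor leaf₁) only-v₀)))

    euler-triangle : Euler 1 (initial {n} 3) (lift (tadpole 0))
    euler-triangle = Euler-edge-up {T = lift f₂} {E = lift (tadpole 0)} chord (Euler-up leaf₂ (Euler-up leaf₁ euler₀))

    triangle-level₁ : ∀ {r} → Resistance (initial {n} 3) (lift (tadpole 0)) r → Exact level₁ (initial 3) (lift (tadpole 0)) r v₂
    triangle-level₁ res = ClosedCycle.triangle-exact {T = lift f₂} triangle-chain chord (lift-sym (tadpole 0))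
      euler-triangle (lift-sym f₀) (lift-within {f = f₀} below₀) (Leaf.anchor leaf₁) only-v₀ res refl

    tail : ∀ j (k< : 2 ℕ.+ j ℕ.< 5 ℕ.+ m) → Chain (λ _ → 2) (initial 3) (lift (tadpole 0)) v₂ (initial (3 ℕ.+ j)) (lift (tadpole j)) (at k<) j
    tail zero    _  = stop (lift-sym (tadpole 0)) (Leaf.leaf∈ leaf₂)
    tail (suc j) k< = grow (extends-leaf (tadpole-suc j) (tadpole-below j) (toℕ-at k<) (toℕ-at (ℕ.<⇒≤ k<))) refl (tail j (ℕ.<⇒≤ k<))

    q₂ : 2 ℕ.+ m ℕ.< 5 ℕ.+ m
    q₂ = ℕ.m≤n+m (3 ℕ.+ m) 2
    q₃ : 3 ℕ.+ m ℕ.< 5 ℕ.+ m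
    q₃ = ℕ.m≤n+m (4 ℕ.+ m) 1
    q₄ : 4 ℕ.+ m ℕ.< 5 ℕ.+ m
    q₄ = ℕ.≤-refl

    x y c : V
    y = at q₂
    x = at q₃
    c = at q₄

    g₃ g₄ gₚ : ℕ → ℕ → Bool
    g₃ = with-edge (tadpole m) (2 ℕ.+ m) (3 ℕ.+ m)
    g₄ = with-edge g₃ (3 ℕ.+ m) (4 ℕ.+ m)
    gₚ = edgeℕ (5 ℕ.+ m)

    below₃ : Below g₃ (4 ℕ.+ m)
    below₃ = below-with-edge {tadpole m} (tadpole-below m)

    leaf₃ : Leaf (initial (4 ℕ.+ m)) (lift g₃) (initial (3 ℕ.+ m)) (lift (tadpole m)) x y
    leaf₃ = extends-leaf (extends-with-edge {tadpole m} (ℕ.n<1+n (2 ℕ.+ m)) (tadpole-below m)) (tadpole-below m) (toℕ-at q₃) (toℕ-at q₂)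

    leaf₄ : Leaf (initial (5 ℕ.+ m)) (lift g₄) (initial (4 ℕ.+ m)) (lift g₃) c x
    leaf₄ = extends-leaf (extends-with-edge {g₃} (ℕ.n<1+n (3 ℕ.+ m)) below₃) below₃ (toℕ-at q₄) (toℕ-at q₃)

    T E : EdgeSet n
    T = lift g₄
    E = lift gₚ

    closesₚ : Extends g₄ gₚ (2 ℕ.+ m) (4 ℕ.+ m)
    closesₚ = record { p<q = ℕ.m<n⇒m<1+n (ℕ.n<1+n (2 ℕ.+ m)) ; fresh = fresh ; extend = extend }
      where
      ≢-suc : ∀ k → (k ≡ᵇ suc k) ≡ false
      ≢-suc zero    = refl
      ≢-suc (suc k) = ≢-suc k
      fresh : g₄ (2 ℕ.+ m) (4 ℕ.+ m) ≡ false
      fresh = cong₂ _∨_ (below-fresh g₃ (2 ℕ.+ m) (4 ℕ.+ m) below₃) (cong (_∧ (m ≡ᵇ m)) (≢-suc m))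
      extend : ∀ a b → gₚ a b ≡ g₄ a b ∨ ((a ≡ᵇ (2 ℕ.+ m)) ∧ (b ≡ᵇ (4 ℕ.+ m)))
      -- For `5 + m` vertices the labels n - 3, n - 2, n - 1 compute to m + 2, m + 3, m + 4, so both
      -- sides are disjunctions of the same seven tests.
      extend a b = B.solve 7 (λ p q r s t u v → (p B.:+ (q B.:+ (r B.:+ (s B.:+ (t B.:+ (u B.:+ v)))))) B.:= ((((p B.:+ (q B.:+ r)) B.:+ v) B.:+ s) B.:+ u) B.:+ t) refl
        ((a ≡ᵇ 0) ∧ (b ≡ᵇ 1)) ((a ≡ᵇ 0) ∧ (b ≡ᵇ 2)) ((a ≡ᵇ 1) ∧ (b ≡ᵇ 2))
        ((a ≡ᵇ (2 ℕ.+ m)) ∧ (b ≡ᵇ (3 ℕ.+ m))) ((a ≡ᵇ (2 ℕ.+ m)) ∧ (b ≡ᵇ (4 ℕ.+ m))) ((a ≡ᵇ (3 ℕ.+ m)) ∧ (b ≡ᵇ (4 ℕ.+ m)))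
        ((b ≡ᵇ suc a) ∧ (2 ≤ᵇ a) ∧ (b ≤ᵇ (2 ℕ.+ m)))

    add : AddEdge T c y E
    add = extends-edge {f = g₄} {gₚ} closesₚ (toℕ-at q₄) (toℕ-at q₂)

    3≢2 : 3 ℕ.+ m ≢ 2 ℕ.+ m
    3≢2 = ℕ.1+n≢n
    4≢3 : 4 ℕ.+ m ≢ 3 ℕ.+ m
    4≢3 = ℕ.1+n≢n
    4≢2 : 4 ℕ.+ m ≢ 2 ℕ.+ m
    4≢2 e = ℕ.<-irrefl (≡-sym e) (ℕ.m<n⇒m<1+n (ℕ.n<1+n (2 ℕ.+ m)))

    top-degree : ∀ u → initial (3 ℕ.+ m) u ≡ false → degE E u ≡ (δℕ u x ℕ.+ δℕ u y) ℕ.+ (δℕ u c ℕ.+ δℕ u x) ℕ.+ (δℕ u c ℕ.+ δℕ u y)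
    top-degree u u∉ = trans (deg-edge {E′ = T} {E = E} add u) (cong (ℕ._+ (δℕ u c ℕ.+ δℕ u y))
      (trans (deg-edge {E′ = lift g₃} {E = T} (Leaf.edge leaf₄) u) (cong (ℕ._+ (δℕ u c ℕ.+ δℕ u x))
        (trans (deg-edge {E′ = lift (tadpole m)} {E = lift g₃} (Leaf.edge leaf₃) u) (cong (ℕ._+ (δℕ u x ℕ.+ δℕ u y))
          (degE-outside {S = initial (3 ℕ.+ m)} (lift-within {f = tadpole m} (tadpole-below m)) u u∉))))))

    x∉ : initial (3 ℕ.+ m) x ≡ false
    x∉ = Leaf.leaf∉ leaf₃
    c∉ : initial (3 ℕ.+ m) c ≡ false
    c∉ = ≮⇒<ᵇ≡ (λ lt → ℕ.<-asym (subst (ℕ._< 3 ℕ.+ m) (toℕ-at q₄) lt) (ℕ.n<1+n (3 ℕ.+ m)))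

    degree-c : degE E c ≡ 2
    degree-c = trans (top-degree c c∉) (degree-sum₂ (δℕ-≢ (apart q₄ q₃ 4≢3)) (δℕ-≢ (apart q₄ q₂ 4≢2)) (δℕ-refl c))

    degree-x : degE E x ≡ 2
    degree-x = trans (top-degree x x∉) (degree-sum₁ (δℕ-refl x) (δℕ-≢ (apart q₃ q₂ 3≢2)) (δℕ-≢ (apart q₃ q₄ (4≢3 ∘ ≡-sym))))

    end-chain : Chain (degE E) (initial (3 ℕ.+ m)) (lift (tadpole m)) y (initial (5 ℕ.+ m)) T c 2
    end-chain = grow leaf₄ degree-c (grow leaf₃ degree-x (stop (lift-sym (tadpole m)) (Leaf.anchor leaf₃)))

    -- The network `T` is read in two ways. From the first triangle it is one tail of length m + 2
    -- ending in `c`, which carries exactness from the triangle to `c`; in `end-chain` its last two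
    -- edges are the path that closes to the second triangle.
    long-chain : Chain (λ _ → 2) (initial 3) (lift (tadpole 0)) v₂ (initial (5 ℕ.+ m)) T c (2 ℕ.+ m)
    long-chain = grow leaf₄ refl (grow leaf₃ refl (tail m q₂))

    euler : Euler 2 (initial (5 ℕ.+ m)) E
    euler = Euler-edge-up {T = T} {E = E} add (Chain-Euler-up long-chain euler-triangle)

  twoTriangles-total : ∀ {r} → Resistance (initial (5 ℕ.+ m)) (lift (edgeℕ (5 ℕ.+ m))) r →
    total (initial (5 ℕ.+ m)) (lift (edgeℕ (5 ℕ.+ m))) r ≡ Level.totalMax level₂ (ι (card (initial {n} (5 ℕ.+ m))))
  twoTriangles-total {r} res = ClosedSecond.total-exact {T = T} end-chain add (lift-sym gₚ) euler res refl (Exact.dist-≡ ex) (Exact.total-≡ ex)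
    where
    module Closed′ = ClosedChain {T = T} end-chain add (lift-sym gₚ) {cyc = 2} euler res
    ex : Exact level₁ (initial (5 ℕ.+ m)) T Closed′.rT c
    ex = Chain-exact level₁ euler-triangle long-chain Closed′.resT (triangle-level₁ (Chain-resistance long-chain Closed′.resT))

-- The degree resistance distance

card-all : {S : VertexSet n} → (∀ u → S u ≡ true) → card S ≡ n
card-all {n} {S} all = trans (∑ℕ-cong (λ u → cong b2ℕ (all u))) (ones n)
  where
  ones : ∀ k → ∑ℕ {k} (λ _ → 1) ≡ k
  ones zero    = refl
  ones (suc k) = cong suc (ones k)

module _ (G : Graph n) where

  private
    lower : Fin n → Fin n → Bool
    lower u v = toℕ u <ᵇ toℕ v

    degree-split : ∀ u v → b2ℕ (adj G u v) ≡ b2ℕ (lower u v ∧ adj G u v) ℕ.+ b2ℕ (lower v u ∧ adj G v u)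
    degree-split u v with ℕ.<-cmp (toℕ u) (toℕ v)
    ... | tri< u<v _ _ rewrite <⇒<ᵇ≡ u<v | ≮⇒<ᵇ≡ (ℕ.<-asym u<v) = ≡-sym (ℕ.+-identityʳ _)
    ... | tri> _ _ v<u rewrite <⇒<ᵇ≡ v<u | ≮⇒<ᵇ≡ (ℕ.<-asym v<u) = cong b2ℕ (Graph.sym G u v)
    ... | tri≈ _ e _ rewrite Fin.toℕ-injective e | irrefl G v | ∧-zeroʳ (lower v v) = refl

  handshake : vol (adj G) ≡ edgeCount G ℕ.+ edgeCount G
  handshake = begin
    ∑ℕ (λ u → ∑ℕ (λ v → b2ℕ (adj G u v)))
      ≡⟨ ∑ℕ-cong (λ u → trans (∑ℕ-cong (degree-split u)) (∑ℕ-+ (λ v → b2ℕ (lower u v ∧ adj G u v)) (λ v → b2ℕ (lower v u ∧ adj G v u)))) ⟩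
    ∑ℕ (λ u → ∑ℕ (λ v → b2ℕ (lower u v ∧ adj G u v)) ℕ.+ ∑ℕ (λ v → b2ℕ (lower v u ∧ adj G v u)))
      ≡⟨ ∑ℕ-+ (λ u → ∑ℕ (λ v → b2ℕ (lower u v ∧ adj G u v))) (λ u → ∑ℕ (λ v → b2ℕ (lower v u ∧ adj G v u))) ⟩
    edgeCount G ℕ.+ ∑ℕ (λ u → ∑ℕ (λ v → b2ℕ (lower v u ∧ adj G v u)))
      ≡⟨ cong (edgeCount G ℕ.+_) (∑ℕ-swap (λ u v → b2ℕ (lower v u ∧ adj G v u))) ⟩
    edgeCount G ℕ.+ edgeCount G ∎
    where open ≡-Reasoning

  graph-simple : ∀ {S} → (∀ u → S u ≡ true) → Simple S (adj G)
  graph-simple all = record { sym-E = Graph.sym G ; within = λ u _ _ → all u ; loopless = irrefl G }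

  graph-net : ∀ {S k} → (∀ u → S u ≡ true) → n ≡ suc k → Bicyclic G → Net 2 S (adj G)
  graph-net {S} {k} all n≡ (connected , edges) = record
    { simple = graph-simple all
    ; joined = λ P closed u v _ _ → along P closed (connected u v)
    ; euler  = trans (cong (ℕ._+ 2) (trans handshake (cong₂ ℕ._+_ edges edges))) count
    ; root   = first , all first
    }
    where
    first : Fin n
    first = subst Fin (≡-sym n≡) zero
    along : ∀ P → Closed (adj G) P → ∀ {u v} → Reach (adj G) u v → P u ≡ P v
    along P closed here       = refl
    along P closed (step e p) = trans (closed _ _ e) (along P closed p)
    count : suc n ℕ.+ suc n ℕ.+ 2 ≡ 2 ℕ.* (card S ℕ.+ 2)
    count = trans (arith n) (cong (λ t → 2 ℕ.* (t ℕ.+ 2)) (≡-sym (card-all all)))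
      where
      open ℕ-Solver using () renaming (solve to solveℕ; _:+_ to _⊹_; _:*_ to _⋆_; _:=_ to _≗_; con to conℕ)
      arith : ∀ n → suc n ℕ.+ suc n ℕ.+ 2 ≡ 2 ℕ.* (n ℕ.+ 2)
      arith = solveℕ 1 (λ n → (conℕ 1 ⊹ n) ⊹ (conℕ 1 ⊹ n) ⊹ conℕ 2 ≗ conℕ 2 ⋆ (n ⊹ conℕ 2)) refl

  -- The term with d(u) and the term with d(v) are separated and the names exchanged in the second.
  -- By symmetry of `r` the two halves fill the ordered pairs above and below the diagonal, where
  -- `r` vanishes.
  DR-total : ∀ {S r} → (∀ u → S u ≡ true) → IsResistance G r → DR G r ≡ total S (adj G) r
  DR-total {S} {r} all isR = begin
    ∑ (λ u → ∑ (λ v → b2ℚ (lower u v) * (ι (deg G u ℕ.+ deg G v) * r u v)))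
      ≡⟨ ∑-cong (λ u → trans (∑-cong (λ v → trans (cong (λ d → b2ℚ (lower u v) * (d * r u v)) (ι-+ (deg G u) (deg G v)))
           (solve 4 (λ b d d′ r → b :* ((d :+ d′) :* r) := b :* (d :* r) :+ b :* (d′ :* r)) refl (b2ℚ (lower u v)) (ι (deg G u)) (ι (deg G v)) (r u v))))
           (∑-+ (λ v → b2ℚ (lower u v) * (ι (deg G u) * r u v)) (λ v → b2ℚ (lower u v) * (ι (deg G v) * r u v)))) ⟩
    ∑ (λ u → ∑ (λ v → b2ℚ (lower u v) * (ι (deg G u) * r u v)) + ∑ (λ v → b2ℚ (lower u v) * (ι (deg G v) * r u v)))
      ≡⟨ ∑-+ (λ u → ∑ (λ v → b2ℚ (lower u v) * (ι (deg G u) * r u v))) (λ u → ∑ (λ v → b2ℚ (lower u v) * (ι (deg G v) * r u v))) ⟩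
    ∑ (λ u → ∑ (λ v → b2ℚ (lower u v) * (ι (deg G u) * r u v))) + ∑ (λ u → ∑ (λ v → b2ℚ (lower u v) * (ι (deg G v) * r u v)))
      ≡⟨ cong (λ t → ∑ (λ u → ∑ (λ v → b2ℚ (lower u v) * (ι (deg G u) * r u v))) + t) (∑-swap (λ u v → b2ℚ (lower u v) * (ι (deg G v) * r u v))) ⟩
    ∑ (λ u → ∑ (λ v → b2ℚ (lower u v) * (ι (deg G u) * r u v))) + ∑ (λ u → ∑ (λ v → b2ℚ (lower v u) * (ι (deg G u) * r v u)))
      ≡⟨ ∑-+ (λ u → ∑ (λ v → b2ℚ (lower u v) * (ι (deg G u) * r u v))) (λ u → ∑ (λ v → b2ℚ (lower v u) * (ι (deg G u) * r v u))) ⟨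
    ∑ (λ u → ∑ (λ v → b2ℚ (lower u v) * (ι (deg G u) * r u v)) + ∑ (λ v → b2ℚ (lower v u) * (ι (deg G u) * r v u)))
      ≡⟨ ∑-cong (λ u → trans (≡-sym (∑-+ (λ v → b2ℚ (lower u v) * (ι (deg G u) * r u v)) (λ v → b2ℚ (lower v u) * (ι (deg G u) * r v u))))
           (trans (∑-cong (merge u)) (∑-*ˡ (ι (deg G u)) (λ v → b2ℚ (S v) * r u v)))) ⟩
    total S (adj G) r ∎
    where
    open ≡-Reasoning
    res : Resistance S (adj G) r
    res u v _ _ = isR u v
    merge : ∀ u v → b2ℚ (lower u v) * (ι (deg G u) * r u v) + b2ℚ (lower v u) * (ι (deg G u) * r v u) ≡ ι (deg G u) * (b2ℚ (S v) * r u v)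
    merge u v rewrite all v = by-order (ℕ.<-cmp (toℕ u) (toℕ v))
      where
      d = ι (deg G u)
      by-order : _ → b2ℚ (lower u v) * (d * r u v) + b2ℚ (lower v u) * (d * r v u) ≡ d * (1ℚ * r u v)
      by-order (tri< u<v _ _) = trans (cong₂ (λ p q → b2ℚ p * (d * r u v) + b2ℚ q * (d * r v u)) (<⇒<ᵇ≡ u<v) (≮⇒<ᵇ≡ (ℕ.<-asym u<v)))
        (solve 3 (λ d p q → con 1ℚ :* (d :* p) :+ con 0ℚ :* (d :* q) := d :* (con 1ℚ :* p)) refl d (r u v) (r v u))
      by-order (tri> _ _ v<u) = trans (cong₂ (λ p q → b2ℚ p * (d * r u v) + b2ℚ q * (d * r v u)) (≮⇒<ᵇ≡ (ℕ.<-asym v<u)) (<⇒<ᵇ≡ v<u))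
        (trans (solve 3 (λ d p q → con 0ℚ :* (d :* p) :+ con 1ℚ :* (d :* q) := d :* (con 1ℚ :* q)) refl d (r u v) (r v u))
          (cong (λ t → d * (1ℚ * t)) (r-sym {S = S} {E = adj G} {r = r} (Graph.sym G) res v u (all v) (all u))))
      by-order (tri≈ _ e _) = trans (cong₂ (λ p q → b2ℚ (lower u v) * (d * p) + b2ℚ (lower v u) * (d * q)) (zero-r u v (Fin.toℕ-injective e)) (zero-r v u (≡-sym (Fin.toℕ-injective e))))
        (trans (solve 3 (λ d p q → p :* (d :* con 0ℚ) :+ q :* (d :* con 0ℚ) := d :* (con 1ℚ :* con 0ℚ)) refl d (b2ℚ (lower u v)) (b2ℚ (lower v u)))
          (cong (λ t → d * (1ℚ * t)) (≡-sym (zero-r u v (Fin.toℕ-injective e)))))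
        where
        zero-r : ∀ u v → u ≡ v → r u v ≡ 0ℚ
        zero-r u .u refl = r-diag {S = S} {E = adj G} {r = r} (Graph.sym G) res u (all u)

twoRegular : {G : Graph n} {C : EdgeSet n} → IsCycle G C → TwoRegular C (adj G)
twoRegular cyc = record { sym-C = csym ; ⊆E = sub ; nonempty = nonempty ; deg02 = deg02 }
  where open IsCycle cyc

P33-total : ∀ m {n} → n ≡ 5 ℕ.+ m → (r : Fin n → Fin n → ℚ) → IsResistance (P33 n) r → DR (P33 n) r ≡ Level.totalMax level₂ (ι n)
P33-total m {n} refl r isR = begin
  DR (P33 n) r
    ≡⟨ DR-total (P33 n) {S = initial n} all isR ⟩
  total (initial n) (adjP n) r
    ≡⟨ TwoTriangles.twoTriangles-total n m refl (λ u v _ _ → isR u v) ⟩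
  Level.totalMax level₂ (ι (card (initial {n} n)))
    ≡⟨ cong (λ k → Level.totalMax level₂ (ι k)) (card-all all) ⟩
  Level.totalMax level₂ (ι n) ∎
  where
  open ≡-Reasoning
  all : ∀ (u : Fin n) → initial n u ≡ true
  all u = <⇒<ᵇ≡ (Fin.toℕ<n u)

maximum-value : ∀ N → Level.totalMax level₂ N ≡ ((+ 2 / 3) * (N * N * N) + N * N - (+ 19 / 1) * N) + (+ 88 / 3)
maximum-value = solve 1 (λ N →
  con ⅓ :* (N :* (N :- con 1ℚ) :* (con 2ℚ :* N :- con 1ℚ)) :+ con 2ℚ :* (N :* N) :+ (con 2ℚ :- con (+ 64 / 3)) :* N :- con (- (+ 88 / 3))
  := (con (+ 2 / 3) :* (N :* N :* N) :+ N :* N :- con (+ 19 / 1) :* N) :+ con (+ 88 / 3)) refl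

theorem4p2 : (n : ℕ) → 5 ≤ n →
    ((G : Graph n) → Bicyclic G → ExactlyTwoCycles G →
    (rG rP : _) → IsResistance G rG → IsResistance (P33 n) rP →
    DR G rG ≤ℚ DR (P33 n) rP)
    × ((rP : _) → IsResistance (P33 n) rP →
    DR (P33 n) rP ≡
    ((+ 2 / 3) * (ℕ→ℚ n * ℕ→ℚ n * ℕ→ℚ n) + ℕ→ℚ n * ℕ→ℚ n
    - (+ 19 / 1) * ℕ→ℚ n) + (+ 88 / 3))
theorem4p2 n 5≤n = maximal , λ rP isP → trans (P33-total m n≡ rP isP) (maximum-value (ι n))
  where
  m : ℕ
  m = n ℕ.∸ 5
  n≡ : n ≡ 5 ℕ.+ m
  n≡ = ≡-sym (ℕ.m+[n∸m]≡n 5≤n)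
  everything : VertexSet n
  everything _ = true
  maximal : (G : Graph n) → Bicyclic G → ExactlyTwoCycles G → ∀ rG rP → IsResistance G rG → IsResistance (P33 n) rP → DR G rG ≤ℚ DR (P33 n) rP
  maximal G bicyclic (C₁ , C₂ , cyc₁ , cyc₂ , distinct , only) rG rP isG isP = begin
    DR G rG
      ≡⟨ DR-total G {S = everything} (λ _ → refl) isG ⟩
    total everything (adj G) rG
      ≤⟨ Bounded.total-≤ bounded ⟩
    Level.totalMax level₂ (ι (card everything))
      ≡⟨ cong (λ k → Level.totalMax level₂ (ι k)) (card-all {S = everything} (λ _ → refl)) ⟩
    Level.totalMax level₂ (ι n)
      ≡⟨ P33-total m n≡ rP isP ⟨
    DR (P33 n) rP ∎
    where
    open ℚ.≤-Reasoning
    bounded : Bounded level₂ everything (adj G) rG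
    bounded = bicyclic-bounded (card everything) refl (graph-net G (λ _ → refl) n≡ bicyclic) (twoRegular cyc₁) (twoRegular cyc₂)
      (twoCycles-noShare G cyc₁ cyc₂ distinct only) (λ u v _ _ → isG u v)
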